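{- For every positive integer $m$, there exists an irreducible odd unimodular lattice $L_m$ of rank $24m$ and minimum norm $3$ that is $3$-integrable and generated (over $\mathbb{Z}$) by its minimal vectors.
   Context: All lattices are Euclidean, and the norm of a lattice vector $\mathbf{v}$ is its squared Euclidean length $\mathbf{v}\cdot\mathbf{v}$. Generation of lattices is over $\mathbb{Z}$. For an $n$-dimensional lattice $L$ (of full rank in $\mathbb{R}^n$), the dual lattice is $L^*=\{\mathbf{x}\in\mathbb{R}^n : \mathbf{x}\cdot\mathbf{y}\in\mathbb{Z}\text{ for all }\mathbf{y}\in L\}$. $L$ is unimodular if $L=L^*$. A unimodular lattice is even if all its vectors have even norm, and odd if some vector has odd norm. The minimum norm of $L$ is the smallest norm of a nonzero vector of $L$; $\operatorname{Min}(L)$ is the set of vectors attaining it (the minimal vectors), and $L$ is generated by its minimal vectors if $L=\langle\operatorname{Min}(L)\rangle_{\mathbb{Z}}$. A lattice is irreducible if it admits no orthogonal decomposition into two nonzero sublattices. For a positive integer $s$, a lattice $L$ is $s$-integrable if $\sqrt{s}\,L$ is isometric to a sublattice (of possibly smaller rank) of $\mathbb{Z}^N$ for some positive integer $N$. -}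

module Defs where

open import Algebra.Bundles using (CommutativeRing)
open import Algebra.Definitions.RawMonoid using () renaming (sum to rawSum)
open import Data.Fin using (Fin)
open import Data.Integer as ℤ using (ℤ; +_)
open import Data.Nat as ℕ using (ℕ)
import Data.Nat.Properties as ℕ
open import Data.Product using (Σ; _×_; _,_; proj₁; ∃; ∃-syntax; Σ-syntax)
open import Data.Rational as ℚ using (ℚ; 0ℚ; 1ℚ; ½; ∣_∣)
import Data.Rational.Properties as ℚ
open import Data.Rational.Solver using (module +-*-Solver)
open import Data.Vec.Functional using (Vector; zipWith; map; replicate)
import Data.Vec.Functional.Relation.Binary.Equality.Setoid as VecEq
open import Function.Bundles using (Bijection)
open import Level using (0ℓ)
open import Relation.Binary.Bundles using (Setoid)
open import Relation.Binary.Structures using (IsEquivalence)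
import Relation.Binary.Construct.On as On
open import Relation.Binary.PropositionalEquality
  using (_≡_; refl; sym; trans; cong; cong₂; subst)
open import Relation.Nullary using (¬_)
open import Relation.Unary using (Pred; _∈_; _⊆_; _≐_)

private
  half+half : ∀ ε → ½ ℚ.* ε ℚ.+ ½ ℚ.* ε ≡ ε
  half+half ε = trans (sym (ℚ.*-distribʳ-+ ε ½ ½)) (ℚ.*-identityˡ ε)

  *-pos : ∀ {p q} → 0ℚ ℚ.< p → 0ℚ ℚ.< q → 0ℚ ℚ.< p ℚ.* q
  *-pos {p} {q} p>0 q>0 = ℚ.positive⁻¹ (p ℚ.* q)
    {{ℚ.pos*pos⇒pos p {{ℚ.positive p>0}} q {{ℚ.positive q>0}}}}

  half>0 : ∀ {ε} → 0ℚ ℚ.< ε → 0ℚ ℚ.< ½ ℚ.* ε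
  half>0 = *-pos (ℚ.positive⁻¹ ½)

  shrink : ∀ B → 0ℚ ℚ.< B → ∀ ε → 0ℚ ℚ.< ε → ∃[ δ ] (0ℚ ℚ.< δ × B ℚ.* δ ≡ ε)
  shrink B B>0 ε ε>0 = B⁻¹ ℚ.* ε , *-pos B⁻¹>0 ε>0
    , trans (sym (ℚ.*-assoc B B⁻¹ ε))
        (trans (cong (ℚ._* ε) (ℚ.*-inverseʳ B)) (ℚ.*-identityˡ ε))
    where
    instance
      B-pos : ℚ.Positive B
      B-pos = ℚ.positive B>0
      B-nonZero : ℚ.NonZero B
      B-nonZero = ℚ.pos⇒nonZero B
    B⁻¹ : ℚ
    B⁻¹ = ℚ.1/ B
    B⁻¹>0 : 0ℚ ℚ.< B⁻¹
    B⁻¹>0 = ℚ.positive⁻¹ B⁻¹ {{ℚ.1/pos⇒pos B}}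

  <-half+half : ∀ {a b c ε} → a ℚ.≤ b ℚ.+ c →
                b ℚ.< ½ ℚ.* ε → c ℚ.< ½ ℚ.* ε → a ℚ.< ε
  <-half+half {ε = ε} a≤b+c b< c< =
    ℚ.≤-<-trans a≤b+c (subst (_ ℚ.<_) (half+half ε) (ℚ.+-mono-< b< c<))

  ∣-∣-swap : ∀ p q → ∣ p ℚ.- q ∣ ≡ ∣ q ℚ.- p ∣
  ∣-∣-swap p q = trans (sym (ℚ.∣-p∣≡∣p∣ (p ℚ.- q)))
    (cong ∣_∣ (solve 2 (λ p q → :- (p :- q) := q :- p) refl p q))
    where open +-*-Solver

  ∣-∣-neg : ∀ p q → ∣ p ℚ.- q ∣ ≡ ∣ (ℚ.- p) ℚ.- (ℚ.- q) ∣
  ∣-∣-neg p q = trans (∣-∣-swap p q)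
    (cong ∣_∣ (solve 2 (λ p q → q :- p := (:- p) :- (:- q)) refl p q))
    where open +-*-Solver

  ∣-∣-split : ∀ {p} q r → q ℚ.+ r ≡ p → ∣ p ∣ ℚ.≤ ∣ q ∣ ℚ.+ ∣ r ∣
  ∣-∣-split q r refl = ℚ.∣p+q∣≤∣p∣+∣q∣ q r

  triangle : ∀ p q r → ∣ p ℚ.- r ∣ ℚ.≤ ∣ p ℚ.- q ∣ ℚ.+ ∣ q ℚ.- r ∣
  triangle p q r = ∣-∣-split (p ℚ.- q) (q ℚ.- r)
    (solve 3 (λ p q r → (p :- q) :+ (q :- r) := p :- r) refl p q r)
    where open +-*-Solver

  ∣-∣-bound : ∀ p q → ∣ p ∣ ℚ.≤ ∣ p ℚ.- q ∣ ℚ.+ ∣ q ∣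
  ∣-∣-bound p q = ∣-∣-split (p ℚ.- q) q
    (solve 2 (λ p q → (p :- q) :+ q := p) refl p q)
    where open +-*-Solver

  +-diff : ∀ a a′ b b′ → ∣ (a ℚ.+ b) ℚ.- (a′ ℚ.+ b′) ∣ ℚ.≤ ∣ a ℚ.- a′ ∣ ℚ.+ ∣ b ℚ.- b′ ∣
  +-diff a a′ b b′ = ∣-∣-split (a ℚ.- a′) (b ℚ.- b′)
    (solve 4 (λ a a′ b b′ → (a :- a′) :+ (b :- b′) := (a :+ b) :- (a′ :+ b′)) refl a a′ b b′)
    where open +-*-Solver

  *-diff : ∀ a a′ b b′ → ∣ a ℚ.* b ℚ.- a′ ℚ.* b′ ∣ ℚ.≤
           ∣ a ∣ ℚ.* ∣ b ℚ.- b′ ∣ ℚ.+ ∣ b′ ∣ ℚ.* ∣ a ℚ.- a′ ∣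
  *-diff a a′ b b′ = ℚ.≤-trans
    (∣-∣-split (a ℚ.* (b ℚ.- b′)) (b′ ℚ.* (a ℚ.- a′))
      (solve 4 (λ a a′ b b′ → a :* (b :- b′) :+ b′ :* (a :- a′) := a :* b :- a′ :* b′)
        refl a a′ b b′))
    (ℚ.≤-reflexive (cong₂ ℚ._+_ (ℚ.∣p*q∣≡∣p∣*∣q∣ a (b ℚ.- b′)) (ℚ.∣p*q∣≡∣p∣*∣q∣ b′ (a ℚ.- a′))))
    where open +-*-Solver

  *-small : ∀ a d {B δ ε} → 0ℚ ℚ.< B → ∣ a ∣ ℚ.≤ B → ∣ d ∣ ℚ.< δ → B ℚ.* δ ≡ ε →
            ∣ a ∣ ℚ.* ∣ d ∣ ℚ.< ε
  *-small a d {B} B>0 a≤B d<δ refl = ℚ.≤-<-trans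
    (ℚ.*-monoʳ-≤-nonNeg ∣ d ∣ {{ℚ.nonNegative (ℚ.0≤∣p∣ d)}} a≤B)
    (ℚ.*-monoʳ-<-pos B {{ℚ.positive B>0}} d<δ)

  *-close : ∀ a a′ b b′ {A B α β ε} → 0ℚ ℚ.< A → 0ℚ ℚ.< B →
            A ℚ.* α ≡ ½ ℚ.* ε → B ℚ.* β ≡ ½ ℚ.* ε → ∣ a ∣ ℚ.≤ A → ∣ b′ ∣ ℚ.≤ B →
            ∣ b ℚ.- b′ ∣ ℚ.< α → ∣ a ℚ.- a′ ∣ ℚ.< β → ∣ a ℚ.* b ℚ.- a′ ℚ.* b′ ∣ ℚ.< ε
  *-close a a′ b b′ {A} {B} {α} {β} {ε} A>0 B>0 Aα≡ Bβ≡ a≤A b′≤B b-b′<α a-a′<β =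
    <-half+half {b = ∣ a ∣ ℚ.* ∣ b ℚ.- b′ ∣} {c = ∣ b′ ∣ ℚ.* ∣ a ℚ.- a′ ∣} {ε = ε}
      (*-diff a a′ b b′)
      (*-small a (b ℚ.- b′) {ε = ½ ℚ.* ε} A>0 a≤A b-b′<α Aα≡)
      (*-small b′ (a ℚ.- a′) {ε = ½ ℚ.* ε} B>0 b′≤B a-a′<β Bβ≡)

  ≡⇒∣-∣< : ∀ {p q ε} → 0ℚ ℚ.< ε → p ≡ q → ∣ p ℚ.- q ∣ ℚ.< ε
  ≡⇒∣-∣< {p} ε>0 refl = subst (λ t → ∣ t ∣ ℚ.< _) (sym (ℚ.+-inverseʳ p)) ε>0

-- Cauchy reals: since quotients are unavailable, sequences whose difference
-- tends to 0 are identified by the setoid equality _≈_, and every notion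
-- below is stated up to _≈_.

record ℝ : Set where
  constructor mkℝ
  field
    seq    : ℕ → ℚ
    cauchy : ∀ ε → 0ℚ ℚ.< ε →
             ∃[ N ] ∀ m n → N ℕ.≤ m → N ℕ.≤ n → ∣ seq m ℚ.- seq n ∣ ℚ.< ε
open ℝ public

infix 4 _≈_ _≤_

_≈_ : ℝ → ℝ → Set
x ≈ y = ∀ ε → 0ℚ ℚ.< ε → ∃[ N ] ∀ n → N ℕ.≤ n → ∣ seq x n ℚ.- seq y n ∣ ℚ.< ε

_≤_ : ℝ → ℝ → Set
x ≤ y = ∀ ε → 0ℚ ℚ.< ε → ∃[ N ] ∀ n → N ℕ.≤ n → seq x n ℚ.< seq y n ℚ.+ ε

fromℚ : ℚ → ℝ
fromℚ q = mkℝ (λ _ → q) λ ε ε>0 → 0 , λ _ _ _ _ → ≡⇒∣-∣< {q} ε>0 refl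

fromℤ : ℤ → ℝ
fromℤ z = fromℚ (z ℚ./ 1)

private
  ⊔-left : ∀ {N M n} → N ℕ.⊔ M ℕ.≤ n → N ℕ.≤ n
  ⊔-left {N} {M} = ℕ.≤-trans (ℕ.m≤m⊔n N M)

  ⊔-right : ∀ {N M n} → N ℕ.⊔ M ℕ.≤ n → M ℕ.≤ n
  ⊔-right {N} {M} = ℕ.≤-trans (ℕ.m≤n⊔m N M)

  bounded : ∀ x → ∃[ B ] (0ℚ ℚ.< B × ∃[ N ] ∀ n → N ℕ.≤ n → ∣ seq x n ∣ ℚ.≤ B)
  bounded x with cauchy x 1ℚ (ℚ.positive⁻¹ 1ℚ)
  ... | N , close = 1ℚ ℚ.+ ∣ seq x N ∣
    , ℚ.+-mono-<-≤ (ℚ.positive⁻¹ 1ℚ) (ℚ.0≤∣p∣ (seq x N))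
    , N , λ n N≤n → ℚ.≤-trans (∣-∣-bound (seq x n) (seq x N))
        (ℚ.+-monoˡ-≤ ∣ seq x N ∣ (ℚ.<⇒≤ (close n N N≤n ℕ.≤-refl)))

infixl 6 _+_
infixl 7 _*_
infix  8 -_

_+_ : ℝ → ℝ → ℝ
seq (x + y) n = seq x n ℚ.+ seq y n
cauchy (x + y) ε ε>0
  with cauchy x (½ ℚ.* ε) (half>0 ε>0) | cauchy y (½ ℚ.* ε) (half>0 ε>0)
... | N , p | M , q = N ℕ.⊔ M , λ m n N≤m N≤n →
  <-half+half (+-diff (seq x m) (seq x n) (seq y m) (seq y n))
    (p m n (⊔-left N≤m) (⊔-left N≤n)) (q m n (⊔-right {N} N≤m) (⊔-right {N} N≤n))

-_ : ℝ → ℝ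
seq (- x) n = ℚ.- seq x n
cauchy (- x) ε ε>0 =
  let N , p = cauchy x ε ε>0
  in N , λ m n N≤m N≤n →
    subst (ℚ._< ε) (∣-∣-neg (seq x m) (seq x n)) (p m n N≤m N≤n)

_*_ : ℝ → ℝ → ℝ
seq (x * y) n = seq x n ℚ.* seq y n
cauchy (x * y) ε ε>0 =
  let A , A>0 , K , x≤A = bounded x
      B , B>0 , L , y≤B = bounded y
      α , α>0 , Aα≡ = shrink A A>0 (½ ℚ.* ε) (half>0 ε>0)
      β , β>0 , Bβ≡ = shrink B B>0 (½ ℚ.* ε) (half>0 ε>0)
      M , q = cauchy y α α>0
      N , p = cauchy x β β>0
  in (K ℕ.⊔ L) ℕ.⊔ (M ℕ.⊔ N) , λ m n ≤m ≤n →
    *-close (seq x m) (seq x n) (seq y m) (seq y n) {A} {B} {α} {β} {ε} A>0 B>0 Aα≡ Bβ≡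
      (x≤A m (⊔-left {K} (⊔-left {K ℕ.⊔ L} ≤m)))
      (y≤B n (⊔-right {K} (⊔-left {K ℕ.⊔ L} ≤n)))
      (q m n (⊔-left {M} (⊔-right {K ℕ.⊔ L} ≤m)) (⊔-left {M} (⊔-right {K ℕ.⊔ L} ≤n)))
      (p m n (⊔-right {M} (⊔-right {K ℕ.⊔ L} ≤m)) (⊔-right {M} (⊔-right {K ℕ.⊔ L} ≤n)))

private
  pointwise : ∀ {x y} → (∀ n → seq x n ≡ seq y n) → x ≈ y
  pointwise eq ε ε>0 = 0 , λ n _ → ≡⇒∣-∣< ε>0 (eq n)

  ≈-sym : ∀ {x y} → x ≈ y → y ≈ x
  ≈-sym {x} {y} x≈y ε ε>0 with x≈y ε ε>0
  ... | N , p = N , λ n N≤n → subst (ℚ._< ε) (∣-∣-swap (seq x n) (seq y n)) (p n N≤n)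

  ≈-trans : ∀ {x y z} → x ≈ y → y ≈ z → x ≈ z
  ≈-trans {x} {y} {z} x≈y y≈z ε ε>0
    with x≈y (½ ℚ.* ε) (half>0 ε>0) | y≈z (½ ℚ.* ε) (half>0 ε>0)
  ... | N , p | M , q = N ℕ.⊔ M , λ n ≤n →
    <-half+half (triangle (seq x n) (seq y n) (seq z n)) (p n (⊔-left ≤n)) (q n (⊔-right {N} ≤n))

  ≈-isEquivalence : IsEquivalence _≈_
  ≈-isEquivalence = record
    { refl  = λ {x} → pointwise {x} {x} λ _ → refl
    ; sym   = λ {x} {y} → ≈-sym {x} {y}
    ; trans = λ {x} {y} {z} → ≈-trans {x} {y} {z}
    }

  +-cong : ∀ {x x′ y y′} → x ≈ x′ → y ≈ y′ → x + y ≈ x′ + y′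
  +-cong {x} {x′} {y} {y′} x≈ y≈ ε ε>0
    with x≈ (½ ℚ.* ε) (half>0 ε>0) | y≈ (½ ℚ.* ε) (half>0 ε>0)
  ... | N , p | M , q = N ℕ.⊔ M , λ n ≤n →
    <-half+half (+-diff (seq x n) (seq x′ n) (seq y n) (seq y′ n))
      (p n (⊔-left ≤n)) (q n (⊔-right {N} ≤n))

  -‿cong : ∀ {x y} → x ≈ y → - x ≈ - y
  -‿cong {x} {y} x≈y ε ε>0 =
    let N , p = x≈y ε ε>0
    in N , λ n N≤n → subst (ℚ._< ε) (∣-∣-neg (seq x n) (seq y n)) (p n N≤n)

  *-cong : ∀ {x x′ y y′} → x ≈ x′ → y ≈ y′ → x * y ≈ x′ * y′
  *-cong {x} {x′} {y} {y′} x≈ y≈ ε ε>0 =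
    let A , A>0 , K , x≤A = bounded x
        B , B>0 , L , y≤B = bounded y′
        α , α>0 , Aα≡ = shrink A A>0 (½ ℚ.* ε) (half>0 ε>0)
        β , β>0 , Bβ≡ = shrink B B>0 (½ ℚ.* ε) (half>0 ε>0)
        M , q = y≈ α α>0
        N , p = x≈ β β>0
    in (K ℕ.⊔ L) ℕ.⊔ (M ℕ.⊔ N) , λ n ≤n →
      *-close (seq x n) (seq x′ n) (seq y n) (seq y′ n) {A} {B} {α} {β} {ε} A>0 B>0 Aα≡ Bβ≡
        (x≤A n (⊔-left {K} (⊔-left {K ℕ.⊔ L} ≤n)))
        (y≤B n (⊔-right {K} (⊔-left {K ℕ.⊔ L} ≤n)))
        (q n (⊔-left {M} (⊔-right {K ℕ.⊔ L} ≤n)))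
        (p n (⊔-right {M} (⊔-right {K ℕ.⊔ L} ≤n)))

0ℝ 1ℝ : ℝ
0ℝ = fromℚ 0ℚ
1ℝ = fromℚ 1ℚ

ℝ-commutativeRing : CommutativeRing 0ℓ 0ℓ
ℝ-commutativeRing = record
  { Carrier = ℝ ; _≈_ = _≈_ ; _+_ = _+_ ; _*_ = _*_ ; -_ = -_ ; 0# = 0ℝ ; 1# = 1ℝ
  ; isCommutativeRing = record
    { isRing = record
      { +-isAbelianGroup = record
        { isGroup = record
          { isMonoid = record
            { isSemigroup = record
              { isMagma = record
                { isEquivalence = ≈-isEquivalence
                ; ∙-cong = λ {x} {x′} {y} {y′} → +-cong {x} {x′} {y} {y′} }
              ; assoc = λ x y z → pointwise {(x + y) + z} {x + (y + z)}
                  λ n → ℚ.+-assoc (seq x n) (seq y n) (seq z n) }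
            ; identity = (λ x → pointwise {0ℝ + x} {x} λ n → ℚ.+-identityˡ (seq x n))
                       , (λ x → pointwise {x + 0ℝ} {x} λ n → ℚ.+-identityʳ (seq x n)) }
          ; inverse = (λ x → pointwise {(- x) + x} {0ℝ} λ n → ℚ.+-inverseˡ (seq x n))
                    , (λ x → pointwise {x + (- x)} {0ℝ} λ n → ℚ.+-inverseʳ (seq x n))
          ; ⁻¹-cong = λ {x} {y} → -‿cong {x} {y} }
        ; comm = λ x y → pointwise {x + y} {y + x} λ n → ℚ.+-comm (seq x n) (seq y n) }
      ; *-cong = λ {x} {x′} {y} {y′} → *-cong {x} {x′} {y} {y′}
      ; *-assoc = λ x y z → pointwise {(x * y) * z} {x * (y * z)}
          λ n → ℚ.*-assoc (seq x n) (seq y n) (seq z n)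
      ; *-identity = (λ x → pointwise {1ℝ * x} {x} λ n → ℚ.*-identityˡ (seq x n))
                   , (λ x → pointwise {x * 1ℝ} {x} λ n → ℚ.*-identityʳ (seq x n))
      ; distrib = (λ x y z → pointwise {x * (y + z)} {x * y + x * z}
                     λ n → ℚ.*-distribˡ-+ (seq x n) (seq y n) (seq z n))
                , (λ x y z → pointwise {(y + z) * x} {y * x + z * x}
                     λ n → ℚ.*-distribʳ-+ (seq x n) (seq y n) (seq z n))
      }
    ; *-comm = λ x y → pointwise {x * y} {y * x} λ n → ℚ.*-comm (seq x n) (seq y n)
    }
  }

sum : ∀ {n} → Vector ℝ n → ℝ
sum = rawSum (CommutativeRing.+-rawMonoid ℝ-commutativeRing)

ℝ^_ : ℕ → Set
ℝ^ d = Vector ℝ d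

open VecEq (CommutativeRing.setoid ℝ-commutativeRing) public
  using (_≋_; ≋-setoid)

infixl 6 _+ᵥ_
infixr 7 _*ᵥ_
infix  7 _·_

0ᵥ : ∀ {d} → ℝ^ d
0ᵥ = replicate _ 0ℝ

_+ᵥ_ : ∀ {d} → ℝ^ d → ℝ^ d → ℝ^ d
_+ᵥ_ = zipWith _+_

_*ᵥ_ : ∀ {d} → ℝ → ℝ^ d → ℝ^ d
r *ᵥ v = map (r *_) v

_·_ : ∀ {d} → ℝ^ d → ℝ^ d → ℝ
v · w = sum (zipWith _*_ v w)

norm : ∀ {d} → ℝ^ d → ℝ
norm v = v · v

NonzeroVec : ∀ {d} → ℝ^ d → Set
NonzeroVec v = ¬ (v ≋ 0ᵥ)

combination : ∀ {d k} → Vector ℝ k → Vector (ℝ^ d) k → ℝ^ d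
combination c b j = sum λ i → c i * b i j

ℤ-combination : ∀ {d k} → Vector ℤ k → Vector (ℝ^ d) k → ℝ^ d
ℤ-combination c = combination (map fromℤ c)

LinearlyIndependent : ∀ {d k} → Vector (ℝ^ d) k → Set
LinearlyIndependent b = ∀ c → combination c b ≋ 0ᵥ → ∀ i → c i ≈ 0ℝ

-- A set of vectors is a predicate on ℝ^ d.  Nothing forces such a predicate
-- to respect _≋_, but every lattice does, being a ℤ-span.

Subset : ℕ → Set₁
Subset d = Pred (ℝ^ d) 0ℓ

ℤ-Span : ∀ {d k} → Vector (ℝ^ d) k → Subset d
ℤ-Span b v = ∃[ c ] v ≋ ℤ-combination c b

IsLattice : ∀ {d} (rank : ℕ) → Subset d → Set
IsLattice {d} rank L =
  Σ[ b ∈ Vector (ℝ^ d) rank ] (LinearlyIndependent b × L ≐ ℤ-Span b)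

-- The rank of a sublattice may be smaller than that of the ambient lattice.
Sublattice : ∀ {d} → Subset d → Subset d → Set
Sublattice M L = M ⊆ L × ∃[ k ] IsLattice k M

-- The ℤ-module generated by an arbitrary, possibly infinite, set.
⟨_⟩ : ∀ {d} → Subset d → Subset d
⟨_⟩ {d} S v = ∃[ k ] Σ[ s ∈ Vector (ℝ^ d) k ] ((∀ i → s i ∈ S) × v ∈ ℤ-Span s)

IsInteger : ℝ → Set
IsInteger x = ∃[ z ] x ≈ fromℤ z

-- Taken in all of ℝ^ d, hence a lattice only when L has full rank.
Dual : ∀ {d} → Subset d → Subset d
Dual L x = ∀ y → y ∈ L → IsInteger (x · y)

Unimodular : ∀ {d} → Subset d → Set
Unimodular L = L ≐ Dual L

HasOddNormVector : ∀ {d} → Subset d → Set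
HasOddNormVector L = ∃[ v ] (v ∈ L × ∃[ z ] norm v ≈ fromℤ (+ 1 ℤ.+ + 2 ℤ.* z))

IsMinimumNorm : ∀ {d} → Subset d → ℝ → Set
IsMinimumNorm L μ =
  (∃[ v ] (v ∈ L × NonzeroVec v × norm v ≈ μ)) ×
  (∀ w → w ∈ L → NonzeroVec w → μ ≤ norm w)

Min : ∀ {d} → Subset d → Subset d
Min L v = v ∈ L × NonzeroVec v × IsMinimumNorm L (norm v)

GeneratedByMinimalVectors : ∀ {d} → Subset d → Set
GeneratedByMinimalVectors L = L ≐ ⟨ Min L ⟩

Nonzero : ∀ {d} → Subset d → Set
Nonzero L = ∃[ v ] (v ∈ L × NonzeroVec v)

record OrthogonalDecomposition {d} (L : Subset d) : Set₁ where
  field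
    M₁ M₂        : Subset d
    M₁-sub       : Sublattice M₁ L
    M₂-sub       : Sublattice M₂ L
    M₁-nonzero   : Nonzero M₁
    M₂-nonzero   : Nonzero M₂
    orthogonal   : ∀ v w → v ∈ M₁ → w ∈ M₂ → v · w ≈ 0ℝ
    decompose    : ∀ v → v ∈ L → ∃[ v₁ ] ∃[ v₂ ] (v₁ ∈ M₁ × v₂ ∈ M₂ × v ≋ v₁ +ᵥ v₂)

Irreducible : ∀ {d} → Subset d → Set₁
Irreducible L = ¬ OrthogonalDecomposition L

Elements : ∀ {d} → Subset d → Setoid 0ℓ 0ℓ
Elements {d} L = On.setoid {B = Σ (ℝ^ d) L} (≋-setoid d) proj₁

record Isometry {d e} (L : Subset d) (M : Subset e) : Set where
  field
    bijection : Bijection (Elements L) (Elements M)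

  ⟦_⟧ : Σ (ℝ^ d) L → ℝ^ e
  ⟦ u ⟧ = proj₁ (Bijection.to bijection u)

  -- The sum is given as an element w because Elements carries no addition.
  field
    additive : ∀ u v w → proj₁ w ≋ proj₁ u +ᵥ proj₁ v → ⟦ w ⟧ ≋ ⟦ u ⟧ +ᵥ ⟦ v ⟧
    isometric : ∀ u v → ⟦ u ⟧ · ⟦ v ⟧ ≈ proj₁ u · proj₁ v

Scaled : ∀ {d} → ℝ → Subset d → Subset d
Scaled r L v = ∃[ w ] (w ∈ L × v ≋ r *ᵥ w)

ℤ^_ : ∀ N → Subset N
(ℤ^ N) v = ∀ i → IsInteger (v i)

IsSqrt : ℝ → ℝ → Set
IsSqrt x r = 0ℝ ≤ r × r * r ≈ x

Integrable : ∀ {d} (s : ℕ) .{{_ : ℕ.NonZero s}} → Subset d → Set₁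
Integrable s L =
  ∃[ √s ] (IsSqrt (fromℤ (+ s)) √s ×
    ∃[ N ] (ℕ.NonZero N ×
      Σ[ M ∈ Subset N ] (Sublattice M (ℤ^ N) × Isometry (Scaled √s L) M)))

{-# OPTIONS --safe #-}
-- The lattice is obtained by Construction A from a ternary self-dual code of length 24m, and √3 times
-- it is the integer lattice { u ∈ ℤ²⁴ᵐ : u mod 3 is a codeword }.  The code glues m copies of the Pless
-- symmetry code [24,12,9] in a chain.  Let x = a − a′ and y = b − b′ be words of weight 9 of the Pless
-- code with disjoint supports, split into parts a, b′ of weight 4 and a′, b of weight 5 such that
-- a, a′, b, b′ are pairwise orthogonal.  The generators are a basis of weight 9 words of the subcode
-- orthogonal to a and b in every block, the words (a | b) and (a′ | b′) on consecutive blocks, y in the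
-- first block and x in the last; all have weight 9.  A codeword whose blocks are not all in the Pless code
-- has a maximal run of glued blocks, whose two ends lie in cosets of minimum weight 4, so its weight is
-- at least 8, and at least 9 because weights of a self-dual ternary code are divisible by 3.  Hence the
-- minimum norm is 9/3 = 3.  A minimal vector cannot be split orthogonally, and the generators together
-- with the vectors 3eᵢ are connected by non-orthogonality, whence irreducibility.
module Submission where

open import Defs hiding (_*_)
open import Data.Integer using (+_)
open import Data.Nat using (ℕ; NonZero; _*_)
open import Data.Product using (Σ-syntax; _×_)

open import Algebra.Bundles using (CommutativeRing)
import Algebra.Properties.Semiring.Sum as SemiringSum
open import Algebra.Solver.Ring.AlmostCommutativeRing using (fromCommutativeRing)
import Algebra.Solver.Ring.Simple as RingSolver
open import Data.Bool using (Bool; T; _∧_; _∨_)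
open import Data.Bool.Properties using (T-∧; T-∨)
open import Data.Empty using (⊥; ⊥-elim)
open import Data.Fin using (Fin; zero; suc; #_; combine; remQuot; splitAt; _↑ˡ_; _↑ʳ_)
import Data.Fin.Properties as Fin
open import Data.Integer as ℤ using (ℤ; -[1+_]; 0ℤ)
import Data.Integer.Properties as ℤ
open import Data.Integer.Tactic.RingSolver using () renaming (solve-∀ to ℤ-solve-∀)
open import Data.Nat as ℕ using (zero; suc; z≤n; s≤s)
open import Data.Nat.Coprimality using (1-coprimeTo) renaming (sym to coprime-sym)
import Data.Nat.Properties as ℕ
open import Data.Nat.Tactic.RingSolver using () renaming (solve-∀ to ℕ-solve-∀)
open import Data.Product using (∃; ∃-syntax; _,_; proj₁; proj₂)
open import Data.Product.Properties using () renaming (≡-dec to ×-≡-dec)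
open import Data.Rational as ℚ using (ℚ; mkℚ; 0ℚ; 1ℚ; ½; ∣_∣; *≤*; *<*)
import Data.Rational.Properties as ℚ
open import Data.Rational.Solver using (module +-*-Solver)
open import Data.Sum using (_⊎_; inj₁; inj₂; [_,_]′)
open import Data.Unit using (⊤; tt)
open import Data.Vec as Vec using (Vec; []; _∷_; _++_; map; zipWith; replicate; lookup; tabulate)
open import Data.Vec.Functional as Vector using (Vector)
open import Data.Vec.Functional.Properties using (lookup-++ˡ; lookup-++ʳ)
import Data.Vec.Properties as Vec
open import Function using (_∘_; id)
open import Function.Bundles using (Equivalence)
open import Level using (0ℓ)
open import Relation.Binary.PropositionalEquality
  using (_≡_; _≢_; _≗_; refl; sym; trans; cong; cong₂; subst; subst₂; isEquivalence; module ≡-Reasoning)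
import Relation.Binary.Reasoning.Setoid as SetoidReasoning
open import Relation.Nullary using (¬_; Dec; yes; no; contradiction)
open import Relation.Nullary.Decidable using (from-yes; map′; _×-dec_; _⊎-dec_; _→-dec_; ¬?)
open import Relation.Unary using (_∈_)
open import Algebra.Properties.Semiring.Sum ℤ.+-*-semiring
  using (sum-cong-≗; ∑-distrib-+; ∑-comm; *-distribˡ-sum; sum-replicate-zero)
  renaming (sum to sumℤ)

-- Linear algebra over the field of three elements

-- For m > 1 the orthogonal sum of m Pless codes fails only by being decomposable, so words
-- straddling two blocks must be added without creating words of weight 3 or 6. Let C₀ be the span
-- of `gs`. Its dual modulo C₀ is a quadratic space of dimension 4 with orthogonal basis `a`, `a′`,
-- `b`, `b′`, whose norms 1, -1, -1, 1 are the weights 4, 5, 5, 4 modulo 3. Hence `a` ↦ `b`, `a′` ↦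
-- `b′` is an anti-isometry between the planes at the two ends of a block, and gluing consecutive
-- blocks along its graph yields a self-dual code again. This is why a part of weight 4 is always
-- paired with one of weight 5. The code is defined by parity checks, not as a span. One inclusion
-- of self-duality is a telescoping of inner products, the other reads the generators as checks;
-- that the generators span is a separate induction. A lattice must come with an explicit basis,
-- which is extracted from the decidability of the code as a Hermite basis.

data 𝔽₃ : Set where
  0₃ 1₃ -1₃ : 𝔽₃

infixl 6 _+₃_
infixl 7 _*₃_
infix  8 -₃_

-₃_ : 𝔽₃ → 𝔽₃
-₃ 0₃  = 0₃
-₃ 1₃  = -1₃
-₃ -1₃ = 1₃

_+₃_ : 𝔽₃ → 𝔽₃ → 𝔽₃
0₃  +₃ y   = y
1₃  +₃ 0₃  = 1₃
1₃  +₃ 1₃  = -1₃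
1₃  +₃ -1₃ = 0₃
-1₃ +₃ 0₃  = -1₃
-1₃ +₃ 1₃  = 0₃
-1₃ +₃ -1₃ = 1₃

_*₃_ : 𝔽₃ → 𝔽₃ → 𝔽₃
0₃  *₃ y = 0₃
1₃  *₃ y = y
-1₃ *₃ y = -₃ y

infix 4 _≟₃_

_≟₃_ : (x y : 𝔽₃) → Dec (x ≡ y)
0₃  ≟₃ 0₃  = yes refl
0₃  ≟₃ 1₃  = no λ ()
0₃  ≟₃ -1₃ = no λ ()
1₃  ≟₃ 0₃  = no λ ()
1₃  ≟₃ 1₃  = yes refl
1₃  ≟₃ -1₃ = no λ ()
-1₃ ≟₃ 0₃  = no λ ()
-1₃ ≟₃ 1₃  = no λ ()
-1₃ ≟₃ -1₃ = yes refl

-- With `from-yes`, exhaustion turns every fixed identity or implication over 𝔽₃ into an evaluation.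
∀₃? : ∀ {P : 𝔽₃ → Set} → (∀ x → Dec (P x)) → Dec (∀ x → P x)
∀₃? {P} P? = map′ to (λ p → p 0₃ , p 1₃ , p -1₃) (P? 0₃ ×-dec P? 1₃ ×-dec P? -1₃)
  where
  to : P 0₃ × P 1₃ × P -1₃ → ∀ x → P x
  to (p , _ , _) 0₃  = p
  to (_ , p , _) 1₃  = p
  to (_ , _ , p) -1₃ = p

∃₃? : ∀ {P : 𝔽₃ → Set} → (∀ x → Dec (P x)) → Dec (∃ P)
∃₃? {P} P? = map′ to from (P? 0₃ ⊎-dec P? 1₃ ⊎-dec P? -1₃)
  where
  to : P 0₃ ⊎ P 1₃ ⊎ P -1₃ → ∃ P
  to (inj₁ p)        = 0₃ , p
  to (inj₂ (inj₁ p)) = 1₃ , p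
  to (inj₂ (inj₂ p)) = -1₃ , p
  from : ∃ P → P 0₃ ⊎ P 1₃ ⊎ P -1₃
  from (0₃ , p)  = inj₁ p
  from (1₃ , p)  = inj₂ (inj₁ p)
  from (-1₃ , p) = inj₂ (inj₂ p)

𝔽₃-commutativeRing : CommutativeRing 0ℓ 0ℓ
𝔽₃-commutativeRing = record
  { Carrier = 𝔽₃ ; _≈_ = _≡_ ; _+_ = _+₃_ ; _*_ = _*₃_ ; -_ = -₃_ ; 0# = 0₃ ; 1# = 1₃
  ; isCommutativeRing = record
    { isRing = record
      { +-isAbelianGroup = record
        { isGroup = record
          { isMonoid = record
            { isSemigroup = record
              { isMagma = record { isEquivalence = isEquivalence ; ∙-cong = cong₂ _+₃_ }
              ; assoc = from-yes (∀₃? λ x → ∀₃? λ y → ∀₃? λ z → (x +₃ y) +₃ z ≟₃ x +₃ (y +₃ z)) }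
            ; identity = (λ _ → refl) , from-yes (∀₃? λ x → x +₃ 0₃ ≟₃ x) }
          ; inverse = from-yes (∀₃? λ x → -₃ x +₃ x ≟₃ 0₃) , from-yes (∀₃? λ x → x +₃ -₃ x ≟₃ 0₃)
          ; ⁻¹-cong = cong -₃_ }
        ; comm = from-yes (∀₃? λ x → ∀₃? λ y → x +₃ y ≟₃ y +₃ x) }
      ; *-cong = cong₂ _*₃_
      ; *-assoc = from-yes (∀₃? λ x → ∀₃? λ y → ∀₃? λ z → (x *₃ y) *₃ z ≟₃ x *₃ (y *₃ z))
      ; *-identity = (λ _ → refl) , from-yes (∀₃? λ x → x *₃ 1₃ ≟₃ x)
      ; distrib =
            from-yes (∀₃? λ x → ∀₃? λ y → ∀₃? λ z → x *₃ (y +₃ z) ≟₃ x *₃ y +₃ x *₃ z)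
          , from-yes (∀₃? λ x → ∀₃? λ y → ∀₃? λ z → (y +₃ z) *₃ x ≟₃ y *₃ x +₃ z *₃ x) }
    ; *-comm = from-yes (∀₃? λ x → ∀₃? λ y → x *₃ y ≟₃ y *₃ x) } }

module 𝔽 = CommutativeRing 𝔽₃-commutativeRing
module 𝔽-Solver = RingSolver (fromCommutativeRing 𝔽₃-commutativeRing) _≟₃_

infixl 6 _⊞_
infixr 7 _⊡_

_⊞_ : ∀ {n} → Vec 𝔽₃ n → Vec 𝔽₃ n → Vec 𝔽₃ n
_⊞_ = zipWith _+₃_

_⊡_ : ∀ {n} → 𝔽₃ → Vec 𝔽₃ n → Vec 𝔽₃ n
c ⊡ v = map (c *₃_) v

𝟎 : ∀ {n} → Vec 𝔽₃ n
𝟎 = replicate _ 0₃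

dot : ∀ {n} → Vec 𝔽₃ n → Vec 𝔽₃ n → 𝔽₃
dot []      []      = 0₃
dot (x ∷ u) (y ∷ v) = x *₃ y +₃ dot u v

lincomb : ∀ {k n} → Vec 𝔽₃ k → Vec (Vec 𝔽₃ n) k → Vec 𝔽₃ n
lincomb []      []      = 𝟎
lincomb (c ∷ cs) (r ∷ rs) = c ⊡ r ⊞ lincomb cs rs

⊞-identityˡ : ∀ {n} (v : Vec 𝔽₃ n) → 𝟎 ⊞ v ≡ v
⊞-identityˡ = Vec.zipWith-identityˡ 𝔽.+-identityˡ

⊞-identityʳ : ∀ {n} (v : Vec 𝔽₃ n) → v ⊞ 𝟎 ≡ v
⊞-identityʳ = Vec.zipWith-identityʳ 𝔽.+-identityʳ

⊞-assoc : ∀ {n} (u v w : Vec 𝔽₃ n) → (u ⊞ v) ⊞ w ≡ u ⊞ (v ⊞ w)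
⊞-assoc = Vec.zipWith-assoc 𝔽.+-assoc

⊡-zeroˡ : ∀ {n} (v : Vec 𝔽₃ n) → 0₃ ⊡ v ≡ 𝟎
⊡-zeroˡ []      = refl
⊡-zeroˡ (x ∷ v) = cong (0₃ ∷_) (⊡-zeroˡ v)

⊡-zeroʳ : ∀ {n} c → c ⊡ 𝟎 {n} ≡ 𝟎
⊡-zeroʳ {zero}  c = refl
⊡-zeroʳ {suc n} c = cong₂ _∷_ (𝔽.zeroʳ c) (⊡-zeroʳ c)

⊡-distrib-⊞ : ∀ {n} c (u v : Vec 𝔽₃ n) → c ⊡ (u ⊞ v) ≡ c ⊡ u ⊞ c ⊡ v
⊡-distrib-⊞ c []      []      = refl
⊡-distrib-⊞ c (x ∷ u) (y ∷ v) = cong₂ _∷_ (𝔽.distribˡ c x y) (⊡-distrib-⊞ c u v)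

⊡-distrib-+ : ∀ {n} c d (v : Vec 𝔽₃ n) → (c +₃ d) ⊡ v ≡ c ⊡ v ⊞ d ⊡ v
⊡-distrib-+ c d []      = refl
⊡-distrib-+ c d (x ∷ v) = cong₂ _∷_ (𝔽.distribʳ x c d) (⊡-distrib-+ c d v)

⊡-⊡ : ∀ {n} c d (v : Vec 𝔽₃ n) → c ⊡ (d ⊡ v) ≡ (c *₃ d) ⊡ v
⊡-⊡ c d []      = refl
⊡-⊡ c d (x ∷ v) = cong₂ _∷_ (sym (𝔽.*-assoc c d x)) (⊡-⊡ c d v)

⊞-interchange : ∀ {n} (s t u v : Vec 𝔽₃ n) → (s ⊞ t) ⊞ (u ⊞ v) ≡ (s ⊞ u) ⊞ (t ⊞ v)
⊞-interchange [] [] [] [] = refl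
⊞-interchange (x ∷ s) (y ∷ t) (z ∷ u) (w ∷ v) =
  cong₂ _∷_ (solve 4 (λ x y z w → (x :+ y) :+ (z :+ w) := (x :+ z) :+ (y :+ w)) refl x y z w)
            (⊞-interchange s t u v)
  where open 𝔽-Solver

dot-comm : ∀ {n} (u v : Vec 𝔽₃ n) → dot u v ≡ dot v u
dot-comm []      []      = refl
dot-comm (x ∷ u) (y ∷ v) = cong₂ _+₃_ (𝔽.*-comm x y) (dot-comm u v)

dot-zeroˡ : ∀ {n} (v : Vec 𝔽₃ n) → dot 𝟎 v ≡ 0₃
dot-zeroˡ []      = refl
dot-zeroˡ (x ∷ v) = dot-zeroˡ v

dot-zeroʳ : ∀ {n} (v : Vec 𝔽₃ n) → dot v 𝟎 ≡ 0₃
dot-zeroʳ v = trans (dot-comm v 𝟎) (dot-zeroˡ v)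

dot-⊞ˡ : ∀ {n} (u v w : Vec 𝔽₃ n) → dot (u ⊞ v) w ≡ dot u w +₃ dot v w
dot-⊞ˡ [] [] [] = refl
dot-⊞ˡ (x ∷ u) (y ∷ v) (z ∷ w) = trans (cong ((x +₃ y) *₃ z +₃_) (dot-⊞ˡ u v w))
  (solve 5 (λ x y z p q → (x :+ y) :* z :+ (p :+ q) := (x :* z :+ p) :+ (y :* z :+ q))
    refl x y z (dot u w) (dot v w))
  where open 𝔽-Solver

dot-⊡ˡ : ∀ {n} c (u v : Vec 𝔽₃ n) → dot (c ⊡ u) v ≡ c *₃ dot u v
dot-⊡ˡ c [] [] = sym (𝔽.zeroʳ c)
dot-⊡ˡ c (x ∷ u) (y ∷ v) = trans (cong (c *₃ x *₃ y +₃_) (dot-⊡ˡ c u v))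
  (solve 4 (λ c x y p → c :* x :* y :+ c :* p := c :* (x :* y :+ p)) refl c x y (dot u v))
  where open 𝔽-Solver

dot-lincomb : ∀ {k n} (c : Vec 𝔽₃ k) R (v : Vec 𝔽₃ n) → dot (lincomb c R) v ≡ dot c (map (dot v) R)
dot-lincomb []       []       v = dot-zeroˡ v
dot-lincomb (c ∷ cs) (r ∷ R) v = trans (dot-⊞ˡ (c ⊡ r) (lincomb cs R) v)
  (cong₂ _+₃_ (trans (dot-⊡ˡ c r v) (cong (c *₃_) (dot-comm r v))) (dot-lincomb cs R v))

lincomb-zeroˡ : ∀ {k n} (R : Vec (Vec 𝔽₃ n) k) → lincomb 𝟎 R ≡ 𝟎
lincomb-zeroˡ []      = refl
lincomb-zeroˡ (r ∷ R) = trans (cong₂ _⊞_ (⊡-zeroˡ r) (lincomb-zeroˡ R)) (⊞-identityˡ 𝟎)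

lincomb-⊞ : ∀ {k n} (c d : Vec 𝔽₃ k) (R : Vec (Vec 𝔽₃ n) k) →
            lincomb (c ⊞ d) R ≡ lincomb c R ⊞ lincomb d R
lincomb-⊞ [] [] [] = sym (⊞-identityˡ 𝟎)
lincomb-⊞ (c ∷ cs) (d ∷ ds) (r ∷ R) = trans
  (cong₂ _⊞_ (⊡-distrib-+ c d r) (lincomb-⊞ cs ds R))
  (⊞-interchange (c ⊡ r) (d ⊡ r) (lincomb cs R) (lincomb ds R))

lincomb-⊡ : ∀ {k n} c (d : Vec 𝔽₃ k) (R : Vec (Vec 𝔽₃ n) k) → lincomb (c ⊡ d) R ≡ c ⊡ lincomb d R
lincomb-⊡ c [] [] = sym (⊡-zeroʳ c)
lincomb-⊡ c (d ∷ ds) (r ∷ R) = trans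
  (cong₂ _⊞_ (sym (⊡-⊡ c d r)) (lincomb-⊡ c ds R))
  (sym (⊡-distrib-⊞ c (d ⊡ r) (lincomb ds R)))

lincomb-++ : ∀ {k l n} (c : Vec 𝔽₃ k) (d : Vec 𝔽₃ l) (R : Vec (Vec 𝔽₃ n) k) S →
             lincomb (c ++ d) (R ++ S) ≡ lincomb c R ⊞ lincomb d S
lincomb-++ []       d []      S = sym (⊞-identityˡ (lincomb d S))
lincomb-++ (c ∷ cs) d (r ∷ R) S = trans (cong (c ⊡ r ⊞_) (lincomb-++ cs d R S))
  (sym (⊞-assoc (c ⊡ r) (lincomb cs R) (lincomb d S)))

record Linear {m n} (f : Vec 𝔽₃ m → Vec 𝔽₃ n) : Set where
  field
    ⊞-homo : ∀ u v → f (u ⊞ v) ≡ f u ⊞ f v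
    ⊡-homo : ∀ c v → f (c ⊡ v) ≡ c ⊡ f v

  𝟎-homo : f 𝟎 ≡ 𝟎
  𝟎-homo = trans (cong f (sym (⊡-zeroˡ 𝟎))) (trans (⊡-homo 0₃ 𝟎) (⊡-zeroˡ (f 𝟎)))

  lincomb-homo : ∀ {k} (c : Vec 𝔽₃ k) R → f (lincomb c R) ≡ lincomb c (map f R)
  lincomb-homo []       []      = 𝟎-homo
  lincomb-homo (c ∷ cs) (r ∷ R) = trans (⊞-homo (c ⊡ r) (lincomb cs R))
    (cong₂ _⊞_ (⊡-homo c r) (lincomb-homo cs R))

  -- Reduces a claim about all words of a span to its generators, where the hypothesis holds by
  -- `refl`.
  fixes-lincomb : ∀ {k} (c : Vec 𝔽₃ k) R (R′ : Vec (Vec 𝔽₃ n) k) → map f R ≡ R′ → f (lincomb c R) ≡ lincomb c R′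
  fixes-lincomb c R R′ eq = trans (lincomb-homo c R) (cong (lincomb c) eq)
open Linear

map-dot-⊞ : ∀ {k n} (u v : Vec 𝔽₃ n) (R : Vec _ k) → map (dot (u ⊞ v)) R ≡ map (dot u) R ⊞ map (dot v) R
map-dot-⊞ u v []      = refl
map-dot-⊞ u v (r ∷ R) = cong₂ _∷_ (dot-⊞ˡ u v r) (map-dot-⊞ u v R)

map-dot-⊡ : ∀ {k n} c (v : Vec 𝔽₃ n) (R : Vec _ k) → map (dot (c ⊡ v)) R ≡ c ⊡ map (dot v) R
map-dot-⊡ c v []      = refl
map-dot-⊡ c v (r ∷ R) = cong₂ _∷_ (dot-⊡ˡ c v r) (map-dot-⊡ c v R)

expand-linear : ∀ {k m n} (H : Vec (Vec 𝔽₃ m) k) (R : Vec (Vec 𝔽₃ n) k) →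
                Linear (λ u → lincomb (map (dot u) H) R)
expand-linear H R .⊞-homo u v =
  trans (cong (λ c → lincomb c R) (map-dot-⊞ u v H)) (lincomb-⊞ (map (dot u) H) (map (dot v) H) R)
expand-linear H R .⊡-homo c v =
  trans (cong (λ c → lincomb c R) (map-dot-⊡ c v H)) (lincomb-⊡ c (map (dot v) H) R)

basisVectors : ∀ n → Vec (Vec 𝔽₃ n) n
basisVectors zero    = []
basisVectors (suc n) = (1₃ ∷ 𝟎) ∷ map (0₃ ∷_) (basisVectors n)

lincomb-0∷ : ∀ {k n} (c : Vec 𝔽₃ k) (R : Vec (Vec 𝔽₃ n) k) →
             lincomb c (map (0₃ ∷_) R) ≡ 0₃ ∷ lincomb c R
lincomb-0∷ []       []      = refl
lincomb-0∷ (c ∷ cs) (r ∷ R) = trans (cong ((c *₃ 0₃ ∷ c ⊡ r) ⊞_) (lincomb-0∷ cs R))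
  (cong (_∷ (c ⊡ r ⊞ lincomb cs R)) (trans (𝔽.+-identityʳ (c *₃ 0₃)) (𝔽.zeroʳ c)))

lincomb-identity : ∀ {n} (u : Vec 𝔽₃ n) → lincomb u (basisVectors n) ≡ u
lincomb-identity []      = refl
lincomb-identity (x ∷ u) = trans
  (cong₂ _⊞_ (cong₂ _∷_ (𝔽.*-identityʳ x) (⊡-zeroʳ x)) (lincomb-0∷ u (basisVectors _)))
  (cong₂ _∷_ (𝔽.+-identityʳ x) (trans (⊞-identityˡ _) (lincomb-identity u)))

-- Hamming weight and a bounded search for light combinations

weight₁ : 𝔽₃ → ℕ
weight₁ 0₃  = 0
weight₁ 1₃  = 1
weight₁ -1₃ = 1

weight₁≤1 : ∀ c → weight₁ c ℕ.≤ 1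
weight₁≤1 = from-yes (∀₃? λ c → weight₁ c ℕ.≤? 1)

weight : ∀ {n} → Vec 𝔽₃ n → ℕ
weight []      = 0
weight (x ∷ v) = weight₁ x ℕ.+ weight v

weight≡0⇒𝟎 : ∀ {n} (v : Vec 𝔽₃ n) → weight v ≡ 0 → v ≡ 𝟎
weight≡0⇒𝟎 []       _  = refl
weight≡0⇒𝟎 (0₃ ∷ v) eq = cong (0₃ ∷_) (weight≡0⇒𝟎 v eq)

weight-⊡ : ∀ {n} c (v : Vec 𝔽₃ n) → weight (c ⊡ v) ℕ.≤ weight v
weight-⊡ c []      = z≤n
weight-⊡ c (x ∷ v) =
  ℕ.+-mono-≤ (from-yes (∀₃? λ c → ∀₃? λ x → weight₁ (c *₃ x) ℕ.≤? weight₁ x) c x) (weight-⊡ c v)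

weight-⊞ : ∀ {n} (u v : Vec 𝔽₃ n) → weight (u ⊞ v) ℕ.≤ weight u ℕ.+ weight v
weight-⊞ []      []      = z≤n
weight-⊞ (x ∷ u) (y ∷ v) = ℕ.≤-trans
  (ℕ.+-mono-≤
    (from-yes (∀₃? λ x → ∀₃? λ y → weight₁ (x +₃ y) ℕ.≤? weight₁ x ℕ.+ weight₁ y) x y)
    (weight-⊞ u v))
  (ℕ.≤-reflexive (interchange (weight₁ x) (weight₁ y) (weight u) (weight v)))
  where
  interchange : ∀ p q r s → (p ℕ.+ q) ℕ.+ (r ℕ.+ s) ≡ (p ℕ.+ r) ℕ.+ (q ℕ.+ s)
  interchange = ℕ-solve-∀

weight-++ : ∀ {m n} (u : Vec 𝔽₃ m) (v : Vec 𝔽₃ n) → weight (u ++ v) ≡ weight u ℕ.+ weight v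
weight-++ []      v = refl
weight-++ (x ∷ u) v = trans (cong (weight₁ x ℕ.+_) (weight-++ u v))
  (sym (ℕ.+-assoc (weight₁ x) (weight u) (weight v)))

-- check k R acc used inspects every combination of at most k rows of R, acc and used
-- being the partial sum of the rows already chosen and their number.
check : ∀ {m n} → ℕ → Vec (Vec 𝔽₃ n) m → Vec 𝔽₃ n → ℕ → Bool
check k       []      acc used = (used ℕ.≡ᵇ 0) ∨ (8 ℕ.≤ᵇ used ℕ.+ weight acc)
check zero    (r ∷ R) acc used = check zero R acc used
check (suc k) (r ∷ R) acc used =
  check (suc k) R acc used ∧ check k R (acc ⊞ 1₃ ⊡ r) (suc used) ∧ check k R (acc ⊞ -1₃ ⊡ r) (suc used)

T-∧-proj : ∀ p {q} → T (p ∧ q) → T p × T q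
T-∧-proj p = Equivalence.to (T-∧ {p})

-- The left alternative is the empty choice, which `check` lets pass. Each chosen row raises `used`
-- by one, so `used` plus the weight of the remaining coefficients stays the weight of the whole
-- coefficient vector.
check-sound : ∀ {m n} k (R : Vec (Vec 𝔽₃ n) m) acc used → T (check k R acc used) →
              ∀ q → weight q ℕ.≤ k →
              used ℕ.+ weight q ≡ 0 ⊎ 8 ℕ.≤ used ℕ.+ weight q ℕ.+ weight (acc ⊞ lincomb q R)
check-sound k [] acc used ok [] _ with Equivalence.to T-∨ ok
... | inj₁ p = inj₁ (trans (ℕ.+-identityʳ used) (ℕ.≡ᵇ⇒≡ used 0 p))
... | inj₂ p rewrite ℕ.+-identityʳ used | ⊞-identityʳ acc = inj₂ (ℕ.≤ᵇ⇒≤ 8 _ p)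
check-sound zero (r ∷ R) acc used ok (0₃ ∷ q) q≤0
  rewrite ⊡-zeroˡ r | ⊞-identityˡ (lincomb q R) = check-sound zero R acc used ok q q≤0
check-sound (suc k) (r ∷ R) acc used ok (0₃ ∷ q) q≤k
  rewrite ⊡-zeroˡ r | ⊞-identityˡ (lincomb q R) =
  check-sound (suc k) R acc used (proj₁ (T-∧-proj (check (suc k) R acc used) ok)) q q≤k
check-sound (suc k) (r ∷ R) acc used ok (1₃ ∷ q) (s≤s q≤k)
  rewrite ℕ.+-suc used (weight q) | sym (⊞-assoc acc (1₃ ⊡ r) (lincomb q R)) =
  let _ , plus∧minus = T-∧-proj (check (suc k) R acc used) ok
      plus , _       = T-∧-proj (check k R (acc ⊞ 1₃ ⊡ r) (suc used)) plus∧minus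
  in check-sound k R (acc ⊞ 1₃ ⊡ r) (suc used) plus q q≤k
check-sound (suc k) (r ∷ R) acc used ok (-1₃ ∷ q) (s≤s q≤k)
  rewrite ℕ.+-suc used (weight q) | sym (⊞-assoc acc (-1₃ ⊡ r) (lincomb q R)) =
  let _ , plus∧minus = T-∧-proj (check (suc k) R acc used) ok
      _ , minus      = T-∧-proj (check k R (acc ⊞ 1₃ ⊡ r) (suc used)) plus∧minus
  in check-sound k R (acc ⊞ -1₃ ⊡ r) (suc used) minus q q≤k

-- The Pless symmetry code

Block : Set
Block = Vec 𝔽₃ 24

infixr 5 ○_ ⊕_ ⊖_

□ : Vec 𝔽₃ 0
□ = []

○_ ⊕_ ⊖_ : ∀ {n} → Vec 𝔽₃ n → Vec 𝔽₃ (suc n)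
○ v = 0₃ ∷ v
⊕ v = 1₃ ∷ v
⊖ v = -1₃ ∷ v

-- The bordered Paley matrix P of order 12: P is skew and PPᵀ = −I, so the rows of (I | P) span a
-- self-dual code, the Pless symmetry code.
paley : Vec (Vec 𝔽₃ 12) 12
paley =
    (○ ⊕ ⊕ ⊕ ⊕ ⊕ ⊕ ⊕ ⊕ ⊕ ⊕ ⊕ □)
  ∷ (⊖ ○ ⊕ ⊖ ⊕ ⊕ ⊕ ⊖ ⊖ ⊖ ⊕ ⊖ □)
  ∷ (⊖ ⊖ ○ ⊕ ⊖ ⊕ ⊕ ⊕ ⊖ ⊖ ⊖ ⊕ □)
  ∷ (⊖ ⊕ ⊖ ○ ⊕ ⊖ ⊕ ⊕ ⊕ ⊖ ⊖ ⊖ □)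
  ∷ (⊖ ⊖ ⊕ ⊖ ○ ⊕ ⊖ ⊕ ⊕ ⊕ ⊖ ⊖ □)
  ∷ (⊖ ⊖ ⊖ ⊕ ⊖ ○ ⊕ ⊖ ⊕ ⊕ ⊕ ⊖ □)
  ∷ (⊖ ⊖ ⊖ ⊖ ⊕ ⊖ ○ ⊕ ⊖ ⊕ ⊕ ⊕ □)
  ∷ (⊖ ⊕ ⊖ ⊖ ⊖ ⊕ ⊖ ○ ⊕ ⊖ ⊕ ⊕ □)
  ∷ (⊖ ⊕ ⊕ ⊖ ⊖ ⊖ ⊕ ⊖ ○ ⊕ ⊖ ⊕ □)
  ∷ (⊖ ⊕ ⊕ ⊕ ⊖ ⊖ ⊖ ⊕ ⊖ ○ ⊕ ⊖ □)
  ∷ (⊖ ⊖ ⊕ ⊕ ⊕ ⊖ ⊖ ⊖ ⊕ ⊖ ○ ⊕ □)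
  ∷ (⊖ ⊕ ⊖ ⊕ ⊕ ⊕ ⊖ ⊖ ⊖ ⊕ ⊖ ○ □)
  ∷ []

-- A basis, of words of weight 9, of the subcode orthogonal to a and b.
gs : Vec (Vec 𝔽₃ 24) 10
gs =
    (⊕ ⊕ ⊕ ○ ⊖ ⊖ ○ ⊖ ○ ○ ⊕ ○ ○ ○ ⊕ ○ ⊕ ○ ○ ○ ○ ○ ○ ○ □)
  ∷ (⊕ ○ ⊖ ○ ○ ○ ○ ⊕ ○ ○ ○ ○ ○ ○ ○ ⊖ ⊕ ⊕ ⊖ ○ ○ ⊕ ○ ⊕ □)
  ∷ (⊕ ○ ○ ○ ○ ○ ⊕ ○ ⊕ ⊖ ○ ○ ⊖ ○ ○ ⊕ ⊖ ○ ○ ○ ⊕ ○ ○ ⊕ □)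
  ∷ (⊕ ○ ○ ○ ○ ⊕ ⊕ ○ ⊖ ○ ○ ⊕ ⊕ ⊖ ○ ○ ○ ⊖ ○ ⊕ ○ ○ ○ ○ □)
  ∷ (⊕ ⊖ ○ ○ ○ ○ ⊖ ○ ○ ⊕ ○ ⊖ ⊖ ⊖ ○ ○ ○ ⊖ ○ ○ ○ ○ ⊕ ○ □)
  ∷ (⊕ ○ ⊖ ○ ⊖ ○ ⊕ ○ ⊕ ○ ○ ○ ○ ○ ○ ⊖ ⊖ ○ ⊖ ⊖ ○ ○ ○ ○ □)
  ∷ (⊕ ⊕ ○ ○ ⊕ ○ ○ ○ ⊕ ○ ⊖ ○ ⊕ ⊖ ○ ○ ○ ○ ○ ⊕ ○ ○ ○ ⊖ □)
  ∷ (⊕ ○ ○ ⊕ ⊕ ○ ○ ○ ⊖ ○ ○ ○ ⊖ ○ ○ ⊕ ○ ⊖ ○ ⊕ ○ ○ ○ ⊕ □)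
  ∷ (⊕ ○ ⊕ ⊕ ⊕ ○ ○ ⊖ ○ ○ ⊕ ○ ○ ⊕ ○ ○ ○ ○ ⊖ ○ ⊖ ○ ○ ○ □)
  ∷ (⊕ ○ ○ ⊕ ○ ⊕ ⊕ ○ ⊖ ⊖ ○ ⊖ ○ ○ ○ ○ ○ ○ ⊕ ○ ⊕ ○ ○ ○ □)
  ∷ []

-- Dual to gs, isotropic, and orthogonal to a, a′, b, b′.
hs : Vec (Vec 𝔽₃ 24) 10
hs =
    (⊕ ⊖ ⊖ ⊕ ⊕ ○ ○ ○ ○ ○ ⊕ ⊖ ○ ○ ⊕ ○ ⊕ ○ ○ ○ ○ ○ ○ ○ □)
  ∷ (⊖ ⊕ ⊖ ○ ⊕ ○ ○ ⊖ ⊖ ⊕ ⊖ ⊕ ○ ○ ⊖ ⊖ ○ ⊕ ⊖ ○ ○ ⊕ ○ ⊕ □)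
  ∷ (⊕ ○ ⊖ ○ ⊕ ⊖ ⊕ ⊖ ⊖ ⊕ ⊖ ⊖ ⊖ ○ ○ ⊕ ○ ○ ○ ○ ⊕ ⊖ ○ ⊕ □)
  ∷ (⊕ ⊖ ⊕ ⊕ ○ ⊖ ○ ⊖ ○ ⊖ ⊖ ⊖ ⊖ ○ ⊕ ○ ○ ○ ○ ○ ○ ⊕ ○ ○ □)
  ∷ (○ ⊕ ⊕ ⊕ ○ ⊕ ⊖ ⊖ ○ ⊕ ⊕ ○ ⊖ ⊖ ○ ⊕ ○ ○ ○ ○ ○ ○ ⊕ ○ □)
  ∷ (○ ⊖ ⊕ ○ ○ ○ ⊖ ⊕ ○ ○ ⊖ ⊕ ⊕ ○ ⊖ ⊖ ○ ○ ⊖ ⊖ ○ ⊕ ○ ○ □)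
  ∷ (⊖ ⊕ ⊖ ○ ○ ○ ⊕ ⊕ ⊕ ⊕ ⊕ ⊕ ⊕ ⊖ ○ ○ ⊕ ○ ○ ⊕ ○ ⊖ ○ ⊖ □)
  ∷ (○ ⊕ ⊕ ⊖ ○ ⊖ ○ ○ ○ ⊖ ⊕ ○ ⊖ ○ ⊕ ⊕ ⊕ ○ ⊕ ⊖ ○ ⊕ ⊕ ⊕ □)
  ∷ (⊖ ⊕ ○ ⊖ ○ ⊖ ○ ○ ⊕ ⊕ ○ ⊖ ⊖ ⊕ ⊕ ⊕ ⊕ ⊖ ⊖ ⊖ ⊖ ○ ⊖ ⊕ □)
  ∷ (⊖ ⊕ ⊖ ⊕ ○ ⊕ ⊖ ○ ○ ○ ⊖ ⊖ ⊕ ⊖ ○ ⊖ ○ ⊖ ⊕ ⊖ ⊖ ⊖ ⊖ ⊖ □)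
  ∷ []

a : Block
a = ○ ○ ○ ○ ○ ⊕ ○ ○ ○ ○ ⊕ ⊕ ○ ⊖ ○ ○ ○ ○ ○ ○ ○ ○ ○ ○ □

a′ : Block
a′ = ○ ○ ○ ○ ○ ○ ○ ○ ○ ○ ○ ○ ○ ○ ⊕ ○ ⊖ ○ ⊕ ○ ⊖ ⊖ ○ ○ □

b : Block
b = ○ ○ ○ ○ ○ ○ ○ ○ ○ ○ ○ ○ ○ ○ ○ ⊕ ○ ⊖ ○ ⊖ ○ ○ ⊖ ⊖ □

b′ : Block
b′ = ○ ○ ○ ○ ○ ○ ⊕ ○ ⊖ ⊖ ○ ○ ⊕ ○ ○ ○ ○ ○ ○ ○ ○ ○ ○ ○ □

-- H₄ is dual to R₄, since a·a = b′·b′ = 1 and a′·a′ = b·b = −1.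
R₄ H₄ : Vec Block 4
R₄ = a ∷ a′ ∷ b ∷ b′ ∷ []
H₄ = a ∷ -1₃ ⊡ a′ ∷ -1₃ ⊡ b ∷ b′ ∷ []

-- Expansion in a basis of 𝔽₃²⁴ by means of its dual basis: `gs` and `hs` are isotropic, dual to
-- each other and orthogonal to `R₄`, hence the exchange of `gs` and `hs` between the two lists. By
-- linearity the identity is evaluated on the 24 standard basis vectors.
expand-identity : ∀ u → lincomb (map (dot u) (H₄ ++ hs ++ gs)) (R₄ ++ gs ++ hs) ≡ u
expand-identity u = trans (cong f (sym (lincomb-identity u)))
  (trans (fixes-lincomb f-linear u (basisVectors 24) (basisVectors 24) refl) (lincomb-identity u))
  where
  f : Block → Block
  f u = lincomb (map (dot u) (H₄ ++ hs ++ gs)) (R₄ ++ gs ++ hs)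
  f-linear : Linear f
  f-linear = expand-linear (H₄ ++ hs ++ gs) (R₄ ++ gs ++ hs)

-- The dual of the span of `gs`, which contains every block of a codeword; modulo that span it is
-- generated by `R₄`.
Glued : Block → Set
Glued u = map (dot u) gs ≡ 𝟎

-- The coordinates along `hs` are the products with `gs`, which vanish for a glued block.
glued-expand : ∀ u → Glued u →
  u ≡ lincomb (map (dot u) H₄) R₄ ⊞ lincomb (map (dot u) hs) gs
glued-expand u glued = begin
  u
    ≡⟨ expand-identity u ⟨
  lincomb (map (dot u) (H₄ ++ hs ++ gs)) (R₄ ++ gs ++ hs)
    ≡⟨ cong (λ c → lincomb c (R₄ ++ gs ++ hs)) (Vec.map-++ (dot u) H₄ (hs ++ gs)) ⟩
  lincomb (map (dot u) H₄ ++ map (dot u) (hs ++ gs)) (R₄ ++ gs ++ hs)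
    ≡⟨ lincomb-++ (map (dot u) H₄) (map (dot u) (hs ++ gs)) R₄ (gs ++ hs) ⟩
  lincomb (map (dot u) H₄) R₄ ⊞ lincomb (map (dot u) (hs ++ gs)) (gs ++ hs)
    ≡⟨ cong (lincomb (map (dot u) H₄) R₄ ⊞_) (begin
      lincomb (map (dot u) (hs ++ gs)) (gs ++ hs)
        ≡⟨ cong (λ c → lincomb c (gs ++ hs)) (Vec.map-++ (dot u) hs gs) ⟩
      lincomb (map (dot u) hs ++ map (dot u) gs) (gs ++ hs)
        ≡⟨ lincomb-++ (map (dot u) hs) (map (dot u) gs) gs hs ⟩
      lincomb (map (dot u) hs) gs ⊞ lincomb (map (dot u) gs) hs
        ≡⟨ cong (λ c → lincomb (map (dot u) hs) gs ⊞ lincomb c hs) glued ⟩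
      lincomb (map (dot u) hs) gs ⊞ lincomb 𝟎 hs
        ≡⟨ cong (lincomb (map (dot u) hs) gs ⊞_) (lincomb-zeroˡ hs) ⟩
      lincomb (map (dot u) hs) gs ⊞ 𝟎
        ≡⟨ ⊞-identityʳ _ ⟩
      lincomb (map (dot u) hs) gs ∎) ⟩
  lincomb (map (dot u) H₄) R₄ ⊞ lincomb (map (dot u) hs) gs ∎
  where open ≡-Reasoning

_≟ᵥ_ : ∀ {n} (u v : Vec 𝔽₃ n) → Dec (u ≡ v)
_≟ᵥ_ = Vec.≡-dec _≟₃_

dot-⊞ʳ : ∀ {n} (u v w : Vec 𝔽₃ n) → dot u (v ⊞ w) ≡ dot u v +₃ dot u w
dot-⊞ʳ u v w = trans (dot-comm u (v ⊞ w))
  (trans (dot-⊞ˡ v w u) (cong₂ _+₃_ (dot-comm v u) (dot-comm w u)))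

dot-⊡ʳ : ∀ {n} c (u v : Vec 𝔽₃ n) → dot u (c ⊡ v) ≡ c *₃ dot u v
dot-⊡ʳ c u v = trans (dot-comm u (c ⊡ v)) (trans (dot-⊡ˡ c v u) (cong (c *₃_) (dot-comm v u)))

-- A word is orthogonal to (a | b) and (a′ | b′) on two consecutive blocks if and only if the leaving
-- state of the first block is the entering state of the second; a leaving (entering) state is balanced
-- if and only if the block is orthogonal to x (to y).
State : Set
State = 𝔽₃ × 𝔽₃

Balanced : State → Set
Balanced (p , q) = p ≡ q

-- The signs turn the link equations `dot u a +₃ dot v b ≡ 0₃` and `dot u a′ +₃ dot v b′ ≡ 0₃` into
-- equality of two states.
entering leaving : Block → State
entering u = -₃ dot u b , -₃ dot u b′
leaving  u = dot u a , dot u a′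

-- Orthogonality to `gs`, `y` and `x`. These span the Pless code, so by self-duality this is
-- membership.
InPless : Block → Set
InPless u = Glued u × Balanced (entering u) × Balanced (leaving u)

x y : Block
x = a ⊞ -1₃ ⊡ a′
y = b ⊞ -1₃ ⊡ b′

-₃-injective : ∀ {p q} → -₃ p ≡ -₃ q → p ≡ q
-₃-injective {p} {q} = from-yes (∀₃? λ p → ∀₃? λ q → (-₃ p ≟₃ -₃ q) →-dec (p ≟₃ q)) p q

-- Balance makes the coefficients of `a` and `a′` opposite, and likewise those of `b` and `b′`, so
-- the four terms collapse to multiples of `x` and `y`.
pless-expand : ∀ u → InPless u →
               u ≡ lincomb (dot u a ∷ -₃ dot u b ∷ map (dot u) hs) (x ∷ y ∷ gs)
pless-expand u (glued , in≡ , out≡) = begin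
  u
    ≡⟨ glued-expand u glued ⟩
  lincomb (map (dot u) H₄) R₄ ⊞ lincomb (map (dot u) hs) gs
    ≡⟨ cong (λ c → lincomb c R₄ ⊞ lincomb (map (dot u) hs) gs) coefficients ⟩
  lincomb (lincomb (p ∷ d ∷ []) M) R₄ ⊞ lincomb (map (dot u) hs) gs
    ≡⟨ cong (_⊞ lincomb (map (dot u) hs) gs)
         (fixes-lincomb (lincomb-linear R₄) (p ∷ d ∷ []) M (x ∷ y ∷ []) refl) ⟩
  lincomb (p ∷ d ∷ []) (x ∷ y ∷ []) ⊞ lincomb (map (dot u) hs) gs
    ≡⟨ lincomb-++ (p ∷ d ∷ []) (map (dot u) hs) (x ∷ y ∷ []) gs ⟨
  lincomb (p ∷ d ∷ map (dot u) hs) (x ∷ y ∷ gs) ∎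
  where
  open ≡-Reasoning
  p d : 𝔽₃
  p = dot u a
  d = -₃ dot u b
  -- The coordinates of `x` and `y` with respect to `R₄`.
  M : Vec (Vec 𝔽₃ 4) 2
  M = (⊕ ⊖ ○ ○ □) ∷ (○ ○ ⊕ ⊖ □) ∷ []
  lincomb-linear : ∀ {k n} (R : Vec (Vec 𝔽₃ n) k) → Linear (λ c → lincomb c R)
  lincomb-linear R .⊞-homo c c′ = lincomb-⊞ c c′ R
  lincomb-linear R .⊡-homo c c′ = lincomb-⊡ c c′ R
  coefficients : map (dot u) H₄ ≡ lincomb (p ∷ d ∷ []) M
  coefficients = trans
    (cong (p ∷_) (cong₂ _∷_ (trans (dot-⊡ʳ -1₃ u a′) (cong -₃_ (sym out≡)))
      (cong₂ _∷_ (dot-⊡ʳ -1₃ u b) (cong (_∷ []) (sym (-₃-injective in≡))))))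
    (from-yes (∀₃? λ p → ∀₃? λ e →
      (p ∷ -₃ p ∷ -₃ e ∷ e ∷ []) ≟ᵥ lincomb (p ∷ -₃ e ∷ []) M) p (dot u b))

⊞-++ : ∀ {k l} (s : Vec 𝔽₃ k) (t : Vec 𝔽₃ l) u v → (s ++ t) ⊞ (u ++ v) ≡ (s ⊞ u) ++ (t ⊞ v)
⊞-++ []      t []      v = refl
⊞-++ (p ∷ s) t (q ∷ u) v = cong (p +₃ q ∷_) (⊞-++ s t u v)

𝟎-++ : ∀ k {l} → 𝟎 {k} ++ 𝟎 {l} ≡ 𝟎
𝟎-++ zero    = refl
𝟎-++ (suc k) = cong (0₃ ∷_) (𝟎-++ k)

lincomb-++𝟎 : ∀ {k n} l (c : Vec 𝔽₃ k) (R : Vec (Vec 𝔽₃ n) k) →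
              lincomb c (map (_++ 𝟎 {l}) R) ≡ lincomb c R ++ 𝟎
lincomb-++𝟎 {n = n} l [] [] = sym (𝟎-++ n)
lincomb-++𝟎 l (c ∷ cs) (r ∷ R) = begin
  c ⊡ (r ++ 𝟎) ⊞ lincomb cs (map (_++ 𝟎) R)
    ≡⟨ cong₂ _⊞_ (trans (Vec.map-++ (c *₃_) r 𝟎) (cong (c ⊡ r ++_) (⊡-zeroʳ c))) (lincomb-++𝟎 l cs R) ⟩
  (c ⊡ r ++ 𝟎) ⊞ (lincomb cs R ++ 𝟎)
    ≡⟨ ⊞-++ (c ⊡ r) 𝟎 (lincomb cs R) 𝟎 ⟩
  (c ⊡ r ⊞ lincomb cs R) ++ (𝟎 ⊞ 𝟎)
    ≡⟨ cong (c ⊡ r ⊞ lincomb cs R ++_) (⊞-identityˡ 𝟎) ⟩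
  (c ⊡ r ⊞ lincomb cs R) ++ 𝟎 ∎
  where open ≡-Reasoning

lincomb-𝟎++ : ∀ {k n} l (c : Vec 𝔽₃ k) (R : Vec (Vec 𝔽₃ n) k) →
              lincomb c (map (𝟎 {l} ++_) R) ≡ 𝟎 ++ lincomb c R
lincomb-𝟎++ zero    []       []      = refl
lincomb-𝟎++ (suc l) []       []      = cong (0₃ ∷_) (lincomb-𝟎++ l [] [])
lincomb-𝟎++ l (c ∷ cs) (r ∷ R) = begin
  c ⊡ (𝟎 ++ r) ⊞ lincomb cs (map (𝟎 ++_) R)
    ≡⟨ cong₂ _⊞_ (trans (Vec.map-++ (c *₃_) 𝟎 r) (cong (_++ c ⊡ r) (⊡-zeroʳ c))) (lincomb-𝟎++ l cs R) ⟩
  (𝟎 ++ c ⊡ r) ⊞ (𝟎 ++ lincomb cs R)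
    ≡⟨ ⊞-++ 𝟎 (c ⊡ r) 𝟎 (lincomb cs R) ⟩
  (𝟎 ⊞ 𝟎) ++ (c ⊡ r ⊞ lincomb cs R)
    ≡⟨ cong (_++ (c ⊡ r ⊞ lincomb cs R)) (⊞-identityˡ 𝟎) ⟩
  𝟎 ++ (c ⊡ r ⊞ lincomb cs R) ∎
  where open ≡-Reasoning

-- The words p ++ q with p = qM and q = pM are the fixed points of this map.
swap : ∀ {n} → Vec (Vec 𝔽₃ n) n → Vec 𝔽₃ (n ℕ.+ n) → Vec 𝔽₃ (n ℕ.+ n)
swap M u = lincomb u (map (𝟎 ++_) M ++ map (_++ 𝟎) M)

swap-linear : ∀ {n} (M : Vec (Vec 𝔽₃ n) n) → Linear (swap M)
swap-linear M .⊞-homo c c′ = lincomb-⊞ c c′ _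
swap-linear M .⊡-homo c c′ = lincomb-⊡ c c′ _

swap-++ : ∀ {n} (M : Vec (Vec 𝔽₃ n) n) p q → swap M (p ++ q) ≡ lincomb q M ++ lincomb p M
swap-++ M p q = begin
  swap M (p ++ q)
    ≡⟨ lincomb-++ p q (map (𝟎 ++_) M) (map (_++ 𝟎) M) ⟩
  lincomb p (map (𝟎 ++_) M) ⊞ lincomb q (map (_++ 𝟎) M)
    ≡⟨ cong₂ _⊞_ (lincomb-𝟎++ _ p M) (lincomb-++𝟎 _ q M) ⟩
  (𝟎 ++ lincomb p M) ⊞ (lincomb q M ++ 𝟎)
    ≡⟨ ⊞-++ 𝟎 (lincomb p M) (lincomb q M) 𝟎 ⟩
  (𝟎 ⊞ lincomb q M) ++ (lincomb p M ⊞ 𝟎)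
    ≡⟨ cong₂ _++_ (⊞-identityˡ (lincomb q M)) (⊞-identityʳ (lincomb p M)) ⟩
  lincomb q M ++ lincomb p M ∎
  where open ≡-Reasoning

-- It suffices to evaluate `swap` on the twelve words of the basis. They are fixed because q = pP
-- implies p = qP, as P² = -PPᵀ = I.
pless-swap : ∀ u → InPless u → swap paley u ≡ u
pless-swap u inC = subst (λ v → swap paley v ≡ v) (sym (pless-expand u inC))
  (fixes-lincomb (swap-linear paley) c (x ∷ y ∷ gs) (x ∷ y ∷ gs) refl)
  where
  c : Vec 𝔽₃ 12
  c = dot u a ∷ -₃ dot u b ∷ map (dot u) hs

-- The bound is 8 although the minimum weight is 9: if both halves weigh more than 3, only 4 + 4 is
-- known. The missing unit comes from divisibility by three in `round-up`.
HeavyCombinations : ∀ {n} → Vec (Vec 𝔽₃ n) n → Set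
HeavyCombinations M = ∀ q → weight q ℕ.≤ 3 → weight q ≡ 0 ⊎ 8 ℕ.≤ weight q ℕ.+ weight (lincomb q M)

check-heavy : ∀ {n} (M : Vec (Vec 𝔽₃ n) n) → T (check 3 M 𝟎 0) → HeavyCombinations M
check-heavy M ok q q≤3 = subst (λ v → weight q ≡ 0 ⊎ 8 ℕ.≤ weight q ℕ.+ weight v)
  (⊞-identityˡ (lincomb q M)) (check-sound 3 M 𝟎 0 ok q q≤3)

-- A word of weight at most 7 has a half of weight at most 3, which determines the other half.
swap-weight : ∀ {n} (M : Vec (Vec 𝔽₃ n) n) → HeavyCombinations M → ∀ p q →
              p ≡ lincomb q M → q ≡ lincomb p M → (p ≡ 𝟎 × q ≡ 𝟎) ⊎ 8 ℕ.≤ weight p ℕ.+ weight q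
swap-weight {n} M heavy p q p≡ q≡ = cases (weight p ℕ.≤? 3) (weight q ℕ.≤? 3)
  where
  light : ∀ p q → q ≡ lincomb p M → weight p ℕ.≤ 3 → (p ≡ 𝟎 × q ≡ 𝟎) ⊎ 8 ℕ.≤ weight p ℕ.+ weight q
  light p q refl p≤3 with heavy p p≤3
  ... | inj₁ p≡0 with refl ← weight≡0⇒𝟎 p p≡0 = inj₁ (refl , lincomb-zeroˡ M)
  ... | inj₂ 8≤ = inj₂ 8≤
  cases : Dec (weight p ℕ.≤ 3) → Dec (weight q ℕ.≤ 3) → (p ≡ 𝟎 × q ≡ 𝟎) ⊎ 8 ℕ.≤ weight p ℕ.+ weight q
  cases (yes p≤3) _ = light p q q≡ p≤3
  cases (no _) (yes q≤3) with light q p p≡ q≤3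
  ... | inj₁ (q≡0 , p≡0) = inj₁ (p≡0 , q≡0)
  ... | inj₂ 8≤ = inj₂ (subst (8 ℕ.≤_) (ℕ.+-comm (weight q) (weight p)) 8≤)
  cases (no p≰3) (no q≰3) = inj₂ (ℕ.+-mono-≤ (ℕ.≰⇒> p≰3) (ℕ.≰⇒> q≰3))

swap-fixed-weight : ∀ {n} (M : Vec (Vec 𝔽₃ n) n) → HeavyCombinations M →
                    ∀ u → swap M u ≡ u → u ≡ 𝟎 ⊎ 8 ℕ.≤ weight u
swap-fixed-weight {n} M heavy u fixed with Vec.splitAt n u
... | p , q , refl with Vec.++-injective (lincomb q M) p (trans (sym (swap-++ M p q)) fixed)
... | p≡ , q≡ with swap-weight M heavy p q (sym p≡) (sym q≡)
...   | inj₁ (refl , refl) = inj₁ (𝟎-++ n)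
...   | inj₂ 8≤ = inj₂ (subst (8 ℕ.≤_) (sym (weight-++ p q)) 8≤)

pless-weight : ∀ u → InPless u → u ≡ 𝟎 ⊎ 8 ℕ.≤ weight u
pless-weight u inC = swap-fixed-weight paley (check-heavy paley tt) u (pless-swap u inC)

weight-cancel : ∀ {n} c (u t : Vec 𝔽₃ n) → c ≢ 0₃ → u ⊞ c ⊡ t ≡ 𝟎 → weight t ℕ.≤ weight u
weight-cancel c []      []      c≢0 eq = z≤n
weight-cancel c (x ∷ u) (z ∷ t) c≢0 eq = ℕ.+-mono-≤
  (from-yes (∀₃? λ c → ∀₃? λ x → ∀₃? λ z →
      ¬? (c ≟₃ 0₃) →-dec (x +₃ c *₃ z ≟₃ 0₃) →-dec (weight₁ z ℕ.≤? weight₁ x))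
    c x z c≢0 (Vec.∷-injectiveˡ eq))
  (weight-cancel c u t c≢0 (Vec.∷-injectiveʳ eq))

-- Either `u` is a nonzero multiple of `t` and has its support, or 8 is at most `weight u` plus 4 by
-- the triangle inequality.
coset-weight : ∀ c u t → weight t ≡ 4 → c ≢ 0₃ → InPless (u ⊞ c ⊡ t) → 4 ℕ.≤ weight u
coset-weight c u t t≡4 c≢0 inC = cases (pless-weight (u ⊞ c ⊡ t) inC)
  where
  cases : u ⊞ c ⊡ t ≡ 𝟎 ⊎ 8 ℕ.≤ weight (u ⊞ c ⊡ t) → 4 ℕ.≤ weight u
  cases (inj₁ eq) = subst (ℕ._≤ weight u) t≡4 (weight-cancel c u t c≢0 eq)
  cases (inj₂ 8≤) = ℕ.+-cancelʳ-≤ 4 4 (weight u) (ℕ.≤-trans 8≤ (ℕ.≤-trans (weight-⊞ u (c ⊡ t))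
    (ℕ.+-monoʳ-≤ (weight u) (subst (weight (c ⊡ t) ℕ.≤_) t≡4 (weight-⊡ c t)))))

dot-shift : ∀ {n} c (u t r : Vec 𝔽₃ n) → dot (u ⊞ c ⊡ t) r ≡ dot u r +₃ c *₃ dot t r
dot-shift c u t r = trans (dot-⊞ˡ u (c ⊡ t) r) (cong (dot u r +₃_) (dot-⊡ˡ c t r))

glued-shift : ∀ c u t → Glued u → Glued t → Glued (u ⊞ c ⊡ t)
glued-shift c u t gu gt = begin
  map (dot (u ⊞ c ⊡ t)) gs            ≡⟨ map-dot-⊞ u (c ⊡ t) gs ⟩
  map (dot u) gs ⊞ map (dot (c ⊡ t)) gs ≡⟨ cong₂ _⊞_ gu (map-dot-⊡ c t gs) ⟩
  𝟎 ⊞ c ⊡ map (dot t) gs              ≡⟨ cong (λ v → 𝟎 ⊞ c ⊡ v) gt ⟩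
  𝟎 ⊞ c ⊡ 𝟎                           ≡⟨ ⊞-identityˡ (c ⊡ 𝟎) ⟩
  c ⊡ 𝟎                               ≡⟨ ⊡-zeroʳ c ⟩
  𝟎 ∎
  where open ≡-Reasoning

-- Since `a` has norm 1 and is orthogonal to `a′`, `b` and `b′`, adding a multiple of it balances
-- the leaving state and keeps the entering one. It is the part of weight 4 of `x`.
leaving-weight : ∀ u → Glued u → Balanced (entering u) → ¬ Balanced (leaving u) → 4 ℕ.≤ weight u
leaving-weight u glued in≡ out≢ = coset-weight c u a refl c≢0
  ( glued-shift c u a glued refl
  , cong -₃_ (trans (unchanged b refl) (trans (-₃-injective in≡) (sym (unchanged b′ refl))))
  , trans (dot-shift c u a a) (trans
      (from-yes (∀₃? λ p → ∀₃? λ q → p +₃ (q +₃ -₃ p) *₃ 1₃ ≟₃ q) (dot u a) (dot u a′))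
      (sym (unchanged a′ refl))))
  where
  c : 𝔽₃
  c = dot u a′ +₃ -₃ dot u a
  c≢0 : c ≢ 0₃
  c≢0 c≡0 = out≢ (from-yes (∀₃? λ p → ∀₃? λ q → (q +₃ -₃ p ≟₃ 0₃) →-dec (p ≟₃ q))
    (dot u a) (dot u a′) c≡0)
  unchanged : ∀ r → dot a r ≡ 0₃ → dot (u ⊞ c ⊡ a) r ≡ dot u r
  unchanged r eq = trans (dot-shift c u a r) (trans (cong (λ z → dot u r +₃ c *₃ z) eq)
    (trans (cong (dot u r +₃_) (𝔽.zeroʳ c)) (𝔽.+-identityʳ (dot u r))))

-- Here the part of weight 4 is `b′`, again of norm 1 and orthogonal to the other three.
entering-weight : ∀ u → Glued u → ¬ Balanced (entering u) → Balanced (leaving u) → 4 ℕ.≤ weight u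
entering-weight u glued in≢ out≡ = coset-weight c u b′ refl c≢0
  ( glued-shift c u b′ glued refl
  , cong -₃_ (trans (unchanged b refl) (sym (trans (dot-shift c u b′ b′)
      (from-yes (∀₃? λ p → ∀₃? λ q → p +₃ (q +₃ -₃ p) *₃ 1₃ ≟₃ q) (dot u b′) (dot u b)))))
  , trans (unchanged a refl) (trans out≡ (sym (unchanged a′ refl))))
  where
  c : 𝔽₃
  c = dot u b +₃ -₃ dot u b′
  c≢0 : c ≢ 0₃
  c≢0 c≡0 = in≢ (from-yes (∀₃? λ p → ∀₃? λ q → (p +₃ -₃ q ≟₃ 0₃) →-dec (-₃ p ≟₃ -₃ q))
    (dot u b) (dot u b′) c≡0)
  unchanged : ∀ r → dot b′ r ≡ 0₃ → dot (u ⊞ c ⊡ b′) r ≡ dot u r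
  unchanged r eq = trans (dot-shift c u b′ r) (trans (cong (λ z → dot u r +₃ c *₃ z) eq)
    (trans (cong (dot u r +₃_) (𝔽.zeroʳ c)) (𝔽.+-identityʳ (dot u r))))

-- Chains of blocks

Word : ℕ → Set
Word m = Vec Block m

infixl 6 _⊞ʷ_
infixr 7 _⊡ʷ_

_⊞ʷ_ : ∀ {m} → Word m → Word m → Word m
_⊞ʷ_ = zipWith _⊞_

_⊡ʷ_ : ∀ {m} → 𝔽₃ → Word m → Word m
c ⊡ʷ W = map (c ⊡_) W

𝟎ʷ : ∀ {m} → Word m
𝟎ʷ = replicate _ 𝟎

dotʷ : ∀ {m} → Word m → Word m → 𝔽₃
dotʷ []      []        = 0₃
dotʷ (u ∷ U) (v ∷ V) = dot u v +₃ dotʷ U V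

weightʷ : ∀ {m} → Word m → ℕ
weightʷ []      = 0
weightʷ (u ∷ U) = weight u ℕ.+ weightʷ U

-- Chain s U: U is orthogonal to all generators but y in the first block, which it enters in state s.
Chain : ∀ {m} → State → Word m → Set
Chain s []      = Balanced s
Chain s (u ∷ U) = Glued u × entering u ≡ s × Chain (leaving u) U

-- Starting from a balanced state is orthogonality to `y` in the first block; the end of `Chain` is
-- orthogonality to `x` in the last.
Code : ∀ {m} → Word m → Set
Code U = ∃[ t ] Chain (t , t) U

chain? : ∀ {m} s (U : Word m) → Dec (Chain s U)
chain? (p , q) []      = p ≟₃ q
chain? s       (u ∷ U) =
  map (dot u) gs ≟ᵥ 𝟎 ×-dec ×-≡-dec _≟₃_ _≟₃_ (entering u) s ×-dec chain? (leaving u) U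

code? : ∀ {m} (U : Word m) → Dec (Code U)
code? U = ∃₃? λ t → chain? (t , t) U

-- An unbalanced entering state means that a run of glued blocks is open. The block that closes it
-- contributes 4, and the block that opened it contributes the other 4, so both claims are proved in
-- one induction.
chain-weight : ∀ {m} s (U : Word m) → Chain s U →
  (Balanced s → U ≡ 𝟎ʷ ⊎ 8 ℕ.≤ weightʷ U) × (¬ Balanced s → 4 ℕ.≤ weightʷ U)
chain-weight s [] s≡ = (λ _ → inj₁ refl) , λ s≢ → contradiction s≡ s≢
chain-weight s (u ∷ U) (glued , refl , chain) = cases (dot u a ≟₃ dot u a′)
  where
  ih : (Balanced (leaving u) → U ≡ 𝟎ʷ ⊎ 8 ℕ.≤ weightʷ U) × (¬ Balanced (leaving u) → 4 ℕ.≤ weightʷ U)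
  ih = chain-weight (leaving u) U chain
  join : u ≡ 𝟎 ⊎ 8 ℕ.≤ weight u → U ≡ 𝟎ʷ ⊎ 8 ℕ.≤ weightʷ U →
            u ∷ U ≡ 𝟎ʷ ⊎ 8 ℕ.≤ weight u ℕ.+ weightʷ U
  join (inj₁ u≡0) (inj₁ U≡0) = inj₁ (cong₂ _∷_ u≡0 U≡0)
  join (inj₁ _)   (inj₂ 8≤)  = inj₂ (ℕ.≤-trans 8≤ (ℕ.m≤n+m (weightʷ U) (weight u)))
  join (inj₂ 8≤)  _          = inj₂ (ℕ.≤-trans 8≤ (ℕ.m≤m+n (weight u) (weightʷ U)))
  cases : Dec (Balanced (leaving u)) →
          (Balanced (entering u) → u ∷ U ≡ 𝟎ʷ ⊎ 8 ℕ.≤ weight u ℕ.+ weightʷ U) ×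
          (¬ Balanced (entering u) → 4 ℕ.≤ weight u ℕ.+ weightʷ U)
  cases (yes out≡) =
      (λ in≡ → join (pless-weight u (glued , in≡ , out≡)) (proj₁ ih out≡))
    , λ in≢ → ℕ.≤-trans (entering-weight u glued in≢ out≡) (ℕ.m≤m+n (weight u) (weightʷ U))
  cases (no out≢) =
      (λ in≡ → inj₂ (ℕ.+-mono-≤ (leaving-weight u glued in≡ out≢) (proj₂ ih out≢)))
    , λ _ → ℕ.≤-trans (proj₂ ih out≢) (ℕ.m≤n+m (weightʷ U) (weight u))

code-weight : ∀ {m} (U : Word m) → Code U → U ≡ 𝟎ʷ ⊎ 8 ℕ.≤ weightʷ U
code-weight U (t , chain) = proj₁ (chain-weight (t , t) U chain) refl

-- The bilinear form of the plane of `a` and `a′`, whose norms are 1 and -1. The plane of `b` and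
-- `b′` carries its negative, so the contributions at a joint cancel.
boundary : State → State → 𝔽₃
boundary (p , q) (p′ , q′) = p *₃ p′ +₃ -₃ (q *₃ q′)

-- The summands of the inner product of two chains telescope.
glued-dot : ∀ u v → Glued u → Glued v →
            dot u v +₃ boundary (entering u) (entering v) ≡ boundary (leaving u) (leaving v)
glued-dot u v gu gv = begin
  dot u v +₃ boundary (entering u) (entering v)
    ≡⟨ cong (λ w → dot w v +₃ boundary (entering u) (entering v)) (glued-expand u gu) ⟩
  dot (lincomb (map (dot u) H₄) R₄ ⊞ lincomb (map (dot u) hs) gs) v +₃ boundary (entering u) (entering v)
    ≡⟨ cong (_+₃ boundary (entering u) (entering v)) (begin
      dot (lincomb (map (dot u) H₄) R₄ ⊞ lincomb (map (dot u) hs) gs) v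
        ≡⟨ dot-⊞ˡ (lincomb (map (dot u) H₄) R₄) (lincomb (map (dot u) hs) gs) v ⟩
      dot (lincomb (map (dot u) H₄) R₄) v +₃ dot (lincomb (map (dot u) hs) gs) v
        ≡⟨ cong₂ _+₃_ (dot-lincomb (map (dot u) H₄) R₄ v) (trans (dot-lincomb (map (dot u) hs) gs v)
             (trans (cong (dot (map (dot u) hs)) gv) (dot-zeroʳ (map (dot u) hs)))) ⟩
      dot (map (dot u) H₄) (map (dot v) R₄) +₃ 0₃
        ≡⟨ 𝔽.+-identityʳ _ ⟩
      dot (map (dot u) H₄) (map (dot v) R₄)
        ≡⟨ cong (λ c → dot c (map (dot v) R₄)) (cong (dot u a ∷_) (cong₂ _∷_ (dot-⊡ʳ -1₃ u a′)
             (cong (_∷ dot u b′ ∷ []) (dot-⊡ʳ -1₃ u b)))) ⟩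
      dot (dot u a ∷ -₃ dot u a′ ∷ -₃ dot u b ∷ dot u b′ ∷ []) (map (dot v) R₄) ∎) ⟩
  dot (dot u a ∷ -₃ dot u a′ ∷ -₃ dot u b ∷ dot u b′ ∷ []) (map (dot v) R₄)
    +₃ boundary (entering u) (entering v)
    ≡⟨ solve 8 (λ p q d e p′ q′ d′ e′ →
         (p :* p′ :+ (:- q :* q′ :+ (:- d :* d′ :+ (e :* e′ :+ con 0₃))))
           :+ (:- d :* :- d′ :+ :- (:- e :* :- e′))
         := p :* p′ :+ :- (q :* q′)) refl
         (dot u a) (dot u a′) (dot u b) (dot u b′) (dot v a) (dot v a′) (dot v b) (dot v b′) ⟩
  boundary (leaving u) (leaving v) ∎
  where
  open ≡-Reasoning
  open 𝔽-Solver

chain-dot : ∀ {m} s t (U V : Word m) → Chain s U → Chain t V → dotʷ U V +₃ boundary s t ≡ 0₃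
-- The balanced states form an isotropic line of `boundary`.
chain-dot (p , _) (q , _) [] [] refl refl = 𝔽.-‿inverseʳ (p *₃ q)
chain-dot s t (u ∷ U) (v ∷ V) (gu , refl , chainU) (gv , refl , chainV) = begin
  dot u v +₃ dotʷ U V +₃ e
    ≡⟨ solve 3 (λ p q r → p :+ q :+ r := q :+ (p :+ r)) refl (dot u v) (dotʷ U V) e ⟩
  dotʷ U V +₃ (dot u v +₃ e)
    ≡⟨ cong (dotʷ U V +₃_) (glued-dot u v gu gv) ⟩
  dotʷ U V +₃ boundary (leaving u) (leaving v)
    ≡⟨ chain-dot (leaving u) (leaving v) U V chainU chainV ⟩
  0₃ ∎
  where
  open ≡-Reasoning
  open 𝔽-Solver
  e : 𝔽₃
  e = boundary (entering u) (entering v)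

code-dot : ∀ {m} (U V : Word m) → Code U → Code V → dotʷ U V ≡ 0₃
code-dot U V (s , chainU) (t , chainV) = trans
  (sym (trans (cong (dotʷ U V +₃_) (𝔽.-‿inverseʳ (s *₃ t))) (𝔽.+-identityʳ (dotʷ U V))))
  (chain-dot (s , s) (t , t) U V chainU chainV)

-- Generators, self-duality and span

data Gen : ∀ {m} → Word m → Set where
  block : ∀ {m} k → Gen {suc m} (lookup gs k ∷ 𝟎ʷ)
  last  : Gen {1} (x ∷ [])
  link  : ∀ {m} → Gen {2 ℕ.+ m} (a ∷ b ∷ 𝟎ʷ)
  link′ : ∀ {m} → Gen {2 ℕ.+ m} (a′ ∷ b′ ∷ 𝟎ʷ)
  later : ∀ {m} {U : Word m} → Gen U → Gen (𝟎 ∷ U)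

-- `first` stays outside `Gen`, because `later` must not move `y` off the first block; inductions
-- along the chain run over `Gen`.
data Gen⁺ : ∀ {m} → Word m → Set where
  first : ∀ {m} → Gen⁺ {suc m} (y ∷ 𝟎ʷ)
  gen   : ∀ {m} {U : Word m} → Gen U → Gen⁺ U

chain-𝟎 : ∀ m → Chain (0₃ , 0₃) (𝟎ʷ {m})
chain-𝟎 zero    = refl
chain-𝟎 (suc m) = refl , refl , chain-𝟎 m

gs-chain : ∀ k → Glued (lookup gs k) × entering (lookup gs k) ≡ (0₃ , 0₃) × leaving (lookup gs k) ≡ (0₃ , 0₃)
gs-chain = from-yes (Fin.all? λ k → let g = lookup gs k in
  map (dot g) gs ≟ᵥ 𝟎 ×-dec ×-≡-dec _≟₃_ _≟₃_ (entering g) (0₃ , 0₃) ×-dec ×-≡-dec _≟₃_ _≟₃_ (leaving g) (0₃ , 0₃))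

gen-chain : ∀ {m} {U : Word m} → Gen U → Chain (0₃ , 0₃) U
gen-chain (block {m} k) = let glued , in≡ , out≡ = gs-chain k in
  glued , in≡ , subst (λ s → Chain s 𝟎ʷ) (sym out≡) (chain-𝟎 m)
gen-chain last       = refl , refl , refl
gen-chain (link {m})  = refl , refl , refl , refl , chain-𝟎 m
gen-chain (link′ {m}) = refl , refl , refl , refl , chain-𝟎 m
gen-chain (later g)  = refl , refl , gen-chain g

gen-code : ∀ {m} {U : Word m} → Gen⁺ U → Code U
gen-code (first {m}) = 1₃ , refl , refl , chain-𝟎 m
gen-code (gen g)     = 0₃ , gen-chain g

weightʷ-𝟎 : ∀ m → weightʷ (𝟎ʷ {m}) ≡ 0
weightʷ-𝟎 zero    = refl
weightʷ-𝟎 (suc m) = weightʷ-𝟎 m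

gen-weight : ∀ {m} {U : Word m} → Gen⁺ U → weightʷ U ≡ 9
gen-weight (first {m})       = cong (9 ℕ.+_) (weightʷ-𝟎 m)
gen-weight (gen (block {m} k)) = cong₂ ℕ._+_
  (from-yes (Fin.all? λ k → weight (lookup gs k) ℕ.≟ 9) k) (weightʷ-𝟎 m)
gen-weight (gen last)        = refl
gen-weight (gen (link {m}))  = cong (9 ℕ.+_) (weightʷ-𝟎 m)
gen-weight (gen (link′ {m})) = cong (9 ℕ.+_) (weightʷ-𝟎 m)
gen-weight (gen (later g))   = gen-weight (gen g)

dotʷ-𝟎 : ∀ {m} (U : Word m) → dotʷ U 𝟎ʷ ≡ 0₃
dotʷ-𝟎 []      = refl
dotʷ-𝟎 (u ∷ U) = cong₂ _+₃_ (dot-zeroʳ u) (dotʷ-𝟎 U)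

dotʷ-head : ∀ {m} u (U : Word m) v → dotʷ (u ∷ U) (v ∷ 𝟎ʷ) ≡ dot u v
dotʷ-head u U v = trans (cong (dot u v +₃_) (dotʷ-𝟎 U)) (𝔽.+-identityʳ (dot u v))

map-zero : ∀ {k n} (R : Vec (Vec 𝔽₃ n) k) (u : Vec 𝔽₃ n) →
           (∀ i → dot u (lookup R i) ≡ 0₃) → map (dot u) R ≡ 𝟎
map-zero []      u zeros = refl
map-zero (r ∷ R) u zeros = cong₂ _∷_ (zeros zero) (map-zero R u (zeros ∘ suc))

negation-unique : ∀ p q → p +₃ q ≡ 0₃ → -₃ q ≡ p
negation-unique = from-yes (∀₃? λ p → ∀₃? λ q → (p +₃ q ≟₃ 0₃) →-dec (-₃ q ≟₃ p))

dot-≡ : ∀ {n} (u v w : Vec 𝔽₃ n) → dot u (v ⊞ -1₃ ⊡ w) ≡ 0₃ → dot u v ≡ dot u w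
dot-≡ u v w eq = from-yes (∀₃? λ p → ∀₃? λ q → (p +₃ -₃ q ≟₃ 0₃) →-dec (p ≟₃ q))
  (dot u v) (dot u w)
  (trans (sym (trans (dot-⊞ʳ u v (-1₃ ⊡ w)) (cong (dot u v +₃_) (dot-⊡ʳ -1₃ u w)))) eq)

-- The generators serve as parity checks: `block` yields `Glued`, `link` and `link′` match the two
-- coordinates of consecutive states, and `last` balances the end.
gen-dual-chain : ∀ {m} u (U : Word m) → (∀ {V} → Gen V → dotʷ (u ∷ U) V ≡ 0₃) →
                 Chain (entering u) (u ∷ U)
gen-dual-chain u U dual = glued , refl , rest U dual
  where
  glued : Glued u
  glued = map-zero gs u λ k → trans (sym (dotʷ-head u U (lookup gs k))) (dual (block k))
  rest : ∀ {m} (U : Word m) → (∀ {V} → Gen V → dotʷ (u ∷ U) V ≡ 0₃) → Chain (leaving u) U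
  rest [] dual = dot-≡ u a a′ (trans (sym (𝔽.+-identityʳ (dot u x))) (dual last))
  rest (v ∷ U) dual = subst (λ s → Chain s (v ∷ U))
    (cong₂ _,_
      (negation-unique (dot u a) (dot v b) (trans (cong (dot u a +₃_) (sym (dotʷ-head v U b))) (dual link)))
      (negation-unique (dot u a′) (dot v b′) (trans (cong (dot u a′ +₃_) (sym (dotʷ-head v U b′))) (dual link′))))
    (gen-dual-chain v U λ {V} g → trans (cong (_+₃ dotʷ (v ∷ U) V) (sym (dot-zeroʳ u))) (dual (later g)))

-- As the generators are codewords, this gives the inclusion of the dual in the code; `code-dot` is
-- the converse inclusion.
gen-dual : ∀ {m} (U : Word m) → (∀ {V} → Gen⁺ V → dotʷ U V ≡ 0₃) → Code U
gen-dual []      dual = 0₃ , refl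
gen-dual (u ∷ U) dual = _ , subst (λ s → Chain s (u ∷ U))
  (cong (-₃ dot u b ,_) (cong -₃_ (sym (dot-≡ u b b′ (trans (sym (dotʷ-head u U y)) (dual first))))))
  (gen-dual-chain u U (dual ∘ gen))

data Span {m} (G : Word m → Set) : Word m → Set where
  empty : Span G 𝟎ʷ
  add   : ∀ c {U V} → G U → Span G V → Span G (c ⊡ʷ U ⊞ʷ V)

span-map : ∀ {m} {G H : Word m → Set} → (∀ {U} → G U → H U) → ∀ {U} → Span G U → Span H U
span-map f empty       = empty
span-map f (add c g s) = add c (f g) (span-map f s)

𝟎ʷ-scale : ∀ {m} c (U : Word m) → c ⊡ʷ 𝟎ʷ ⊞ʷ U ≡ U
𝟎ʷ-scale c []      = refl
𝟎ʷ-scale c (u ∷ U) = cong₂ _∷_ (trans (cong (_⊞ u) (⊡-zeroʳ c)) (⊞-identityˡ u)) (𝟎ʷ-scale c U)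

span-later : ∀ {m} {U : Word m} → Span Gen U → Span Gen (𝟎 ∷ U)
span-later empty       = empty
span-later (add c {U} {V} g s) = subst (λ u → Span Gen (u ∷ c ⊡ʷ U ⊞ʷ V))
  (trans (⊞-identityʳ (c ⊡ 𝟎)) (⊡-zeroʳ c)) (add c (later g) (span-later s))

span-gs : ∀ {m} (c : Vec 𝔽₃ 10) {u} {U : Word m} → Span Gen (u ∷ U) → Span Gen (lincomb c gs ⊞ u ∷ U)
span-gs {m} c {u} {U} s = go c gs block
  where
  go : ∀ {k} (c : Vec 𝔽₃ k) R → (∀ i → Gen (lookup R i ∷ 𝟎ʷ {m})) → Span Gen (lincomb c R ⊞ u ∷ U)
  go []       []      g = subst (λ v → Span Gen (v ∷ U)) (sym (⊞-identityˡ u)) s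
  go (c ∷ cs) (r ∷ R) g = subst (Span Gen)
    (cong₂ _∷_ (sym (⊞-assoc (c ⊡ r) (lincomb cs R) u)) (𝟎ʷ-scale c U))
    (add c (g zero) (go cs R (g ∘ suc)))

-- The component along `b` and `b′` that a block with this entering state must have. Its
-- coefficients equal those of `outgoing` at the same state, so across a joint the two make up a
-- combination of `link` and `link′`.
incoming : State → Block
incoming (p , q) = p ⊡ b ⊞ -₃ q ⊡ b′

outgoing : State → Block
outgoing (p , q) = p ⊡ a ⊞ -₃ q ⊡ a′

glued-split : ∀ u → Glued u →
              u ≡ incoming (entering u) ⊞ (outgoing (leaving u) ⊞ lincomb (map (dot u) hs) gs)
glued-split u glued = trans (glued-expand u glued) (trans
  (cong (λ c → lincomb c R₄ ⊞ g) (cong (dot u a ∷_) (cong₂ _∷_ (dot-⊡ʳ -1₃ u a′)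
    (cong₂ _∷_ (dot-⊡ʳ -1₃ u b) (cong (_∷ []) (sym (from-yes (∀₃? λ p → -₃ -₃ p ≟₃ p) (dot u b′))))))))
  (rearrange (dot u a ⊡ a) (-₃ dot u a′ ⊡ a′) (-₃ dot u b ⊡ b) (-₃ -₃ dot u b′ ⊡ b′) g))
  where
  g : Block
  g = lincomb (map (dot u) hs) gs
  rearrange : ∀ {n} (p q r s g : Vec 𝔽₃ n) →
              (p ⊞ (q ⊞ (r ⊞ (s ⊞ 𝟎)))) ⊞ g ≡ (r ⊞ s) ⊞ ((p ⊞ q) ⊞ g)
  rearrange [] [] [] [] [] = refl
  rearrange (p ∷ ps) (q ∷ qs) (r ∷ rs) (s ∷ ss) (g ∷ gs) = cong₂ _∷_
    (solve 5 (λ p q r s g → (p :+ (q :+ (r :+ (s :+ con 0₃)))) :+ g := (r :+ s) :+ ((p :+ q) :+ g))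
      refl p q r s g)
    (rearrange ps qs rs ss gs)
    where open 𝔽-Solver

-- At each joint with state (p, q) the outgoing part of one block and the incoming part of the next
-- form p(a | b) - q(a′ | b′). The incoming part of the head is left to the caller, which pairs it
-- with the preceding block or with `y`.
chain-span : ∀ {m} s u (U : Word m) → Chain s (u ∷ U) →
             ∃[ v ] u ≡ incoming s ⊞ v × Span Gen (v ∷ U)
chain-span s u [] (glued , refl , out≡) = _ , glued-split u glued ,
  subst (λ v → Span Gen (v ∷ [])) eq (add (dot u a) last (span-gs (map (dot u) hs) empty))
  where
  open ≡-Reasoning
  g : Block
  g = lincomb (map (dot u) hs) gs
  eq : dot u a ⊡ x ⊞ (g ⊞ 𝟎) ≡ outgoing (leaving u) ⊞ g
  eq = cong₂ _⊞_
    (trans (⊡-distrib-⊞ (dot u a) a (-1₃ ⊡ a′)) (cong (dot u a ⊡ a ⊞_)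
      (trans (⊡-⊡ (dot u a) -1₃ a′) (cong (_⊡ a′)
        (trans (𝔽.*-comm (dot u a) -1₃) (cong -₃_ out≡))))))
    (⊞-identityʳ g)
chain-span s u (w ∷ U) (glued , refl , chain) with chain-span (leaving u) w U chain
... | v , w≡ , span = _ , glued-split u glued ,
  subst (Span Gen)
    (cong₂ _∷_
      (trans (cong (λ z → p ⊡ a ⊞ (q ⊡ a′ ⊞ z)) (⊞-identityʳ g)) (sym (⊞-assoc (p ⊡ a) (q ⊡ a′) g)))
      (cong₂ _∷_ (trans (sym (⊞-assoc (p ⊡ b) (q ⊡ b′) v)) (sym w≡))
        (trans (cong (p ⊡ʷ 𝟎ʷ ⊞ʷ_) (𝟎ʷ-scale q U)) (𝟎ʷ-scale p U))))
    (add p link (add q link′ (span-gs (map (dot u) hs) (span-later span))))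
  where
  p q : 𝔽₃
  p = dot u a
  q = -₃ dot u a′
  g : Block
  g = lincomb (map (dot u) hs) gs

-- What `chain-span` leaves over from the state `(t , t)` is `t ⊡ y`, a multiple of `first`.
code-span : ∀ {m} (U : Word m) → Code U → Span Gen⁺ U
code-span []      _           = empty
code-span (u ∷ U) (t , chain) with chain-span (t , t) u U chain
... | v , refl , span = subst (Span Gen⁺)
  (cong₂ _∷_
    (cong (_⊞ v) (trans (⊡-distrib-⊞ t b (-1₃ ⊡ b′)) (cong (t ⊡ b ⊞_)
      (trans (⊡-⊡ t -1₃ b′) (cong (_⊡ b′) (𝔽.*-comm t -1₃))))))
    (𝟎ʷ-scale t U))
  (add t first (span-map gen span))

-- Connectivity of the positions

entry : ∀ {m} → Word m → Fin m → Fin 24 → 𝔽₃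
entry U i j = lookup (lookup U i) j

Closed : ∀ {m} → (Fin m → Fin 24 → Set) → Word m → Set
Closed T U = ∀ i j i′ j′ → entry U i j ≢ 0₃ → entry U i′ j′ ≢ 0₃ → T i j → T i′ j′

-- Within a block every position shares the support of some word of `gs` with position zero, and
-- `link` leads on to the next block.
gen-connected : ∀ {m} (T : Fin (suc m) → Fin 24 → Set) → (∀ {U} → Gen U → Closed T U) →
            ∀ j → T zero j → ∀ i j′ → T i j′
gen-connected {m} T closed j t = all m T closed (whole T closed j t)
  where
  cover : ∀ j → ∃[ k ] lookup (lookup gs k) zero ≢ 0₃ × lookup (lookup gs k) j ≢ 0₃
  cover = from-yes (Fin.all? λ j → Fin.any? λ k →
    ¬? (lookup (lookup gs k) zero ≟₃ 0₃) ×-dec ¬? (lookup (lookup gs k) j ≟₃ 0₃))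
  whole : ∀ {m} (T : Fin (suc m) → Fin 24 → Set) → (∀ {U} → Gen U → Closed T U) →
          ∀ j → T zero j → ∀ j′ → T zero j′
  whole T closed j t j′ with cover j | cover j′
  ... | k , at0 , atj | k′ , at0′ , atj′ =
    closed (block k′) zero zero zero j′ at0′ atj′ (closed (block k) zero j zero zero atj at0 t)
  all : ∀ m (T : Fin (suc m) → Fin 24 → Set) → (∀ {U} → Gen U → Closed T U) →
        (∀ j → T zero j) → ∀ i j → T i j
  all m       T closed t zero    = t
  all (suc m) T closed t (suc i) = all m (T ∘ suc) closed′
    -- Position 5 lies in the support of `a`, position 15 in that of `b`.
    (whole (T ∘ suc) closed′ (# 15)
      (closed link zero (# 5) (suc zero) (# 15) (λ ()) (λ ()) (t (# 5)))) i
    where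
    closed′ : ∀ {U} → Gen U → Closed (T ∘ suc) U
    closed′ g i j i′ j′ = closed (later g) (suc i) j (suc i′) j′

-- Integer vectors modulo 3

mod₃ⁿ : ℕ → 𝔽₃
mod₃ⁿ zero    = 0₃
mod₃ⁿ (suc n) = 1₃ +₃ mod₃ⁿ n

mod₃ : ℤ → 𝔽₃
mod₃ (+ n)    = mod₃ⁿ n
mod₃ -[1+ n ] = -₃ mod₃ⁿ (suc n)

lift : 𝔽₃ → ℤ
lift 0₃  = + 0
lift 1₃  = + 1
lift -1₃ = -[1+ 0 ]

mod₃-lift : ∀ c → mod₃ (lift c) ≡ c
mod₃-lift = from-yes (∀₃? λ c → mod₃ (lift c) ≟₃ c)

mod₃-neg : ∀ z → mod₃ (ℤ.- z) ≡ -₃ mod₃ z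
mod₃-neg (+ zero)  = refl
mod₃-neg (+ suc n) = refl
mod₃-neg -[1+ n ]  = sym (from-yes (∀₃? λ p → -₃ -₃ p ≟₃ p) (mod₃ⁿ (suc n)))

mod₃ⁿ-+ : ∀ m n → mod₃ⁿ (m ℕ.+ n) ≡ mod₃ⁿ m +₃ mod₃ⁿ n
mod₃ⁿ-+ zero    n = refl
mod₃ⁿ-+ (suc m) n = trans (cong (1₃ +₃_) (mod₃ⁿ-+ m n)) (sym (𝔽.+-assoc 1₃ (mod₃ⁿ m) (mod₃ⁿ n)))

mod₃-⊖ : ∀ m n → mod₃ (m ℤ.⊖ n) ≡ mod₃ⁿ m +₃ -₃ mod₃ⁿ n
mod₃-⊖ m       zero    = sym (𝔽.+-identityʳ (mod₃ⁿ m))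
mod₃-⊖ zero    (suc n) = refl
mod₃-⊖ (suc m) (suc n) = trans (cong mod₃ (ℤ.[1+m]⊖[1+n]≡m⊖n m n)) (trans (mod₃-⊖ m n)
  (from-yes (∀₃? λ p → ∀₃? λ q → p +₃ -₃ q ≟₃ (1₃ +₃ p) +₃ -₃ (1₃ +₃ q)) (mod₃ⁿ m) (mod₃ⁿ n)))

mod₃-+ : ∀ x y → mod₃ (x ℤ.+ y) ≡ mod₃ x +₃ mod₃ y
mod₃-+ (+ m)    (+ n)    = mod₃ⁿ-+ m n
mod₃-+ (+ m)    -[1+ n ] = mod₃-⊖ m (suc n)
mod₃-+ -[1+ m ] (+ n)    = trans (mod₃-⊖ n (suc m)) (𝔽.+-comm (mod₃ⁿ n) (-₃ mod₃ⁿ (suc m)))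
mod₃-+ -[1+ m ] -[1+ n ] = trans
  (cong (λ p → -₃ (1₃ +₃ (1₃ +₃ p))) (mod₃ⁿ-+ m n))
  (from-yes (∀₃? λ p → ∀₃? λ q → -₃ (1₃ +₃ (1₃ +₃ (p +₃ q))) ≟₃ -₃ (1₃ +₃ p) +₃ -₃ (1₃ +₃ q))
    (mod₃ⁿ m) (mod₃ⁿ n))

mod₃-+* : ∀ n y → mod₃ (+ n ℤ.* y) ≡ mod₃ⁿ n *₃ mod₃ y
mod₃-+* zero    y = cong mod₃ (ℤ.*-zeroˡ y)
mod₃-+* (suc n) y = begin
  mod₃ (+ suc n ℤ.* y)           ≡⟨ cong mod₃ (ℤ.suc-* (+ n) y) ⟩
  mod₃ (y ℤ.+ + n ℤ.* y)         ≡⟨ mod₃-+ y (+ n ℤ.* y) ⟩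
  mod₃ y +₃ mod₃ (+ n ℤ.* y)     ≡⟨ cong (mod₃ y +₃_) (mod₃-+* n y) ⟩
  mod₃ y +₃ mod₃ⁿ n *₃ mod₃ y    ≡⟨ 𝔽.distribʳ (mod₃ y) 1₃ (mod₃ⁿ n) ⟨
  mod₃ⁿ (suc n) *₃ mod₃ y ∎
  where open ≡-Reasoning

mod₃-* : ∀ x y → mod₃ (x ℤ.* y) ≡ mod₃ x *₃ mod₃ y
mod₃-* (+ n)    y = mod₃-+* n y
mod₃-* -[1+ n ] y = begin
  mod₃ (-[1+ n ] ℤ.* y)          ≡⟨ cong mod₃ (ℤ.neg-distribˡ-* (+ suc n) y) ⟨
  mod₃ (ℤ.- (+ suc n ℤ.* y))     ≡⟨ mod₃-neg (+ suc n ℤ.* y) ⟩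
  -₃ mod₃ (+ suc n ℤ.* y)        ≡⟨ cong -₃_ (mod₃-+* (suc n) y) ⟩
  -₃ (mod₃ⁿ (suc n) *₃ mod₃ y)
    ≡⟨ from-yes (∀₃? λ p → ∀₃? λ q → -₃ (p *₃ q) ≟₃ -₃ p *₃ q) (mod₃ⁿ (suc n)) (mod₃ y) ⟩
  mod₃ -[1+ n ] *₃ mod₃ y ∎
  where open ≡-Reasoning

mod₃-3* : ∀ z → mod₃ (+ 3 ℤ.* z) ≡ 0₃
mod₃-3* = mod₃-* (+ 3)

mod₃ⁿ-remainder : ∀ n → ∃[ k ] + n ≡ lift (mod₃ⁿ n) ℤ.+ + 3 ℤ.* k
mod₃ⁿ-remainder zero    = + 0 , refl
mod₃ⁿ-remainder (suc n) = step (mod₃ⁿ n) (mod₃ⁿ-remainder n)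
  where
  step : ∀ c → ∃[ k ] + n ≡ lift c ℤ.+ + 3 ℤ.* k → ∃[ k ] + suc n ≡ lift (1₃ +₃ c) ℤ.+ + 3 ℤ.* k
  step 0₃  (k , eq) = k , trans (cong ℤ.suc eq) (shift k)
    where shift : ∀ k → + 1 ℤ.+ (+ 0 ℤ.+ + 3 ℤ.* k) ≡ + 1 ℤ.+ + 3 ℤ.* k
          shift = ℤ-solve-∀
  step 1₃  (k , eq) = + 1 ℤ.+ k , trans (cong ℤ.suc eq) (shift k)
    where shift : ∀ k → + 1 ℤ.+ (+ 1 ℤ.+ + 3 ℤ.* k) ≡ -[1+ 0 ] ℤ.+ + 3 ℤ.* (+ 1 ℤ.+ k)
          shift = ℤ-solve-∀
  step -1₃ (k , eq) = k , trans (cong ℤ.suc eq) (shift k)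
    where shift : ∀ k → + 1 ℤ.+ (-[1+ 0 ] ℤ.+ + 3 ℤ.* k) ≡ + 0 ℤ.+ + 3 ℤ.* k
          shift = ℤ-solve-∀

lift-neg : ∀ c → lift (-₃ c) ≡ ℤ.- lift c
lift-neg 0₃  = refl
lift-neg 1₃  = refl
lift-neg -1₃ = refl

mod₃-remainder : ∀ z → ∃[ k ] z ≡ lift (mod₃ z) ℤ.+ + 3 ℤ.* k
mod₃-remainder (+ n)    = mod₃ⁿ-remainder n
mod₃-remainder -[1+ n ] with mod₃ⁿ-remainder (suc n)
... | k , eq = ℤ.- k , trans (cong ℤ.-_ eq) (trans (shift (lift c) k)
  (cong (ℤ._+ + 3 ℤ.* ℤ.- k) (sym (lift-neg c))))
  where
  c : 𝔽₃
  c = mod₃ⁿ (suc n)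
  shift : ∀ c k → ℤ.- (c ℤ.+ + 3 ℤ.* k) ≡ ℤ.- c ℤ.+ + 3 ℤ.* (ℤ.- k)
  shift = ℤ-solve-∀

Divisible : ℤ → Set
Divisible z = ∃[ k ] z ≡ + 3 ℤ.* k

mod₃≡0⇒divisible : ∀ z → mod₃ z ≡ 0₃ → Divisible z
mod₃≡0⇒divisible z eq with mod₃-remainder z
... | k , z≡ = k , trans z≡ (trans (cong (λ c → lift c ℤ.+ + 3 ℤ.* k) eq) (ℤ.+-identityˡ (+ 3 ℤ.* k)))

divisible⇒mod₃≡0 : ∀ {z} → Divisible z → mod₃ z ≡ 0₃
divisible⇒mod₃≡0 (k , refl) = mod₃-3* k

weight₁-square : ∀ z → + weight₁ (mod₃ z) ℤ.≤ z ℤ.* z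
weight₁-square (+ zero)  = ℤ.≤-refl
weight₁-square (+ suc n) = ℤ.≤-trans (ℤ.+≤+ (weight₁≤1 (mod₃ⁿ (suc n)))) (ℤ.+≤+ (s≤s z≤n))
weight₁-square -[1+ n ]  = ℤ.≤-trans (ℤ.+≤+ (weight₁≤1 (mod₃ -[1+ n ]))) (ℤ.+≤+ (s≤s z≤n))

infix 8 _∙_

_∙_ : ∀ {n} → Vector ℤ n → Vector ℤ n → ℤ
u ∙ v = sumℤ λ i → u i ℤ.* v i

∙-cong : ∀ {n} {u u′ v v′ : Vector ℤ n} → u ≗ u′ → v ≗ v′ → u ∙ v ≡ u′ ∙ v′
∙-cong u≗ v≗ = sum-cong-≗ λ i → cong₂ ℤ._*_ (u≗ i) (v≗ i)

∙-comm : ∀ {n} (u v : Vector ℤ n) → u ∙ v ≡ v ∙ u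
∙-comm u v = sum-cong-≗ λ i → ℤ.*-comm (u i) (v i)

∙-+ : ∀ {n} (u v w : Vector ℤ n) → (λ i → u i ℤ.+ v i) ∙ w ≡ u ∙ w ℤ.+ v ∙ w
∙-+ u v w = trans (sum-cong-≗ λ i → ℤ.*-distribʳ-+ (w i) (u i) (v i))
  (∑-distrib-+ (λ i → u i ℤ.* w i) (λ i → v i ℤ.* w i))

∙-* : ∀ {n} c (u w : Vector ℤ n) → (λ i → c ℤ.* u i) ∙ w ≡ c ℤ.* u ∙ w
∙-* c u w = trans (sum-cong-≗ λ i → ℤ.*-assoc c (u i) (w i)) (sym (*-distribˡ-sum c (λ i → u i ℤ.* w i)))

infix 9 [_]_

[_]_ : ∀ {n} → ℤ → Fin n → Vector ℤ n
([ c ] zero)  zero    = c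
([ c ] zero)  (suc j) = 0ℤ
([ c ] suc i) zero    = 0ℤ
([ c ] suc i) (suc j) = ([ c ] i) j

sum-zero : ∀ {n} {f : Vector ℤ n} → (∀ i → f i ≡ 0ℤ) → sumℤ f ≡ 0ℤ
sum-zero {n} f≡0 = trans (sum-cong-≗ f≡0) (sum-replicate-zero n)

[]-∙ : ∀ {n} c (i : Fin n) u → [ c ] i ∙ u ≡ c ℤ.* u i
[]-∙ c zero    u = trans (cong (λ z → c ℤ.* u zero ℤ.+ z) (sum-zero λ i → ℤ.*-zeroˡ (u (suc i))))
  (ℤ.+-identityʳ (c ℤ.* u zero))
[]-∙ c (suc i) u = trans (cong (ℤ._+ [ c ] i ∙ (u ∘ suc)) (ℤ.*-zeroˡ (u zero)))
  (trans (ℤ.+-identityˡ _) ([]-∙ c i (u ∘ suc)))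

[]-diagonal : ∀ {n} c (i : Fin n) → ([ c ] i) i ≡ c
[]-diagonal c zero    = refl
[]-diagonal c (suc i) = []-diagonal c i

record IsSubgroup {n} (P : Vector ℤ n → Set) : Set where
  field
    resp  : ∀ {u v} → u ≗ v → P u → P v
    zero∈ : P (λ _ → 0ℤ)
    +∈    : ∀ {u v} → P u → P v → P (λ i → u i ℤ.+ v i)
    *∈    : ∀ c {u} → P u → P (λ i → c ℤ.* u i)

  sum∈ : ∀ {k} (c : Vector ℤ k) (v : Vector (Vector ℤ n) k) → (∀ i → P (v i)) →
         P (λ j → sumℤ λ i → c i ℤ.* v i j)
  sum∈ {zero}  c v Pv = zero∈
  sum∈ {suc k} c v Pv = +∈ (*∈ (c zero) (Pv zero)) (sum∈ (c ∘ suc) (v ∘ suc) (Pv ∘ suc))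

  multiples∈ : ∀ d → (∀ i → P ([ d ] i)) → ∀ u → P (λ i → d ℤ.* u i)
  multiples∈ d units u = resp (λ j → begin
    (sumℤ λ i → u i ℤ.* ([ d ] i) j)
      ≡⟨ sum-cong-≗ (λ i → trans (ℤ.*-comm (u i) (([ d ] i) j)) (cong (ℤ._* u i) (symmetric i j))) ⟩
    [ d ] j ∙ u
      ≡⟨ []-∙ d j u ⟩
    d ℤ.* u j ∎) (sum∈ u (λ i → [ d ] i) units)
    where
    open ≡-Reasoning
    symmetric : ∀ {n} (i j : Fin n) → ([ d ] i) j ≡ ([ d ] j) i
    symmetric zero    zero    = refl
    symmetric zero    (suc j) = refl
    symmetric (suc i) zero    = refl
    symmetric (suc i) (suc j) = symmetric i j

-- Hermite bases

search : ∀ {n} {Q : Vec 𝔽₃ n → Set} → (∀ v → Dec (Q v)) → Dec (∃ Q)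
search {zero}  Q? = map′ ([] ,_) (λ { ([] , q) → q }) (Q? [])
search {suc n} Q? = map′ (λ { (c , v , q) → c ∷ v , q }) (λ { (c ∷ v , q) → c , v , q })
  (∃₃? λ c → search λ v → Q? (c ∷ v))

Triangular : ∀ {n} → Vector (Vector ℤ n) n → Set
Triangular {zero}  B = ⊤
Triangular {suc n} B = (B zero zero ≡ + 1 ⊎ B zero zero ≡ + 3) × (∀ i → B (suc i) zero ≡ 0ℤ) ×
  Triangular (λ i j → B (suc i) (suc j))

record TriangularBasis {n} (P : Vector ℤ n → Set) : Set where
  field
    basis      : Vector (Vector ℤ n) n
    triangular : Triangular basis
    member     : ∀ i → P (basis i)
    spans      : ∀ u → P u → Σ[ c ∈ Vector ℤ n ] ∀ j → u j ≡ sumℤ (λ i → c i ℤ.* basis i j)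

abstract
  -- The heads of the members form an ideal containing 3, so the pivot is 1 or 3, and the members
  -- with head 0 are treated recursively. Modulo 3 there are finitely many tails, so a search
  -- decides which pivot occurs; `abstract` keeps that search of size 3ⁿ opaque.
  triangularBasis : ∀ {n} (P : Vector ℤ n → Set) → IsSubgroup P → (∀ u → Dec (P u)) →
                    (∀ (u : Vector ℤ n) → P (λ i → + 3 ℤ.* u i)) → TriangularBasis P
  triangularBasis {zero} P sub P? 3∈ = record
    { basis = λ () ; triangular = tt ; member = λ () ; spans = λ _ _ → (λ ()) , λ () }
  triangularBasis {suc n} P sub P? 3∈ = extend (head-row (search λ v → P? (Vector._∷_ (+ 1) (lift ∘ lookup v))))
    where
    open IsSubgroup sub

    P′ : Vector ℤ n → Set
    P′ u = P (Vector._∷_ 0ℤ u)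

    cons-cong : ∀ {c d : ℤ} {u v : Vector ℤ n} → c ≡ d → u ≗ v → Vector._∷_ c u ≗ Vector._∷_ d v
    cons-cong c≡d u≗v zero    = c≡d
    cons-cong c≡d u≗v (suc i) = u≗v i

    sub′ : IsSubgroup P′
    sub′ = record
      { resp  = λ u≗v → resp (cons-cong refl u≗v)
      ; zero∈ = resp (λ { zero → refl ; (suc i) → refl }) zero∈
      ; +∈    = λ p q → resp (λ { zero → refl ; (suc i) → refl }) (+∈ p q)
      ; *∈    = λ c p → resp (λ { zero → ℤ.*-zeroʳ c ; (suc i) → refl }) (*∈ c p) }

    tail-basis : TriangularBasis P′
    tail-basis = triangularBasis P′ sub′ (λ u → P? (Vector._∷_ 0ℤ u))
      λ u → resp (λ { zero → refl ; (suc i) → refl }) (3∈ (Vector._∷_ 0ℤ u))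

    HeadRow : Set
    HeadRow = ∃[ r ] P r × (r zero ≡ + 1 ⊎ r zero ≡ + 3) × (∀ (u : Vector ℤ (suc n)) → P u → ∃[ k ] u zero ≡ k ℤ.* r zero)

    head-row : Dec (∃[ v ] P (Vector._∷_ (+ 1) (lift ∘ lookup v))) → HeadRow
    head-row (yes (v , p)) = _ , p , inj₁ refl , λ u _ → u zero , sym (ℤ.*-identityʳ (u zero))
    head-row (no ¬p) = (λ i → + 3 ℤ.* ([ + 1 ] zero) i) , 3∈ ([ + 1 ] zero) , inj₂ refl , λ u p →
      let k , eq = mod₃≡0⇒divisible (u zero) (head≡0 u p) in k , trans eq (ℤ.*-comm (+ 3) k)
      where
      head≢1 : ∀ u → P u → mod₃ (u zero) ≢ 1₃
      -- Subtracting multiples of 3 replaces each coordinate by its residue in {0, 1, -1}, which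
      -- gives a vector within the range of the search.
      head≢1 u p eq = ¬p (Vec.tabulate (mod₃ ∘ u ∘ suc) , resp rounding (+∈ p (3∈ (λ i → ℤ.- q i))))
        where
        q : Vector ℤ (suc n)
        q i = proj₁ (mod₃-remainder (u i))
        round : ∀ i → u i ℤ.+ + 3 ℤ.* (ℤ.- q i) ≡ lift (mod₃ (u i))
        round i = trans (cong (ℤ._+ + 3 ℤ.* (ℤ.- q i)) (proj₂ (mod₃-remainder (u i))))
          (cancel (lift (mod₃ (u i))) (q i))
          where
          cancel : ∀ c k → (c ℤ.+ + 3 ℤ.* k) ℤ.+ + 3 ℤ.* (ℤ.- k) ≡ c
          cancel = ℤ-solve-∀
        rounding : (λ i → u i ℤ.+ + 3 ℤ.* (ℤ.- q i)) ≗
                   Vector._∷_ (+ 1) (lift ∘ lookup (Vec.tabulate (mod₃ ∘ u ∘ suc)))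
        rounding zero    = trans (round zero) (cong lift eq)
        rounding (suc i) = trans (round (suc i)) (cong lift (sym (Vec.lookup∘tabulate (mod₃ ∘ u ∘ suc) i)))
      head≡0 : ∀ u → P u → mod₃ (u zero) ≡ 0₃
      head≡0 u p = cases (mod₃ (u zero)) refl
        where
        cases : ∀ c → mod₃ (u zero) ≡ c → c ≡ 0₃
        cases 0₃  eq = refl
        cases 1₃  eq = contradiction eq (head≢1 u p)
        cases -1₃ eq = contradiction
          (trans (mod₃-* -[1+ 0 ] (u zero)) (cong -₃_ eq))
          (head≢1 (λ i → -[1+ 0 ] ℤ.* u i) (*∈ -[1+ 0 ] p))

    extend : HeadRow → TriangularBasis P
    extend (r , Pr , unit , divides) = record
      { basis      = B
      ; triangular = unit , (λ _ → refl) , T.triangular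
      ; member     = λ { zero → Pr ; (suc i) → T.member i }
      ; spans      = spans′ }
      where
      module T = TriangularBasis tail-basis
      B : Vector (Vector ℤ (suc n)) (suc n)
      B zero    = r
      B (suc i) = Vector._∷_ 0ℤ (T.basis i)
      spans′ : ∀ u → P u → Σ[ c ∈ Vector ℤ (suc n) ] ∀ j → u j ≡ sumℤ (λ i → c i ℤ.* B i j)
      spans′ u Pu with divides u Pu
      ... | k , u₀≡ with T.spans (λ i → u (suc i) ℤ.+ (ℤ.- k) ℤ.* r (suc i))
                       (resp (λ { zero → trans (cong (ℤ._+ (ℤ.- k) ℤ.* r zero) u₀≡) (cancel k (r zero)) ; (suc i) → refl })
                         (+∈ Pu (*∈ (ℤ.- k) Pr)))
        where
        cancel : ∀ k r → k ℤ.* r ℤ.+ (ℤ.- k) ℤ.* r ≡ 0ℤ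
        cancel = ℤ-solve-∀
      ...   | c , eq = Vector._∷_ k c , λ
        { zero    → trans u₀≡ (trans (sym (ℤ.+-identityʳ (k ℤ.* r zero)))
                      (cong (λ z → k ℤ.* r zero ℤ.+ z) (sym (sum-zero {f = λ i → c i ℤ.* 0ℤ} λ i → ℤ.*-zeroʳ (c i)))))
        ; (suc j) → trans (restore (u (suc j)) k (r (suc j))) (cong (λ z → k ℤ.* r (suc j) ℤ.+ z) (eq j)) }
        where
        restore : ∀ u k r → u ≡ k ℤ.* r ℤ.+ (u ℤ.+ (ℤ.- k) ℤ.* r)
        restore = ℤ-solve-∀

-- L = (1/√3) A is a unimodular lattice of minimum norm 3 which is generated by its minimal vectors; the
-- last field says that the vectors √3 eᵢ are linked by chains of non-orthogonal minimal vectors.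
record MinimalTernary {n} (A : Vector ℤ n → Set) : Set₁ where
  Short : Vector ℤ n → Set
  Short u = A u × u ∙ u ≡ + 9
  field
    A?         : ∀ u → Dec (A u)
    orthogonal : ∀ u v → A u → A v → Divisible (u ∙ v)
    dual       : ∀ u → (∀ v → A v → Divisible (u ∙ v)) → A u
    minimal    : ∀ u → A u → (∀ i → u i ≡ 0ℤ) ⊎ + 9 ℤ.≤ u ∙ u
    -- Generation and connectivity are stated as induction principles, to be applied to
    -- `GeneratedBy` and to `Contains`.
    generated  : ∀ {P : Vector ℤ n → Set} → IsSubgroup P → (∀ {u} → Short u → P u) → ∀ u → A u → P u
    connected  : ∀ {T : Vector ℤ n → Set} → (∀ {u v} → Short u → Short v → u ∙ v ≢ 0ℤ → T u → T v) →
                 ∀ i j → T ([ + 3 ] i) → T ([ + 3 ] j)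

  -- `A` is its own dual modulo 3, and a dual is closed under linear combinations by bilinearity.
  subgroup : IsSubgroup A
  subgroup = record
    { resp  = λ {u} {v} u≗v Au → dual v λ w Aw →
        subst Divisible (∙-cong u≗v λ _ → refl) (orthogonal u w Au Aw)
    ; zero∈ = dual _ λ w _ → 0ℤ , trans (sum-zero (λ i → ℤ.*-zeroˡ (w i))) (sym (ℤ.*-zeroʳ (+ 3)))
    ; +∈    = λ {u} {v} Au Av → dual _ λ w Aw →
        let k , u∙w≡ = orthogonal u w Au Aw
            l , v∙w≡ = orthogonal v w Av Aw
        in k ℤ.+ l , trans (∙-+ u v w) (trans (cong₂ ℤ._+_ u∙w≡ v∙w≡) (sym (ℤ.*-distribˡ-+ (+ 3) k l)))
    ; *∈    = λ c {u} Au → dual _ λ w Aw →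
        let k , u∙w≡ = orthogonal u w Au Aw
        in c ℤ.* k , trans (∙-* c u w) (trans (cong (c ℤ.*_) u∙w≡) (swap-factors c k)) }
    where
    swap-factors : ∀ c k → c ℤ.* (+ 3 ℤ.* k) ≡ + 3 ℤ.* (c ℤ.* k)
    swap-factors = ℤ-solve-∀

  3*∈ : ∀ (u : Vector ℤ n) → A (λ i → + 3 ℤ.* u i)
  3*∈ u = dual _ λ w _ → u ∙ w , ∙-* (+ 3) u w

  3-unit : ∀ i → Short ([ + 3 ] i)
  3-unit i = dual _ (λ w _ → w i , []-∙ (+ 3) i w)
           , trans ([]-∙ (+ 3) i ([ + 3 ] i)) (cong (+ 3 ℤ.*_) ([]-diagonal (+ 3) i))

  triangular-basis : TriangularBasis A
  triangular-basis = triangularBasis A subgroup A? 3*∈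

-- Construction A for the chain code

sum-↑ : ∀ k {l} (f : Vector ℤ (k ℕ.+ l)) → sumℤ f ≡ sumℤ (λ i → f (i ↑ˡ l)) ℤ.+ sumℤ (λ i → f (k ↑ʳ i))
sum-↑ zero    f = sym (ℤ.+-identityˡ (sumℤ f))
sum-↑ (suc k) f = trans (cong (λ z → f zero ℤ.+ z) (sum-↑ k (f ∘ suc)))
  (sym (ℤ.+-assoc (f zero) _ _))

sum-combine : ∀ k l (f : Vector ℤ (k ℕ.* l)) → sumℤ f ≡ sumℤ λ (i : Fin k) → sumℤ λ (j : Fin l) → f (combine i j)
sum-combine zero    l f = refl
sum-combine (suc k) l f = trans (sum-↑ l f)
  (cong (λ z → sumℤ (λ j → f (j ↑ˡ k ℕ.* l)) ℤ.+ z) (sum-combine k l (λ i → f (l ↑ʳ i))))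

Rank : ℕ → ℕ
Rank m = 24 ℕ.* m

-- Coordinate j of block i sits at position combine j i.
reduce : ∀ m → Vector ℤ (Rank m) → Word m
reduce m u = tabulate λ i → tabulate λ j → mod₃ (u (combine j i))

entry-reduce : ∀ m u i j → entry (reduce m u) i j ≡ mod₃ (u (combine j i))
entry-reduce m u i j = trans
  (cong (λ v → lookup v j) (Vec.lookup∘tabulate (λ i → tabulate λ j → mod₃ (u (combine j i))) i))
  (Vec.lookup∘tabulate (λ j → mod₃ (u (combine j i))) j)

lookup-ext : ∀ {A : Set} {n} {u v : Vec A n} → (∀ i → lookup u i ≡ lookup v i) → u ≡ v
lookup-ext {u = []}    {[]}    eq = refl
lookup-ext {u = _ ∷ _} {_ ∷ _} eq = cong₂ _∷_ (eq zero) (lookup-ext (eq ∘ suc))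

entry-ext : ∀ {m} {U V : Word m} → (∀ i j → entry U i j ≡ entry V i j) → U ≡ V
entry-ext eq = lookup-ext λ i → lookup-ext (eq i)

reduce-≡ : ∀ m u V → (∀ i j → mod₃ (u (combine j i)) ≡ entry V i j) → reduce m u ≡ V
reduce-≡ m u V eq = entry-ext λ i j → trans (entry-reduce m u i j) (eq i j)

liftʷ : ∀ m → Word m → Vector ℤ (Rank m)
liftʷ m U k = let j , i = remQuot {24} m k in lift (entry U i j)

liftʷ-combine : ∀ m U i j → liftʷ m U (combine j i) ≡ lift (entry U i j)
liftʷ-combine m U i j = cong (λ p → lift (entry U (proj₂ p) (proj₁ p))) (Fin.remQuot-combine j i)

reduce-liftʷ : ∀ m U → reduce m (liftʷ m U) ≡ U
reduce-liftʷ m U = reduce-≡ m (liftʷ m U) U λ i j →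
  trans (cong mod₃ (liftʷ-combine m U i j)) (mod₃-lift (entry U i j))

dot-tabulate : ∀ {n} (f g : Vector ℤ n) →
               dot (tabulate (mod₃ ∘ f)) (tabulate (mod₃ ∘ g)) ≡ mod₃ (f ∙ g)
dot-tabulate {zero}  f g = refl
dot-tabulate {suc n} f g = trans
  (cong₂ _+₃_ (sym (mod₃-* (f zero) (g zero))) (dot-tabulate (f ∘ suc) (g ∘ suc)))
  (sym (mod₃-+ (f zero ℤ.* g zero) ((f ∘ suc) ∙ (g ∘ suc))))

dotʷ-tabulate : ∀ {m} (F G : Fin m → Block) (h : Vector ℤ m) → (∀ i → dot (F i) (G i) ≡ mod₃ (h i)) →
                dotʷ (tabulate F) (tabulate G) ≡ mod₃ (sumℤ h)
dotʷ-tabulate {zero}  F G h eq = refl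
dotʷ-tabulate {suc m} F G h eq = trans
  (cong₂ _+₃_ (eq zero) (dotʷ-tabulate (F ∘ suc) (G ∘ suc) (h ∘ suc) (eq ∘ suc)))
  (sym (mod₃-+ (h zero) (sumℤ (h ∘ suc))))

sum-blocks : ∀ m (f : Vector ℤ (Rank m)) →
             sumℤ f ≡ sumℤ λ (i : Fin m) → sumℤ λ (j : Fin 24) → f (combine j i)
sum-blocks m f = trans (sum-combine 24 m f) (∑-comm (λ (j : Fin 24) (i : Fin m) → f (combine j i)))

dotʷ-reduce : ∀ m u v → dotʷ (reduce m u) (reduce m v) ≡ mod₃ (u ∙ v)
dotʷ-reduce m u v = trans
  (dotʷ-tabulate {m} _ _ _ λ i → dot-tabulate {24} (λ j → u (combine j i)) (λ j → v (combine j i)))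
  (cong mod₃ (sym (sum-blocks m (λ k → u k ℤ.* v k))))

weight-tabulate : ∀ {n} (f : Vector ℤ n) → + weight (tabulate (mod₃ ∘ f)) ℤ.≤ f ∙ f
weight-tabulate {zero}  f = ℤ.≤-refl
weight-tabulate {suc n} f = ℤ.+-mono-≤ (weight₁-square (f zero)) (weight-tabulate (f ∘ suc))

weightʷ-tabulate : ∀ {m} (F : Fin m → Block) (h : Vector ℤ m) → (∀ i → + weight (F i) ℤ.≤ h i) →
                   + weightʷ (tabulate F) ℤ.≤ sumℤ h
weightʷ-tabulate {zero}  F h le = ℤ.≤-refl
weightʷ-tabulate {suc m} F h le = ℤ.+-mono-≤ (le zero) (weightʷ-tabulate (F ∘ suc) (h ∘ suc) (le ∘ suc))

weightʷ-reduce : ∀ m u → + weightʷ (reduce m u) ℤ.≤ u ∙ u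
weightʷ-reduce m u = subst (+ weightʷ (reduce m u) ℤ.≤_) (sym (sum-blocks m (λ k → u k ℤ.* u k)))
  (weightʷ-tabulate {m} _ _ λ i → weight-tabulate {24} (λ j → u (combine j i)))

lift-square : ∀ c → lift c ℤ.* lift c ≡ + weight₁ c
lift-square 0₃  = refl
lift-square 1₃  = refl
lift-square -1₃ = refl

weight-sum : ∀ {n} (u : Vec 𝔽₃ n) → sumℤ (λ j → + weight₁ (lookup u j)) ≡ + weight u
weight-sum []      = refl
weight-sum (c ∷ u) = cong (λ z → + weight₁ c ℤ.+ z) (weight-sum u)

weightʷ-sum : ∀ {m} (U : Word m) → sumℤ (λ i → + weight (lookup U i)) ≡ + weightʷ U
weightʷ-sum []      = refl
weightʷ-sum (u ∷ U) = cong (λ z → + weight u ℤ.+ z) (weightʷ-sum U)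

norm-liftʷ : ∀ m U → liftʷ m U ∙ liftʷ m U ≡ + weightʷ U
norm-liftʷ m U = begin
  liftʷ m U ∙ liftʷ m U
    ≡⟨ sum-blocks m (λ k → liftʷ m U k ℤ.* liftʷ m U k) ⟩
  (sumℤ λ (i : Fin m) → sumℤ λ (j : Fin 24) → liftʷ m U (combine j i) ℤ.* liftʷ m U (combine j i))
    ≡⟨ sum-cong-≗ {m} (λ i → trans (sum-cong-≗ {24} λ j →
         trans (cong (λ z → z ℤ.* z) (liftʷ-combine m U i j)) (lift-square (entry U i j)))
         (weight-sum (lookup U i))) ⟩
  (sumℤ λ (i : Fin m) → + weight (lookup U i))
    ≡⟨ weightʷ-sum U ⟩
  + weightʷ U ∎
  where open ≡-Reasoning

reduce≡𝟎⇒divisible : ∀ m u → reduce m u ≡ 𝟎ʷ → ∀ k → Divisible (u k)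
reduce≡𝟎⇒divisible m u eq k = subst (Divisible ∘ u) (Fin.combine-remQuot {24} m k)
  (mod₃≡0⇒divisible (u (combine j i)) (trans (sym (entry-reduce m u i j))
    (trans (cong (λ U → entry U i j) eq)
      (trans (cong (λ v → lookup v j) (Vec.lookup-replicate i 𝟎)) (Vec.lookup-replicate j 0₃)))))
  where
  j : Fin 24
  j = proj₁ (remQuot {24} m k)
  i : Fin m
  i = proj₂ (remQuot {24} m k)

square-nonNegative : ∀ z → 0ℤ ℤ.≤ z ℤ.* z
square-nonNegative z = ℤ.≤-trans (ℤ.+≤+ z≤n) (weight₁-square z)

norm-nonNegative : ∀ {n} (u : Vector ℤ n) → 0ℤ ℤ.≤ u ∙ u
norm-nonNegative {zero}  u = ℤ.≤-refl
norm-nonNegative {suc n} u = ℤ.+-mono-≤ (square-nonNegative (u zero)) (norm-nonNegative (u ∘ suc))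

norm-positive : ∀ {n} (u : Vector ℤ n) → (∀ i → u i ≡ 0ℤ) ⊎ + 1 ℤ.≤ u ∙ u
norm-positive {zero}  u = inj₁ λ ()
norm-positive {suc n} u = cases (u zero) refl (norm-positive (u ∘ suc))
  where
  rest : ℤ
  rest = (u ∘ suc) ∙ (u ∘ suc)
  cases : ∀ z → u zero ≡ z → (∀ i → u (suc i) ≡ 0ℤ) ⊎ + 1 ℤ.≤ rest →
          (∀ i → u i ≡ 0ℤ) ⊎ + 1 ℤ.≤ u zero ℤ.* u zero ℤ.+ rest
  cases (+ zero)  eq (inj₁ zeros) = inj₁ λ { zero → eq ; (suc i) → zeros i }
  cases z         eq (inj₂ 1≤)    = inj₂ (ℤ.+-mono-≤ (square-nonNegative (u zero)) 1≤)
  cases (+ suc n) eq _ = inj₂ (ℤ.+-mono-≤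
    (subst (λ z → + 1 ℤ.≤ z ℤ.* z) (sym eq) (ℤ.+≤+ (s≤s z≤n))) (norm-nonNegative (u ∘ suc)))
  cases -[1+ n ]  eq _ = inj₂ (ℤ.+-mono-≤
    (subst (λ z → + 1 ℤ.≤ z ℤ.* z) (sym eq) (ℤ.+≤+ (s≤s z≤n))) (norm-nonNegative (u ∘ suc)))

-- Covers the vectors over the zero word: they are 3q, of norm nine times that of q.
tripled-norm : ∀ {n} (u : Vector ℤ n) → (∀ i → Divisible (u i)) → (∀ i → u i ≡ 0ℤ) ⊎ + 9 ℤ.≤ u ∙ u
tripled-norm {n} u div = cases (norm-positive q)
  where
  q : Vector ℤ n
  q i = proj₁ (div i)
  norm≡ : u ∙ u ≡ + 9 ℤ.* q ∙ q
  norm≡ = trans (sum-cong-≗ λ i → trans (cong₂ ℤ._*_ (proj₂ (div i)) (proj₂ (div i))) (square (q i)))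
    (sym (*-distribˡ-sum (+ 9) (λ i → q i ℤ.* q i)))
    where
    square : ∀ q → (+ 3 ℤ.* q) ℤ.* (+ 3 ℤ.* q) ≡ + 9 ℤ.* (q ℤ.* q)
    square = ℤ-solve-∀
  cases : (∀ i → q i ≡ 0ℤ) ⊎ + 1 ℤ.≤ q ∙ q → (∀ i → u i ≡ 0ℤ) ⊎ + 9 ℤ.≤ u ∙ u
  cases (inj₁ zeros) = inj₁ λ i → trans (proj₂ (div i)) (cong (+ 3 ℤ.*_) (zeros i))
  cases (inj₂ 1≤)    = inj₂ (subst (+ 9 ℤ.≤_) (sym norm≡) (ℤ.*-monoˡ-≤-nonNeg (+ 9) 1≤))

-- Gains the unit from weight 8 to norm 9, as norms in a self-orthogonal code lattice are multiples
-- of three.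
round-up : ∀ z → Divisible z → + 8 ℤ.≤ z → + 9 ℤ.≤ z
round-up z (k , refl) 8≤ with k ℤ.≤? + 2
... | yes k≤2 = contradiction (ℤ.≤-trans 8≤ (ℤ.*-monoˡ-≤-nonNeg (+ 3) k≤2)) λ { (ℤ.+≤+ (s≤s (s≤s (s≤s (s≤s (s≤s (s≤s ()))))))) }
... | no  k≰2 = ℤ.*-monoˡ-≤-nonNeg (+ 3) (ℤ.i<j⇒suc[i]≤j (ℤ.≰⇒> k≰2))

-- A record, so that a membership proof determines its vector, where `Code (reduce m u)` would
-- unfold.
record ChainCode m (u : Vector ℤ (Rank m)) : Set where
  constructor reduces
  field
    code : Code (reduce m u)
open ChainCode

-- Each generator in the expansion of the reduced word is subtracted as its lift with entries 0, 1,
-- -1. What remains reduces to zero and is a combination of the vectors `[ + 3 ] i`.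
chainCode-generated : ∀ m {P : Vector ℤ (Rank m) → Set} → IsSubgroup P →
  (∀ {U} → Gen⁺ U → P (liftʷ m U)) → (∀ i → P ([ + 3 ] i)) →
  ∀ {U} → Span Gen⁺ U → ∀ u → reduce m u ≡ U → P u
chainCode-generated m sub gens units empty u eq =
  resp (λ k → sym (proj₂ (reduce≡𝟎⇒divisible m u eq k)))
    (multiples∈ (+ 3) units (λ k → proj₁ (reduce≡𝟎⇒divisible m u eq k)))
  where open IsSubgroup sub
chainCode-generated m sub gens units (add c {U} {V} g s) u eq =
  resp (λ k → cancel (u k) (lift c ℤ.* liftʷ m U k))
    (+∈ (chainCode-generated m sub gens units s v (reduce-≡ m v V entry≡)) (*∈ (lift c) (gens g)))
  where
  open IsSubgroup sub
  open ≡-Reasoning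
  v : Vector ℤ (Rank m)
  v k = u k ℤ.+ ℤ.- (lift c ℤ.* liftʷ m U k)
  cancel : ∀ x y → (x ℤ.+ ℤ.- y) ℤ.+ y ≡ x
  cancel = ℤ-solve-∀
  entry-⊞ : ∀ {m} (U V : Word m) i j → entry (c ⊡ʷ U ⊞ʷ V) i j ≡ c *₃ entry U i j +₃ entry V i j
  entry-⊞ (u ∷ U) (v ∷ V) zero    j = trans (Vec.lookup-zipWith _+₃_ j (c ⊡ u) v)
    (cong (_+₃ lookup v j) (Vec.lookup-map j (c *₃_) u))
  entry-⊞ (u ∷ U) (v ∷ V) (suc i) j = entry-⊞ U V i j
  entry≡ : ∀ i j → mod₃ (v (combine j i)) ≡ entry V i j
  entry≡ i j = begin
    mod₃ (v k)
      ≡⟨ mod₃-+ (u k) (ℤ.- (lift c ℤ.* liftʷ m U k)) ⟩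
    mod₃ (u k) +₃ mod₃ (ℤ.- (lift c ℤ.* liftʷ m U k))
      ≡⟨ cong₂ _+₃_
           (trans (sym (entry-reduce m u i j)) (trans (cong (λ W → entry W i j) eq) (entry-⊞ U V i j)))
           (trans (mod₃-neg (lift c ℤ.* liftʷ m U k)) (cong -₃_
             (trans (mod₃-* (lift c) (liftʷ m U k)) (cong₂ _*₃_ (mod₃-lift c)
               (trans (cong mod₃ (liftʷ-combine m U i j)) (mod₃-lift (entry U i j))))))) ⟩
    (c *₃ entry U i j +₃ entry V i j) +₃ -₃ (c *₃ entry U i j)
      ≡⟨ from-yes (∀₃? λ p → ∀₃? λ q → (p +₃ q) +₃ -₃ p ≟₃ q) (c *₃ entry U i j) (entry V i j) ⟩
    entry V i j ∎
    where
    k : Fin (Rank m)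
    k = combine j i

chainCode : ∀ m → MinimalTernary (ChainCode (suc m))
chainCode m′ = record
  { A?         = λ u → map′ reduces code (code? (reduce m u))
  ; orthogonal = orthogonal
  ; dual       = dual
  ; minimal    = λ u Au → cases u Au (code-weight (reduce m u) (code Au))
  ; generated  = λ sub short u Au → chainCode-generated m sub (λ g → short (gen-short g))
                   (λ i → short (unit-short i)) (code-span (reduce m u) (code Au)) u refl
  ; connected  = connected′
  }
  where
  m : ℕ
  m = suc m′
  orthogonal : ∀ u v → ChainCode m u → ChainCode m v → Divisible (u ∙ v)
  orthogonal u v Au Av = mod₃≡0⇒divisible (u ∙ v)
    (trans (sym (dotʷ-reduce m u v)) (code-dot (reduce m u) (reduce m v) (code Au) (code Av)))
  gen-short : ∀ {U} → Gen⁺ U → ChainCode m (liftʷ m U) × liftʷ m U ∙ liftʷ m U ≡ + 9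
  gen-short {U} g = reduces (subst Code (sym (reduce-liftʷ m U)) (gen-code g))
                  , trans (norm-liftʷ m U) (cong +_ (gen-weight g))
  dual : ∀ u → (∀ v → ChainCode m v → Divisible (u ∙ v)) → ChainCode m u
  dual u ortho = reduces (gen-dual (reduce m u) λ {V} g → trans
    (cong (dotʷ (reduce m u)) (sym (reduce-liftʷ m V)))
    (trans (dotʷ-reduce m u (liftʷ m V)) (divisible⇒mod₃≡0 (ortho (liftʷ m V) (proj₁ (gen-short g))))))
  unit-short : ∀ i → ChainCode m ([ + 3 ] i) × [ + 3 ] i ∙ [ + 3 ] i ≡ + 9
  unit-short i = dual _ (λ w _ → w i , []-∙ (+ 3) i w)
               , trans ([]-∙ (+ 3) i ([ + 3 ] i)) (cong (+ 3 ℤ.*_) ([]-diagonal (+ 3) i))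
  cases : ∀ u → ChainCode m u → reduce m u ≡ 𝟎ʷ ⊎ 8 ℕ.≤ weightʷ (reduce m u) →
          (∀ i → u i ≡ 0ℤ) ⊎ + 9 ℤ.≤ u ∙ u
  cases u Au (inj₁ eq) = tripled-norm u (reduce≡𝟎⇒divisible m u eq)
  cases u Au (inj₂ 8≤) = inj₂ (round-up (u ∙ u) (orthogonal u u Au Au)
    (ℤ.≤-trans (ℤ.+≤+ 8≤) (weightʷ-reduce m u)))
  connected′ : ∀ {T : Vector ℤ (Rank m) → Set} →
    (∀ {u v} → ChainCode m u × u ∙ u ≡ + 9 → ChainCode m v × v ∙ v ≡ + 9 → u ∙ v ≢ 0ℤ → T u → T v) →
    ∀ i j → T ([ + 3 ] i) → T ([ + 3 ] j)
  connected′ {T} related i j t = subst (λ k → T ([ + 3 ] k)) (Fin.combine-remQuot {24} m j)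
    (gen-connected T′ closed zero (connected-back (proj₂ (remQuot {24} m i)) (proj₁ (remQuot {24} m i))
      (subst (λ k → T ([ + 3 ] k)) (sym (Fin.combine-remQuot {24} m i)) t))
      (proj₂ (remQuot {24} m j)) (proj₁ (remQuot {24} m j)))
    where
    T′ : Fin m → Fin 24 → Set
    T′ i j = T ([ + 3 ] (combine j i))
    3*≢0 : ∀ {z} → z ≢ 0ℤ → + 3 ℤ.* z ≢ 0ℤ
    3*≢0 {z} z≢0 eq = z≢0 (ℤ.*-cancelˡ-≡ (+ 3) z 0ℤ eq)
    lift≢0 : ∀ c → c ≢ 0₃ → lift c ≢ 0ℤ
    lift≢0 0₃  c≢0 _ = c≢0 refl
    unit-gen : ∀ U i j → entry U i j ≢ 0₃ → [ + 3 ] (combine j i) ∙ liftʷ m U ≢ 0ℤ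
    unit-gen U i j ≢0 eq = 3*≢0 (lift≢0 (entry U i j) ≢0)
      (trans (cong (+ 3 ℤ.*_) (sym (liftʷ-combine m U i j))) (trans (sym ([]-∙ (+ 3) (combine j i) (liftʷ m U))) eq))
    -- The path goes from one `[ + 3 ] k` to another through the lifted generator, whose product
    -- with such a vector is three times its entry there.
    closed : ∀ {U} → Gen U → Closed T′ U
    closed {U} g i j i′ j′ ≢0 ≢0′ t =
      related (gen-short (gen g)) (unit-short (combine j′ i′))
        (λ eq → unit-gen U i′ j′ ≢0′ (trans (∙-comm ([ + 3 ] (combine j′ i′)) (liftʷ m U)) eq))
        (related (unit-short (combine j i)) (gen-short (gen g)) (unit-gen U i j ≢0) t)
    -- `gen-connected` starts in the first block only. Applied to the predicate "`T′` here implies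
    -- `T′` at the origin" it runs the paths backwards.
    connected-back : ∀ i j → T′ i j → T′ zero zero
    connected-back i j = gen-connected (λ i′ j′ → T′ i′ j′ → T′ zero zero)
      (λ g i j i′ j′ ≢0 ≢0′ back t → back (closed g i′ j′ i j ≢0′ ≢0 t)) zero (λ t → t) i j

-- Integral lattices over a commutative ring

record IntegerHomomorphism (R : CommutativeRing 0ℓ 0ℓ) : Set where
  private module R = CommutativeRing R
  field
    ι   : ℤ → R.Carrier
    ι-+ : ∀ a b → ι (a ℤ.+ b) R.≈ ι a R.+ ι b
    ι-* : ∀ a b → ι (a ℤ.* b) R.≈ ι a R.* ι b
    ι-0 : ι (+ 0) R.≈ R.0#
    ι-1 : ι (+ 1) R.≈ R.1#

module Embedding (R : CommutativeRing 0ℓ 0ℓ) (h : IntegerHomomorphism R) where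

  open CommutativeRing R
    using (Carrier; 0#; 1#; reflexive; setoid; semiring; +-assoc; +-congˡ; +-congʳ; +-identityˡ; +-identityʳ;
           *-assoc; *-comm; *-congˡ; *-congʳ; *-identityˡ; *-identityʳ; zeroˡ; zeroʳ)
    renaming (_≈_ to _≈ᴿ_; _+_ to _+ᴿ_; _*_ to _*ᴿ_; sym to ≈-sym; trans to ≈-trans)
  open IntegerHomomorphism h
  module Σᴿ = SemiringSum semiring
  open Σᴿ using () renaming (sum to ∑; sum-cong-≋ to ∑-cong)
  open SetoidReasoning setoid

  embed : ∀ {n} → Carrier → Vector ℤ n → Vector Carrier n
  embed s u i = s *ᴿ ι (u i)

  *-swap : ∀ a b c → a *ᴿ (b *ᴿ c) ≈ᴿ b *ᴿ (a *ᴿ c)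
  *-swap a b c = ≈-trans (≈-sym (*-assoc a b c)) (≈-trans (*-congʳ (*-comm a b)) (*-assoc b a c))

  ∑-zero : ∀ {n} {f : Vector Carrier n} → (∀ i → f i ≈ᴿ 0#) → ∑ f ≈ᴿ 0#
  ∑-zero {n} f≈0 = ≈-trans (∑-cong f≈0) (Σᴿ.sum-replicate-zero n)

  ∑-↑ : ∀ k {l} (f : Vector Carrier (k ℕ.+ l)) → ∑ f ≈ᴿ ∑ (λ i → f (i ↑ˡ l)) +ᴿ ∑ (λ i → f (k ↑ʳ i))
  ∑-↑ zero    f = ≈-sym (+-identityˡ (∑ f))
  ∑-↑ (suc k) f = ≈-trans (+-congˡ (∑-↑ k (f ∘ suc))) (≈-sym (+-assoc (f zero) _ _))

  ι-sum : ∀ {n} (f : Vector ℤ n) → ι (sumℤ f) ≈ᴿ ∑ (ι ∘ f)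
  ι-sum {zero}  f = ι-0
  ι-sum {suc n} f = ≈-trans (ι-+ (f zero) (sumℤ (f ∘ suc))) (+-congˡ (ι-sum (f ∘ suc)))

  embed-dot : ∀ {n} s t (u v : Vector ℤ n) → ∑ (λ i → embed s u i *ᴿ embed t v i) ≈ᴿ s *ᴿ t *ᴿ ι (u ∙ v)
  embed-dot s t u v = begin
    ∑ (λ i → embed s u i *ᴿ embed t v i)     ≈⟨ ∑-cong (λ i → begin
      s *ᴿ ι (u i) *ᴿ (t *ᴿ ι (v i))            ≈⟨ *-assoc s (ι (u i)) (t *ᴿ ι (v i)) ⟩
      s *ᴿ (ι (u i) *ᴿ (t *ᴿ ι (v i)))          ≈⟨ *-congˡ (*-swap (ι (u i)) t (ι (v i))) ⟩
      s *ᴿ (t *ᴿ (ι (u i) *ᴿ ι (v i)))          ≈⟨ *-assoc s t (ι (u i) *ᴿ ι (v i)) ⟨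
      s *ᴿ t *ᴿ (ι (u i) *ᴿ ι (v i))            ≈⟨ *-congˡ (ι-* (u i) (v i)) ⟨
      s *ᴿ t *ᴿ ι (u i ℤ.* v i) ∎) ⟩
    ∑ (λ i → s *ᴿ t *ᴿ ι (u i ℤ.* v i))       ≈⟨ Σᴿ.*-distribˡ-sum (s *ᴿ t) (λ i → ι (u i ℤ.* v i)) ⟨
    s *ᴿ t *ᴿ ∑ (λ i → ι (u i ℤ.* v i))       ≈⟨ *-congˡ (ι-sum (λ i → u i ℤ.* v i)) ⟨
    s *ᴿ t *ᴿ ι (u ∙ v) ∎

  embed-combination : ∀ {k n} s (c : Vector ℤ k) (b : Vector (Vector ℤ n) k) j →
    ∑ (λ i → ι (c i) *ᴿ embed s (b i) j) ≈ᴿ embed s (λ j → sumℤ λ i → c i ℤ.* b i j) j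
  embed-combination s c b j = begin
    ∑ (λ i → ι (c i) *ᴿ (s *ᴿ ι (b i j)))  ≈⟨ ∑-cong (λ i → ≈-trans (*-swap (ι (c i)) s (ι (b i j)))
                                               (*-congˡ (≈-sym (ι-* (c i) (b i j))))) ⟩
    ∑ (λ i → s *ᴿ ι (c i ℤ.* b i j))      ≈⟨ Σᴿ.*-distribˡ-sum s (λ i → ι (c i ℤ.* b i j)) ⟨
    s *ᴿ ∑ (λ i → ι (c i ℤ.* b i j))      ≈⟨ *-congˡ (ι-sum (λ i → c i ℤ.* b i j)) ⟨
    s *ᴿ ι (sumℤ λ i → c i ℤ.* b i j) ∎

  embed-unit : ∀ {n} s d (x : Vector Carrier n) j → ∑ (λ i → x i *ᴿ embed s ([ d ] j) i) ≈ᴿ x j *ᴿ (s *ᴿ ι d)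
  embed-unit s d x zero    = ≈-trans
    (+-congˡ (∑-zero λ i → ≈-trans (*-congˡ (≈-trans (*-congˡ ι-0) (zeroʳ s))) (zeroʳ (x (suc i)))))
    (+-identityʳ _)
  embed-unit s d x (suc j) = ≈-trans
    (+-congʳ (≈-trans (*-congˡ (≈-trans (*-congˡ ι-0) (zeroʳ s))) (zeroʳ (x zero))))
    (≈-trans (+-identityˡ _) (embed-unit s d (x ∘ suc) j))

  -- Forward substitution: the first column has only its pivot, 1 or 3, and the hypothesis on `t`
  -- makes 3 a unit.
  triangular-independent : ∀ {t} → t *ᴿ ι (+ 3) ≈ᴿ 1# → ∀ {n} {B : Vector (Vector ℤ n) n} → Triangular B →
    ∀ (c : Vector Carrier n) → (∀ j → ∑ (λ i → c i *ᴿ ι (B i j)) ≈ᴿ 0#) → ∀ i → c i ≈ᴿ 0#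
  triangular-independent t*3≈1 {zero} _ c eq ()
  triangular-independent {t} t*3≈1 {suc n} {B} (unit , column , rest) c eq = λ
    { zero → c₀≈0
    ; (suc i) → triangular-independent t*3≈1 rest (c ∘ suc) (λ j → begin
        ∑ (λ i → c (suc i) *ᴿ ι (B (suc i) (suc j)))
          ≈⟨ +-identityˡ _ ⟨
        0# +ᴿ ∑ (λ i → c (suc i) *ᴿ ι (B (suc i) (suc j)))
          ≈⟨ +-congʳ (≈-trans (*-congʳ c₀≈0) (zeroˡ (ι (B zero (suc j))))) ⟨
        ∑ (λ i → c i *ᴿ ι (B i (suc j)))
          ≈⟨ eq (suc j) ⟩
        0# ∎) i }
    where
    pivot : c zero *ᴿ ι (B zero zero) ≈ᴿ 0#
    pivot = begin
      c zero *ᴿ ι (B zero zero)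
        ≈⟨ +-identityʳ _ ⟨
      c zero *ᴿ ι (B zero zero) +ᴿ 0#
        ≈⟨ +-congˡ (∑-zero λ i → ≈-trans
             (*-congˡ (≈-trans (reflexive (cong ι (column i))) ι-0)) (zeroʳ (c (suc i)))) ⟨
      ∑ (λ i → c i *ᴿ ι (B i zero))
        ≈⟨ eq zero ⟩
      0# ∎
    solve-pivot : B zero zero ≡ + 1 ⊎ B zero zero ≡ + 3 → c zero ≈ᴿ 0#
    solve-pivot (inj₁ eq₁) = begin
      c zero                    ≈⟨ *-identityʳ (c zero) ⟨
      c zero *ᴿ 1#               ≈⟨ *-congˡ (≈-trans (reflexive (cong ι eq₁)) ι-1) ⟨
      c zero *ᴿ ι (B zero zero)  ≈⟨ pivot ⟩
      0# ∎
    solve-pivot (inj₂ eq₃) = begin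
      c zero                          ≈⟨ *-identityʳ (c zero) ⟨
      c zero *ᴿ 1#                     ≈⟨ *-congˡ (≈-trans (*-congˡ (reflexive (cong ι eq₃))) t*3≈1) ⟨
      c zero *ᴿ (t *ᴿ ι (B zero zero))  ≈⟨ *-swap (c zero) t _ ⟩
      t *ᴿ (c zero *ᴿ ι (B zero zero))  ≈⟨ *-congˡ pivot ⟩
      t *ᴿ 0#                          ≈⟨ zeroʳ t ⟩
      0# ∎
    c₀≈0 : c zero ≈ᴿ 0#
    c₀≈0 = solve-pivot unit

  cancel-unit : ∀ {s t} → t *ᴿ s ≈ᴿ 1# → ∀ x → s *ᴿ x ≈ᴿ 0# → x ≈ᴿ 0#
  cancel-unit {s} {t} ts≈1 x sx≈0 = begin
    x            ≈⟨ *-identityˡ x ⟨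
    1# *ᴿ x       ≈⟨ *-congʳ ts≈1 ⟨
    t *ᴿ s *ᴿ x    ≈⟨ *-assoc t s x ⟩
    t *ᴿ (s *ᴿ x)  ≈⟨ *-congˡ sx≈0 ⟩
    t *ᴿ 0#       ≈⟨ zeroʳ t ⟩
    0# ∎

  embed-independent : ∀ {s s′ t} → s′ *ᴿ s ≈ᴿ 1# → t *ᴿ ι (+ 3) ≈ᴿ 1# →
    ∀ {n} {B : Vector (Vector ℤ n) n} → Triangular B →
    ∀ (c : Vector Carrier n) → (∀ j → ∑ (λ i → c i *ᴿ embed s (B i) j) ≈ᴿ 0#) → ∀ i → c i ≈ᴿ 0#
  embed-independent {s} unit t*3≈1 {B = B} tri c eq = triangular-independent t*3≈1 tri c λ j →
    cancel-unit unit _ (begin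
      s *ᴿ ∑ (λ i → c i *ᴿ ι (B i j))      ≈⟨ Σᴿ.*-distribˡ-sum s (λ i → c i *ᴿ ι (B i j)) ⟩
      ∑ (λ i → s *ᴿ (c i *ᴿ ι (B i j)))    ≈⟨ ∑-cong (λ i → *-swap s (c i) (ι (B i j))) ⟩
      ∑ (λ i → c i *ᴿ embed s (B i) j)    ≈⟨ eq j ⟩
      0# ∎)

-- The real number 1/√3

-- Written in lowest terms directly, since `z ℚ./ 1` normalises through a gcd that is stuck on a
-- variable.
fromℤℚ : ℤ → ℚ
fromℤℚ z = mkℚ z 0 (coprime-sym (1-coprimeTo ℤ.∣ z ∣))

/1 : ∀ z → z ℚ./ 1 ≡ fromℤℚ z
/1 z = ℚ.↥p/↧p≡p (fromℤℚ z)

fromℤℚ-+ : ∀ a b → fromℤℚ (a ℤ.+ b) ≡ fromℤℚ a ℚ.+ fromℤℚ b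
fromℤℚ-+ a b = trans (sym (/1 (a ℤ.+ b)))
  (cong (ℚ._/ 1) (sym (cong₂ ℤ._+_ (ℤ.*-identityʳ a) (ℤ.*-identityʳ b))))

fromℤℚ-* : ∀ a b → fromℤℚ (a ℤ.* b) ≡ fromℤℚ a ℚ.* fromℤℚ b
fromℤℚ-* a b = sym (/1 (a ℤ.* b))

fromℤℚ-mono : ∀ {a b} → a ℤ.≤ b → fromℤℚ a ℚ.≤ fromℤℚ b
fromℤℚ-mono a≤b = *≤* (ℤ.*-monoʳ-≤-nonNeg (+ 1) a≤b)

archimedean : ∀ x → ∃[ N ] x ℚ.≤ fromℤℚ (+ N)
archimedean (mkℚ (+ p) d _)    = p , *≤* (ℤ.*-monoˡ-≤-nonNeg (+ p) (ℤ.+≤+ (s≤s z≤n)))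
archimedean (mkℚ -[1+ p ] d _) = 0 , *≤* ℤ.-≤+

-- Newton's iteration for 1/√3; its defect 1 − 3q² satisfies e′ = e²(3 + e)/4.
newton : ℕ → ℚ
newton zero    = ½
newton (suc n) = ½ ℚ.* (newton n ℚ.* (fromℤℚ (+ 3) ℚ.- fromℤℚ (+ 3) ℚ.* (newton n ℚ.* newton n)))

defect : ℕ → ℚ
defect n = 1ℚ ℚ.- fromℤℚ (+ 3) ℚ.* (newton n ℚ.* newton n)

¼ : ℚ
¼ = ½ ℚ.* ½

defect-step : ∀ n → defect (suc n) ≡ defect n ℚ.* (¼ ℚ.* (defect n ℚ.* (fromℤℚ (+ 3) ℚ.+ defect n)))
defect-step n = solve 1 (λ q →
    con 1ℚ :- con three :* ((con ½ :* (q :* (con three :- con three :* (q :* q)))) :* (con ½ :* (q :* (con three :- con three :* (q :* q)))))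
    := (con 1ℚ :- con three :* (q :* q)) :* (con ¼ :* ((con 1ℚ :- con three :* (q :* q)) :* (con three :+ (con 1ℚ :- con three :* (q :* q))))))
    refl (newton n)
  where
  open +-*-Solver
  three : ℚ
  three = fromℤℚ (+ 3)

newton-step : ∀ n → newton (suc n) ≡ newton n ℚ.+ ½ ℚ.* (newton n ℚ.* defect n)
newton-step n = solve 1 (λ q →
    con ½ :* (q :* (con three :- con three :* (q :* q)))
    := q :+ con ½ :* (q :* (con 1ℚ :- con three :* (q :* q)))) refl (newton n)
  where
  open +-*-Solver
  three : ℚ
  three = fromℤℚ (+ 3)

*-nonNeg : ∀ {p q} → 0ℚ ℚ.≤ p → 0ℚ ℚ.≤ q → 0ℚ ℚ.≤ p ℚ.* q
*-nonNeg {p} {q} 0≤p 0≤q = ℚ.nonNegative⁻¹ _ {{ℚ.nonNeg*nonNeg⇒nonNeg p {{ℚ.nonNegative 0≤p}} q {{ℚ.nonNegative 0≤q}}}}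

*-mono-≤ : ∀ {p q r s} → 0ℚ ℚ.≤ p → 0ℚ ℚ.≤ s → p ℚ.≤ q → r ℚ.≤ s → p ℚ.* r ℚ.≤ q ℚ.* s
*-mono-≤ {p} {q} {r} {s} 0≤p 0≤s p≤q r≤s = ℚ.≤-trans
  (ℚ.*-monoˡ-≤-nonNeg p {{ℚ.nonNegative 0≤p}} r≤s)
  (ℚ.*-monoʳ-≤-nonNeg s {{ℚ.nonNegative 0≤s}} p≤q)

0≤½ : 0ℚ ℚ.≤ ½
0≤½ = ℚ.nonNegative⁻¹ ½

0≤3 : 0ℚ ℚ.≤ fromℤℚ (+ 3)
0≤3 = ℚ.nonNegative⁻¹ (fromℤℚ (+ 3))

defect-contracts : ∀ e → 0ℚ ℚ.≤ e → e ℚ.≤ ½ → ¼ ℚ.* (e ℚ.* (fromℤℚ (+ 3) ℚ.+ e)) ℚ.≤ ½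
defect-contracts e 0≤e e≤½ = ℚ.≤-trans
  (*-mono-≤ {¼} (ℚ.nonNegative⁻¹ ¼) (*-nonNeg 0≤½ (ℚ.nonNegative⁻¹ (fromℤℚ (+ 3) ℚ.+ ½))) ℚ.≤-refl
    (*-mono-≤ {e} 0≤e (ℚ.nonNegative⁻¹ (fromℤℚ (+ 3) ℚ.+ ½)) e≤½ (ℚ.+-monoʳ-≤ (fromℤℚ (+ 3)) e≤½)))
  -- At e = ½ the value is 7/16; cross-multiplied with ½ this is 14 ≤ 16.
  (*≤* (ℤ.+≤+ (ℕ.m≤m+n 14 2)))

record NewtonBounds (n : ℕ) : Set where
  field
    newton≥½ : ½ ℚ.≤ newton n
    defect≥0 : 0ℚ ℚ.≤ defect n
    defect≤½ : defect n ℚ.≤ ½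
    defect≤  : defect n ℚ.* fromℤℚ (+ suc n) ℚ.≤ 1ℚ

-- By `defect-contracts` each step at least halves the defect, and (n + 2)/2 ≤ n + 1 carries the
-- rate `defect≤` along. The iterates increase, because their increments have the sign of the
-- defect.
newton-bounds : ∀ n → NewtonBounds n
newton-bounds zero = record
  { newton≥½ = ℚ.≤-refl
  ; defect≥0 = ℚ.nonNegative⁻¹ (defect 0)
  ; defect≤½ = *≤* (ℤ.+≤+ (ℕ.m≤m+n 2 2))
  ; defect≤  = *≤* (ℤ.+≤+ (ℕ.m≤m+n 1 3)) }
newton-bounds (suc n) = record
  { newton≥½ = subst (½ ℚ.≤_) (sym (newton-step n)) (ℚ.≤-trans
      (ℚ.≤-reflexive (sym (ℚ.+-identityʳ ½)))
      (ℚ.+-mono-≤ newton≥½ (*-nonNeg 0≤½ (*-nonNeg (ℚ.≤-trans 0≤½ newton≥½) defect≥0))))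
  ; defect≥0 = subst (0ℚ ℚ.≤_) (sym (defect-step n)) (*-nonNeg defect≥0 0≤factor)
  ; defect≤½ = ℚ.≤-trans halved (ℚ.≤-trans
      (ℚ.*-monoʳ-≤-nonNeg ½ defect≤½) (*≤* (ℤ.+≤+ (ℕ.m≤m+n 2 2))))
  ; defect≤  = ℚ.≤-trans (ℚ.*-monoʳ-≤-nonNeg (fromℤℚ (+ suc (suc n))) halved) (ℚ.≤-trans
      (ℚ.≤-reflexive (ℚ.*-assoc (defect n) ½ (fromℤℚ (+ suc (suc n)))))
      (ℚ.≤-trans (ℚ.*-monoˡ-≤-nonNeg (defect n) {{ℚ.nonNegative defect≥0}} half-suc) defect≤))
  }
  where
  open NewtonBounds (newton-bounds n)
  0≤factor : 0ℚ ℚ.≤ ¼ ℚ.* (defect n ℚ.* (fromℤℚ (+ 3) ℚ.+ defect n))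
  0≤factor = *-nonNeg (ℚ.nonNegative⁻¹ ¼) (*-nonNeg defect≥0
    (ℚ.≤-trans (ℚ.≤-reflexive (sym (ℚ.+-identityʳ 0ℚ))) (ℚ.+-mono-≤ 0≤3 defect≥0)))
  halved : defect (suc n) ℚ.≤ defect n ℚ.* ½
  halved = subst (ℚ._≤ defect n ℚ.* ½) (sym (defect-step n))
    (ℚ.*-monoˡ-≤-nonNeg (defect n) {{ℚ.nonNegative defect≥0}} (defect-contracts (defect n) defect≥0 defect≤½))
  half-suc : ½ ℚ.* fromℤℚ (+ suc (suc n)) ℚ.≤ fromℤℚ (+ suc n)
  half-suc = ℚ.≤-trans (ℚ.*-monoˡ-≤-nonNeg ½ (fromℤℚ-mono {+ suc (suc n)} {+ suc n ℤ.+ + suc n} (ℤ.+≤+ (s≤s (ℕ.m≤n+m (suc n) n)))))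
    (ℚ.≤-reflexive (trans (cong (½ ℚ.*_) (fromℤℚ-+ (+ suc n) (+ suc n)))
      (solve 1 (λ x → con ½ :* (x :+ x) := x) refl (fromℤℚ (+ suc n)))))
    where open +-*-Solver

module ℝᴿ = CommutativeRing ℝ-commutativeRing

module Newton n = NewtonBounds (newton-bounds n)

defect-small : ∀ ε → 0ℚ ℚ.< ε → ∃[ N ] ∀ n → N ℕ.≤ n → defect n ℚ.< ε
defect-small ε ε>0 = N , λ n N≤n → ℚ.*-cancelʳ-<-nonNeg (fromℤℚ (+ suc n)) (ℚ.≤-<-trans (Newton.defect≤ n)
  (subst (ℚ._< ε ℚ.* fromℤℚ (+ suc n)) (ℚ.*-inverseʳ ε)
    (ℚ.*-monoʳ-<-pos ε (ℚ.≤-<-trans 1/ε≤N (*<* (ℤ.*-monoʳ-<-pos (+ 1) (ℤ.+<+ (s≤s N≤n))))))))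
  where
  instance
    ε-pos : ℚ.Positive ε
    ε-pos = ℚ.positive ε>0
    ε-nonZero : ℚ.NonZero ε
    ε-nonZero = ℚ.pos⇒nonZero ε
  N : ℕ
  N = proj₁ (archimedean (ℚ.1/ ε))
  1/ε≤N : ℚ.1/ ε ℚ.≤ fromℤℚ (+ N)
  1/ε≤N = proj₂ (archimedean (ℚ.1/ ε))

-- For iterates p and q, (p - q) · 3(p + q) is the difference of the defects, and 3(p + q) is at
-- least 1 because both iterates are at least ½.
newton-difference : ∀ m n → ∣ newton m ℚ.- newton n ∣ ℚ.≤ defect m ℚ.+ defect n
newton-difference m n = begin
  ∣ newton m ℚ.- newton n ∣
    ≡⟨ ℚ.*-identityʳ _ ⟨
  ∣ newton m ℚ.- newton n ∣ ℚ.* 1ℚ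
    ≤⟨ ℚ.*-monoˡ-≤-nonNeg ∣ newton m ℚ.- newton n ∣ {{ℚ.nonNegative (ℚ.0≤∣p∣ (newton m ℚ.- newton n))}} 1≤factor ⟩
  ∣ newton m ℚ.- newton n ∣ ℚ.* factor
    ≡⟨ cong (∣ newton m ℚ.- newton n ∣ ℚ.*_) (ℚ.0≤p⇒∣p∣≡p (ℚ.≤-trans (ℚ.nonNegative⁻¹ 1ℚ) 1≤factor)) ⟨
  ∣ newton m ℚ.- newton n ∣ ℚ.* ∣ factor ∣
    ≡⟨ ℚ.∣p*q∣≡∣p∣*∣q∣ (newton m ℚ.- newton n) factor ⟨
  ∣ (newton m ℚ.- newton n) ℚ.* factor ∣
    ≡⟨ cong ∣_∣ (solve 2 (λ p q → (p :- q) :* (con three :* (p :+ q))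
         := (con 1ℚ :- con three :* (q :* q)) :+ (:- (con 1ℚ :- con three :* (p :* p)))) refl (newton m) (newton n)) ⟩
  ∣ defect n ℚ.+ ℚ.- defect m ∣
    ≤⟨ ℚ.∣p+q∣≤∣p∣+∣q∣ (defect n) (ℚ.- defect m) ⟩
  ∣ defect n ∣ ℚ.+ ∣ ℚ.- defect m ∣
    ≡⟨ cong₂ ℚ._+_ (ℚ.0≤p⇒∣p∣≡p (Newton.defect≥0 n))
         (trans (ℚ.∣-p∣≡∣p∣ (defect m)) (ℚ.0≤p⇒∣p∣≡p (Newton.defect≥0 m))) ⟩
  defect n ℚ.+ defect m
    ≡⟨ ℚ.+-comm (defect n) (defect m) ⟩
  defect m ℚ.+ defect n ∎
  where
  open ℚ.≤-Reasoning
  open +-*-Solver using (solve; _:=_; _:+_; _:*_; _:-_; :-_; con)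
  three factor : ℚ
  three  = fromℤℚ (+ 3)
  factor = three ℚ.* (newton m ℚ.+ newton n)
  1≤factor : 1ℚ ℚ.≤ factor
  1≤factor = ℚ.≤-trans (*≤* {1ℚ} {three ℚ.* (½ ℚ.+ ½)} (ℤ.+≤+ (ℕ.m≤m+n 1 2)))
    (ℚ.*-monoˡ-≤-nonNeg three (ℚ.+-mono-≤ (Newton.newton≥½ m) (Newton.newton≥½ n)))

half+half : ∀ ε → ½ ℚ.* ε ℚ.+ ½ ℚ.* ε ≡ ε
half+half ε = trans (sym (ℚ.*-distribʳ-+ ε ½ ½)) (ℚ.*-identityˡ ε)

half>0 : ∀ {ε} → 0ℚ ℚ.< ε → 0ℚ ℚ.< ½ ℚ.* ε
half>0 {ε} ε>0 = ℚ.positive⁻¹ (½ ℚ.* ε) {{ℚ.pos*pos⇒pos ½ ε {{ℚ.positive ε>0}}}}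

1/√3 : ℝ
1/√3 = mkℝ newton λ ε ε>0 → let N , small = defect-small (½ ℚ.* ε) (half>0 ε>0) in
  N , λ m n N≤m N≤n → ℚ.≤-<-trans (newton-difference m n)
    (subst (_ ℚ.<_) (half+half ε) (ℚ.+-mono-< (small m N≤m) (small n N≤n)))

≡⇒∣-∣< : ∀ {p q ε} → 0ℚ ℚ.< ε → p ≡ q → ∣ p ℚ.- q ∣ ℚ.< ε
≡⇒∣-∣< {p} ε>0 refl = subst (λ t → ∣ t ∣ ℚ.< _) (sym (ℚ.+-inverseʳ p)) ε>0

pointwise : ∀ {x y} → (∀ n → seq x n ≡ seq y n) → x ≈ y
pointwise eq ε ε>0 = 0 , λ n _ → ≡⇒∣-∣< ε>0 (eq n)

1/√3-squared : 1/√3 ℝᴿ.* 1/√3 ℝᴿ.* fromℤ (+ 3) ≈ 1ℝ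
1/√3-squared ε ε>0 = let N , small = defect-small ε ε>0 in
  N , λ n N≤n → subst (ℚ._< ε) (sym (∣∣≡ n)) (small n N≤n)
  where
  open +-*-Solver
  ∣∣≡ : ∀ n → ∣ newton n ℚ.* newton n ℚ.* (+ 3 ℚ./ 1) ℚ.- 1ℚ ∣ ≡ defect n
  ∣∣≡ n = trans (cong ∣_∣ (solve 1 (λ q → q :* q :* con (fromℤℚ (+ 3)) :- con 1ℚ
      := :- (con 1ℚ :- con (fromℤℚ (+ 3)) :* (q :* q))) refl (newton n)))
    (trans (ℚ.∣-p∣≡∣p∣ (defect n)) (ℚ.0≤p⇒∣p∣≡p (Newton.defect≥0 n)))

fromℤ-+ : ∀ a b → fromℤ (a ℤ.+ b) ≈ fromℤ a + fromℤ b
fromℤ-+ a b = pointwise {fromℤ (a ℤ.+ b)} {fromℤ a + fromℤ b} λ _ → trans (/1 (a ℤ.+ b)) (trans (fromℤℚ-+ a b) (sym (cong₂ ℚ._+_ (/1 a) (/1 b))))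

fromℤ-* : ∀ a b → fromℤ (a ℤ.* b) ≈ fromℤ a ℝᴿ.* fromℤ b
fromℤ-* a b = pointwise {fromℤ (a ℤ.* b)} {fromℤ a ℝᴿ.* fromℤ b} λ _ → trans (/1 (a ℤ.* b)) (trans (fromℤℚ-* a b) (sym (cong₂ ℚ._*_ (/1 a) (/1 b))))

fromℤ-injective : ∀ a b → fromℤ a ≈ fromℤ b → a ≡ b
fromℤ-injective a b a≈b with a≈b 1ℚ (ℚ.positive⁻¹ 1ℚ)
... | N , close = ℤ.i-j≡0⇒i≡j a b (small (a ℤ.- b) (subst (λ x → ∣ x ∣ ℚ.< 1ℚ) difference (close N ℕ.≤-refl)))
  where
  difference : (a ℚ./ 1) ℚ.- (b ℚ./ 1) ≡ fromℤℚ (a ℤ.- b)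
  difference = trans (cong₂ ℚ._-_ (/1 a) (/1 b)) (trans (cong (fromℤℚ a ℚ.+_) (neg b)) (sym (fromℤℚ-+ a (ℤ.- b))))
    where
    neg : ∀ b → ℚ.- fromℤℚ b ≡ fromℤℚ (ℤ.- b)
    neg (+ zero)  = refl
    neg (+ suc n) = refl
    neg -[1+ n ]  = refl
  small : ∀ z → ∣ fromℤℚ z ∣ ℚ.< 1ℚ → z ≡ 0ℤ
  small (+ zero)  _ = refl
  small (+ suc n) (*<* (ℤ.+<+ (s≤s ())))
  small -[1+ n ]  (*<* (ℤ.+<+ (s≤s ())))

-- Lattices scaled by 1/√3

pythagoras : ∀ {n} (u v w : Vector ℤ n) → (∀ i → u i ≡ v i ℤ.+ w i) → v ∙ w ≡ 0ℤ → u ∙ u ≡ v ∙ v ℤ.+ w ∙ w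
pythagoras {n} u v w u≗ v∙w≡0 = begin
  u ∙ u                        ≡⟨ ∙-cong u≗ u≗ ⟩
  v+w ∙ v+w                    ≡⟨ ∙-+ v w v+w ⟩
  v ∙ v+w ℤ.+ w ∙ v+w          ≡⟨ cong₂ ℤ._+_ (trans (∙-comm v v+w) (∙-+ v w v)) (trans (∙-comm w v+w) (∙-+ v w w)) ⟩
  (v ∙ v ℤ.+ w ∙ v) ℤ.+ (v ∙ w ℤ.+ w ∙ w)
    ≡⟨ cong₂ (λ x y → (v ∙ v ℤ.+ x) ℤ.+ (y ℤ.+ w ∙ w)) (trans (∙-comm w v) v∙w≡0) v∙w≡0 ⟩
  (v ∙ v ℤ.+ 0ℤ) ℤ.+ (0ℤ ℤ.+ w ∙ w)
    ≡⟨ cong₂ ℤ._+_ (ℤ.+-identityʳ (v ∙ v)) (ℤ.+-identityˡ (w ∙ w)) ⟩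
  v ∙ v ℤ.+ w ∙ w ∎
  where
  open ≡-Reasoning
  v+w : Vector ℤ n
  v+w i = v i ℤ.+ w i

record VectorOperations (R : CommutativeRing 0ℓ 0ℓ) (h : IntegerHomomorphism R) : Set where
  private module R = CommutativeRing R
  open IntegerHomomorphism h
  open SemiringSum R.semiring using () renaming (sum to ∑)
  infix 7 _·ᴿ_
  field
    _·ᴿ_         : ∀ {n} → Vector R.Carrier n → Vector R.Carrier n → R.Carrier
    combinationᴿ : ∀ {k n} → Vector R.Carrier k → Vector (Vector R.Carrier n) k → Vector R.Carrier n
    combinationᶻ : ∀ {k n} → Vector ℤ k → Vector (Vector R.Carrier n) k → Vector R.Carrier n
    ·-∑            : ∀ {n} (v w : Vector R.Carrier n) → v ·ᴿ w R.≈ ∑ (λ i → v i R.* w i)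
    combinationᴿ-∑  : ∀ {k n} c (b : Vector (Vector R.Carrier n) k) j →
                     combinationᴿ c b j R.≈ ∑ (λ i → c i R.* b i j)
    combinationᶻ-∑ : ∀ {k n} c (b : Vector (Vector R.Carrier n) k) j →
                     combinationᶻ c b j R.≈ ∑ (λ i → ι (c i) R.* b i j)

record IsInverseRootThree (R : CommutativeRing 0ℓ 0ℓ) (h : IntegerHomomorphism R)
  (r : CommutativeRing.Carrier R) : Set where
  private module R = CommutativeRing R
  open IntegerHomomorphism h
  field
    r²*3≈1      : r R.* r R.* ι (+ 3) R.≈ R.1#
    ι-injective : ∀ a b → ι a R.≈ ι b → a ≡ b

-- The vector operations are a parameter, to be instantiated at the Cauchy reals by the very terms of
-- Defs: ℝ has eta, so conversion checking between two forms of a sum would unfold the Cauchy moduli.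
module ScaledLattice (R : CommutativeRing 0ℓ 0ℓ) (h : IntegerHomomorphism R) (ops : VectorOperations R h)
  (r : CommutativeRing.Carrier R) (root : IsInverseRootThree R h r)
  {n : ℕ} (A : Vector ℤ n → Set) (ternary : MinimalTernary A) where

  open CommutativeRing R
    using (Carrier; 0#; 1#; reflexive; setoid; *-cong; +-cong; +-identityˡ; +-identityʳ;
           *-assoc; *-comm; *-congˡ; *-congʳ; *-identityˡ; *-identityʳ; zeroˡ; zeroʳ; distribˡ)
    renaming (_≈_ to _≈ᴿ_; _+_ to _+ᴿ_; _*_ to _*ᴿ_; refl to ≈-refl; sym to ≈-sym; trans to ≈-trans)
  open IntegerHomomorphism h
  open IsInverseRootThree root
  open VectorOperations ops
  open Embedding R h
  open Σᴿ using () renaming (sum to ∑; sum-cong-≋ to ∑-cong)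
  open MinimalTernary ternary
  open IsSubgroup subgroup
  open TriangularBasis triangular-basis
  open SetoidReasoning setoid

  infix 4 _≋ᴿ_

  _≋ᴿ_ : Vector Carrier n → Vector Carrier n → Set
  v ≋ᴿ w = ∀ i → v i ≈ᴿ w i

  0ᴿ : Vector Carrier n
  0ᴿ _ = 0#

  -- The scale is a parameter: `r` gives the lattice itself, `1#` its multiple by √3 inside ℤⁿ.
  Lat : Carrier → Vector Carrier n → Set
  Lat s v = ∃[ u ] (A u × v ≋ᴿ embed s u)

  √3 : Carrier
  √3 = ι (+ 3) *ᴿ r

  √3*r≈1 : √3 *ᴿ r ≈ᴿ 1#
  √3*r≈1 = ≈-trans (*-assoc (ι (+ 3)) r r) (≈-trans (*-comm (ι (+ 3)) (r *ᴿ r)) r²*3≈1)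

  √3*√3≈3 : √3 *ᴿ √3 ≈ᴿ ι (+ 3)
  √3*√3≈3 = begin
    √3 *ᴿ (ι (+ 3) *ᴿ r)  ≈⟨ *-swap √3 (ι (+ 3)) r ⟩
    ι (+ 3) *ᴿ (√3 *ᴿ r)  ≈⟨ *-congˡ √3*r≈1 ⟩
    ι (+ 3) *ᴿ 1#         ≈⟨ *-identityʳ (ι (+ 3)) ⟩
    ι (+ 3) ∎

  √3*r* : ∀ x → √3 *ᴿ (r *ᴿ x) ≈ᴿ x
  √3*r* x = ≈-trans (≈-sym (*-assoc √3 r x)) (≈-trans (*-congʳ √3*r≈1) (*-identityˡ x))

  embed-cong : ∀ {s} {u v : Vector ℤ n} → u ≗ v → embed s u ≋ᴿ embed s v
  embed-cong u≗v i = *-congˡ (reflexive (cong ι (u≗v i)))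

  embed-injective : ∀ u v → embed r u ≋ᴿ embed r v → u ≗ v
  embed-injective u v eq i = ι-injective (u i) (v i)
    (≈-trans (≈-sym (√3*r* (ι (u i)))) (≈-trans (*-congˡ (eq i)) (√3*r* (ι (v i)))))

  embed-zero : ∀ {u : Vector ℤ n} → (∀ i → u i ≡ 0ℤ) → embed r u ≋ᴿ 0ᴿ
  embed-zero u≡0 i = ≈-trans (*-congˡ (≈-trans (reflexive (cong ι (u≡0 i))) ι-0)) (zeroʳ r)

  embed-+ : ∀ (u v : Vector ℤ n) i → embed r (λ i → u i ℤ.+ v i) i ≈ᴿ embed r u i +ᴿ embed r v i
  embed-+ u v i = ≈-trans (*-congˡ (ι-+ (u i) (v i))) (distribˡ r (ι (u i)) (ι (v i)))

  ·-cong : ∀ {v v′ w w′ : Vector Carrier n} → v ≋ᴿ v′ → w ≋ᴿ w′ → v ·ᴿ w ≈ᴿ v′ ·ᴿ w′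
  ·-cong {v} {v′} {w} {w′} v≋ w≋ =
    ≈-trans (·-∑ v w) (≈-trans (∑-cong λ i → *-cong (v≋ i) (w≋ i)) (≈-sym (·-∑ v′ w′)))

  ·-comm : ∀ (v w : Vector Carrier n) → v ·ᴿ w ≈ᴿ w ·ᴿ v
  ·-comm v w = ≈-trans (·-∑ v w) (≈-trans (∑-cong λ i → *-comm (v i) (w i)) (≈-sym (·-∑ w v)))

  embed-· : ∀ (u v : Vector ℤ n) → embed r u ·ᴿ embed r v ≈ᴿ r *ᴿ r *ᴿ ι (u ∙ v)
  embed-· u v = ≈-trans (·-∑ (embed r u) (embed r v)) (embed-dot r r u v)

  lattice-dot : ∀ {v w u u′} → v ≋ᴿ embed r u → w ≋ᴿ embed r u′ → ∀ k → u ∙ u′ ≡ + 3 ℤ.* k → v ·ᴿ w ≈ᴿ ι k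
  lattice-dot {v} {w} {u} {u′} v≋ w≋ k eq = begin
    v ·ᴿ w                            ≈⟨ ·-cong v≋ w≋ ⟩
    embed r u ·ᴿ embed r u′           ≈⟨ embed-· u u′ ⟩
    r *ᴿ r *ᴿ ι (u ∙ u′)              ≈⟨ *-congˡ (≈-trans (reflexive (cong ι eq)) (ι-* (+ 3) k)) ⟩
    r *ᴿ r *ᴿ (ι (+ 3) *ᴿ ι k)        ≈⟨ *-assoc (r *ᴿ r) (ι (+ 3)) (ι k) ⟨
    r *ᴿ r *ᴿ ι (+ 3) *ᴿ ι k          ≈⟨ *-congʳ r²*3≈1 ⟩
    1# *ᴿ ι k                         ≈⟨ *-identityˡ (ι k) ⟩
    ι k ∎

  integer-dot : ∀ {v w u u′} → v ≋ᴿ embed r u → w ≋ᴿ embed r u′ → ∀ k → v ·ᴿ w ≈ᴿ ι k → u ∙ u′ ≡ + 3 ℤ.* k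
  integer-dot {v} {w} {u} {u′} v≋ w≋ k eq = ι-injective _ _ (begin
    ι (u ∙ u′)                           ≈⟨ *-identityˡ _ ⟨
    1# *ᴿ ι (u ∙ u′)                     ≈⟨ *-congʳ (≈-trans (*-comm (ι (+ 3)) (r *ᴿ r)) r²*3≈1) ⟨
    ι (+ 3) *ᴿ (r *ᴿ r) *ᴿ ι (u ∙ u′)    ≈⟨ *-assoc (ι (+ 3)) (r *ᴿ r) _ ⟩
    ι (+ 3) *ᴿ (r *ᴿ r *ᴿ ι (u ∙ u′))    ≈⟨ *-congˡ (embed-· u u′) ⟨
    ι (+ 3) *ᴿ (embed r u ·ᴿ embed r u′) ≈⟨ *-congˡ (·-cong v≋ w≋) ⟨
    ι (+ 3) *ᴿ (v ·ᴿ w)                  ≈⟨ *-congˡ eq ⟩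
    ι (+ 3) *ᴿ ι k                       ≈⟨ ι-* (+ 3) k ⟨
    ι (+ 3 ℤ.* k) ∎)

  scaledBasis : Carrier → Vector (Vector Carrier n) n
  scaledBasis s i = embed s (basis i)

  basis-independent : ∀ s s′ → s′ *ᴿ s ≈ᴿ 1# → ∀ c → combinationᴿ c (scaledBasis s) ≋ᴿ 0ᴿ → ∀ i → c i ≈ᴿ 0#
  basis-independent s s′ unit c eq = embed-independent unit r²*3≈1 triangular c λ j →
    ≈-trans (≈-sym (combinationᴿ-∑ c (scaledBasis s) j)) (eq j)

  lattice⇒span : ∀ s v → Lat s v → ∃[ c ] v ≋ᴿ combinationᶻ c (scaledBasis s)
  lattice⇒span s v (u , Au , v≋) = let c , u≡ = spans u Au in c , λ j →
    ≈-trans (v≋ j) (≈-trans (embed-cong {s} u≡ j) (≈-sym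
      (≈-trans (combinationᶻ-∑ c (scaledBasis s) j) (embed-combination s c basis j))))

  span⇒lattice : ∀ s v → ∃[ c ] v ≋ᴿ combinationᶻ c (scaledBasis s) → Lat s v
  span⇒lattice s v (c , v≋) = _ , sum∈ c basis member , λ j →
    ≈-trans (v≋ j) (≈-trans (combinationᶻ-∑ c (scaledBasis s) j) (embed-combination s c basis j))

  combination∈ : ∀ {k} v (c : Vector ℤ k) (w : Vector (Vector Carrier n) k) → (∀ i → Lat r (w i)) →
                 v ≋ᴿ combinationᶻ c w → Lat r v
  combination∈ v c w w∈ v≋ = _ , sum∈ c (λ i → proj₁ (w∈ i)) (λ i → proj₁ (proj₂ (w∈ i))) , λ j →
    ≈-trans (v≋ j) (≈-trans (combinationᶻ-∑ c w j) (≈-trans (∑-cong λ i → *-congˡ (proj₂ (proj₂ (w∈ i)) j))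
      (embed-combination r c (λ i → proj₁ (w∈ i)) j)))

  lattice⊆dual : ∀ v → Lat r v → ∀ w → Lat r w → ∃[ z ] v ·ᴿ w ≈ᴿ ι z
  lattice⊆dual v (u , Au , v≋) w (u′ , Au′ , w≋) =
    let k , eq = orthogonal u u′ Au Au′ in k , lattice-dot v≋ w≋ k eq

  -- The vectors √3 eⱼ belong to the lattice, and the integers obtained by pairing `v` with them are
  -- the coordinates of √3 `v`. This integer vector lies in `A` by `dual`.
  dual⊆lattice : ∀ v → (∀ w → Lat r w → ∃[ z ] v ·ᴿ w ≈ᴿ ι z) → Lat r v
  dual⊆lattice v integral = u , dual u (λ u′ Au′ →
      let k , eq = integral (embed r u′) (u′ , Au′ , λ _ → ≈-refl) in k , integer-dot v≋ (λ _ → ≈-refl) k eq)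
    , v≋
    where
    u : Vector ℤ n
    u j = proj₁ (integral (embed r ([ + 3 ] j)) (_ , proj₁ (3-unit j) , λ _ → ≈-refl))
    v≋ : v ≋ᴿ embed r u
    v≋ j = begin
      v j                              ≈⟨ *-identityˡ (v j) ⟨
      1# *ᴿ v j                        ≈⟨ *-congʳ (≈-trans (≈-sym (*-assoc r r (ι (+ 3)))) r²*3≈1) ⟨
      r *ᴿ (r *ᴿ ι (+ 3)) *ᴿ v j       ≈⟨ *-assoc r (r *ᴿ ι (+ 3)) (v j) ⟩
      r *ᴿ (r *ᴿ ι (+ 3) *ᴿ v j)       ≈⟨ *-congˡ (*-comm (r *ᴿ ι (+ 3)) (v j)) ⟩
      r *ᴿ (v j *ᴿ (r *ᴿ ι (+ 3)))     ≈⟨ *-congˡ (≈-trans (·-∑ v (embed r ([ + 3 ] j))) (embed-unit r (+ 3) v j)) ⟨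
      r *ᴿ (v ·ᴿ embed r ([ + 3 ] j))  ≈⟨ *-congˡ (proj₂ (integral (embed r ([ + 3 ] j)) (_ , proj₁ (3-unit j) , λ _ → ≈-refl))) ⟩
      r *ᴿ ι (u j) ∎

  short-norm : ∀ {v u} → Short u → v ≋ᴿ embed r u → v ·ᴿ v ≈ᴿ ι (+ 3)
  short-norm (Au , norm≡9) v≋ = lattice-dot v≋ v≋ (+ 3) norm≡9

  norm≢0 : ∀ {v} k → v ·ᴿ v ≈ᴿ ι k → k ≢ 0ℤ → ¬ v ≋ᴿ 0ᴿ
  norm≢0 {v} k norm≈ k≢0 v≋0 = k≢0 (ι-injective k 0ℤ (begin
    ι k      ≈⟨ norm≈ ⟨
    v ·ᴿ v   ≈⟨ ≈-trans (·-∑ v v) (∑-zero (λ i → ≈-trans (*-congʳ (v≋0 i)) (zeroˡ (v i)))) ⟩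
    0#       ≈⟨ ι-0 ⟨
    ι 0ℤ ∎))

  minimum : ∀ w → Lat r w → ¬ w ≋ᴿ 0ᴿ → ∃[ k ] + 3 ℤ.≤ k × w ·ᴿ w ≈ᴿ ι k
  minimum w (u , Au , w≋) w≢0 = k , bound (minimal u Au) , lattice-dot w≋ w≋ k u∙u≡
    where
    k : ℤ
    k = proj₁ (orthogonal u u Au Au)
    u∙u≡ : u ∙ u ≡ + 3 ℤ.* k
    u∙u≡ = proj₂ (orthogonal u u Au Au)
    bound : (∀ i → u i ≡ 0ℤ) ⊎ + 9 ℤ.≤ u ∙ u → + 3 ℤ.≤ k
    bound (inj₁ u≡0) = ⊥-elim (w≢0 λ i → ≈-trans (w≋ i) (embed-zero u≡0 i))
    bound (inj₂ 9≤)  = ℤ.*-cancelˡ-≤-pos (+ 3) k (+ 3) (subst (+ 9 ℤ.≤_) u∙u≡ 9≤)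

  GeneratedBy : (Vector Carrier n → Set) → Vector Carrier n → Set
  GeneratedBy S v = ∃[ k ] Σ[ s ∈ Vector (Vector Carrier n) k ] ((∀ i → S (s i)) ×
    ∃[ c ] v ≋ᴿ combinationᶻ c s)

  -- Makes the principle `generated` applicable; sums concatenate the lists of generators.
  generatedBy-subgroup : ∀ S → IsSubgroup (GeneratedBy S ∘ embed r)
  generatedBy-subgroup S = record
    { resp  = λ { u≗v (k , s , s∈ , c , eq) → k , s , s∈ , c , λ j → ≈-trans (embed-cong {r} (sym ∘ u≗v) j) (eq j) }
    ; zero∈ = 0 , (λ ()) , (λ ()) , (λ ()) , λ j →
        ≈-trans (embed-zero (λ _ → refl) j) (≈-sym (combinationᶻ-∑ (λ ()) (λ ()) j))
    ; +∈    = λ { {u} {v} (k , s , s∈ , c , eq) (l , t , t∈ , d , eq′) →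
        k ℕ.+ l , s Vector.++ t , ++∈ s t s∈ t∈ , c Vector.++ d , λ j → begin
          embed r (λ i → u i ℤ.+ v i) j
            ≈⟨ embed-+ u v j ⟩
          embed r u j +ᴿ embed r v j
            ≈⟨ +-cong (≈-trans (eq j) (combinationᶻ-∑ c s j)) (≈-trans (eq′ j) (combinationᶻ-∑ d t j)) ⟩
          ∑ (λ i → ι (c i) *ᴿ s i j) +ᴿ ∑ (λ i → ι (d i) *ᴿ t i j)
            ≈⟨ +-cong
                 (∑-cong λ i → reflexive (cong₂ (λ z w → ι z *ᴿ w j) (lookup-++ˡ c d i) (lookup-++ˡ s t i)))
                 (∑-cong λ i → reflexive (cong₂ (λ z w → ι z *ᴿ w j) (lookup-++ʳ c d i) (lookup-++ʳ s t i))) ⟨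
          ∑ (λ i → ι ((c Vector.++ d) (i ↑ˡ l)) *ᴿ (s Vector.++ t) (i ↑ˡ l) j) +ᴿ ∑ (λ i → ι ((c Vector.++ d) (k ↑ʳ i)) *ᴿ (s Vector.++ t) (k ↑ʳ i) j)
            ≈⟨ ∑-↑ k (λ i → ι ((c Vector.++ d) i) *ᴿ (s Vector.++ t) i j) ⟨
          ∑ (λ i → ι ((c Vector.++ d) i) *ᴿ (s Vector.++ t) i j)
            ≈⟨ combinationᶻ-∑ (c Vector.++ d) (s Vector.++ t) j ⟨
          combinationᶻ (c Vector.++ d) (s Vector.++ t) j ∎ }
    ; *∈    = λ { z {u} (k , s , s∈ , c , eq) → k , s , s∈ , (λ i → z ℤ.* c i) , λ j → begin
        r *ᴿ ι (z ℤ.* u j)                          ≈⟨ *-congˡ (ι-* z (u j)) ⟩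
        r *ᴿ (ι z *ᴿ ι (u j))                       ≈⟨ *-swap r (ι z) (ι (u j)) ⟩
        ι z *ᴿ embed r u j                          ≈⟨ *-congˡ (≈-trans (eq j) (combinationᶻ-∑ c s j)) ⟩
        ι z *ᴿ ∑ (λ i → ι (c i) *ᴿ s i j)           ≈⟨ Σᴿ.*-distribˡ-sum (ι z) (λ i → ι (c i) *ᴿ s i j) ⟩
        ∑ (λ i → ι z *ᴿ (ι (c i) *ᴿ s i j))         ≈⟨ ∑-cong (λ i → ≈-trans (≈-sym (*-assoc (ι z) (ι (c i)) (s i j)))
                                                          (*-congʳ (≈-sym (ι-* z (c i))))) ⟩
        ∑ (λ i → ι (z ℤ.* c i) *ᴿ s i j)            ≈⟨ combinationᶻ-∑ (λ i → z ℤ.* c i) s j ⟨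
        combinationᶻ (λ i → z ℤ.* c i) s j ∎ }
    }
    where
    ++∈ : ∀ {k l} (s : Vector (Vector Carrier n) k) (t : Vector (Vector Carrier n) l) →
          (∀ i → S (s i)) → (∀ i → S (t i)) → ∀ i → S ((s Vector.++ t) i)
    ++∈ {k} s t s∈ t∈ i with splitAt k i
    ... | inj₁ j = s∈ j
    ... | inj₂ j = t∈ j

  generatedBy-short : ∀ S → (∀ u v → Short u → v ≋ᴿ embed r u → S v) → ∀ v → Lat r v → GeneratedBy S v
  generatedBy-short S short v (u , Au , v≋) =
    let k , s , s∈ , c , eq = generated (generatedBy-subgroup S) single u Au
    in k , s , s∈ , c , λ j → ≈-trans (v≋ j) (eq j)
    where
    single : ∀ {u} → Short u → GeneratedBy S (embed r u)
    single {u} Su = 1 , (λ _ → embed r u) , (λ _ → short u (embed r u) Su (λ _ → ≈-refl)) , (λ _ → + 1) , λ j → begin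
      embed r u j                   ≈⟨ *-identityˡ _ ⟨
      1# *ᴿ embed r u j             ≈⟨ *-congʳ ι-1 ⟨
      ι (+ 1) *ᴿ embed r u j        ≈⟨ +-identityʳ _ ⟨
      ι (+ 1) *ᴿ embed r u j +ᴿ 0#  ≈⟨ combinationᶻ-∑ (λ (_ : Fin 1) → + 1) (λ _ → embed r u) j ⟨
      combinationᶻ (λ (_ : Fin 1) → + 1) (λ _ → embed r u) j ∎

  -- Existential, because `M` is an arbitrary predicate that may fail to respect `_≋ᴿ_`.
  Contains : (Vector Carrier n → Set) → Vector ℤ n → Set
  Contains M u = ∃[ v ] (M v × v ≋ᴿ embed r u)

  Splits : (M₁ M₂ : Vector Carrier n → Set) → Set
  Splits M₁ M₂ = ∀ v → Lat r v → ∃[ v₁ ] ∃[ v₂ ] (M₁ v₁ × M₂ v₂ × (∀ i → v i ≈ᴿ v₁ i +ᴿ v₂ i))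

  contains-orthogonal : ∀ {M₁ M₂ : Vector Carrier n → Set} → (∀ v w → M₁ v → M₂ w → v ·ᴿ w ≈ᴿ 0#) →
                        ∀ {u u′} → Contains M₁ u → Contains M₂ u′ → u ∙ u′ ≡ 0ℤ
  contains-orthogonal ortho (v , v∈ , v≋) (w , w∈ , w≋) =
    integer-dot v≋ w≋ 0ℤ (≈-trans (ortho v w v∈ w∈) (≈-sym ι-0))

  -- The norm 9 of a short vector is the sum of the norms of its two components, each 0 or at least 9.
  short-splits : ∀ {M₁ M₂ : Vector Carrier n → Set} → (∀ v → M₁ v → Lat r v) → (∀ v → M₂ v → Lat r v) →
    (∀ v w → M₁ v → M₂ w → v ·ᴿ w ≈ᴿ 0#) → Splits M₁ M₂ →
    ∀ {u} → Short u → Contains M₁ u ⊎ Contains M₂ u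
  short-splits M₁⊆ M₂⊆ ortho split {u} (Au , norm≡9) = helper (split (embed r u) (u , Au , λ _ → ≈-refl))
    where
    helper : _ → _
    helper (v₁ , v₂ , v₁∈ , v₂∈ , v≋) = cases (minimal u₁ (proj₁ (proj₂ (M₁⊆ v₁ v₁∈)))) (minimal u₂ (proj₁ (proj₂ (M₂⊆ v₂ v₂∈))))
      where
      u₁ u₂ : Vector ℤ n
      u₁ = proj₁ (M₁⊆ v₁ v₁∈)
      u₂ = proj₁ (M₂⊆ v₂ v₂∈)
      v₁≋ : v₁ ≋ᴿ embed r u₁
      v₁≋ = proj₂ (proj₂ (M₁⊆ v₁ v₁∈))
      v₂≋ : v₂ ≋ᴿ embed r u₂
      v₂≋ = proj₂ (proj₂ (M₂⊆ v₂ v₂∈))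
      u≗ : ∀ i → u i ≡ u₁ i ℤ.+ u₂ i
      u≗ = embed-injective u _ λ i → ≈-trans (v≋ i) (≈-trans (+-cong (v₁≋ i) (v₂≋ i)) (≈-sym (embed-+ u₁ u₂ i)))
      u₁∙u₂≡0 : u₁ ∙ u₂ ≡ 0ℤ
      u₁∙u₂≡0 = contains-orthogonal ortho (v₁ , v₁∈ , v₁≋) (v₂ , v₂∈ , v₂≋)
      norms : u ∙ u ≡ u₁ ∙ u₁ ℤ.+ u₂ ∙ u₂
      norms = pythagoras u u₁ u₂ u≗ u₁∙u₂≡0
      cases : (∀ i → u₁ i ≡ 0ℤ) ⊎ + 9 ℤ.≤ u₁ ∙ u₁ → (∀ i → u₂ i ≡ 0ℤ) ⊎ + 9 ℤ.≤ u₂ ∙ u₂ → _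
      cases (inj₁ u₁≡0) _ = inj₂ (v₂ , v₂∈ , λ i → ≈-trans (v₂≋ i) (embed-cong {r} {u₂} {u} (λ i →
        sym (trans (u≗ i) (trans (cong (λ z → z ℤ.+ u₂ i) (u₁≡0 i)) (ℤ.+-identityˡ (u₂ i))))) i))
      cases _ (inj₁ u₂≡0) = inj₁ (v₁ , v₁∈ , λ i → ≈-trans (v₁≋ i) (embed-cong {r} {u₁} {u} (λ i →
        sym (trans (u≗ i) (trans (cong (λ z → u₁ i ℤ.+ z) (u₂≡0 i)) (ℤ.+-identityʳ (u₁ i))))) i))
      cases (inj₂ 9≤₁) (inj₂ 9≤₂) = contradiction
        (subst (+ 18 ℤ.≤_) (trans (sym norms) norm≡9) (ℤ.+-mono-≤ 9≤₁ 9≤₂))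
        λ { (ℤ.+≤+ (s≤s (s≤s (s≤s (s≤s (s≤s (s≤s (s≤s (s≤s (s≤s ())))))))))) }

  -- Short vectors that are not orthogonal lie on the same side, so connectivity brings every √3 eⱼ
  -- into `M₁`. A member of `M₂` is orthogonal to all of them and hence vanishes.
  one-sided : ∀ {M₁ M₂ : Vector Carrier n → Set} → (∀ v → M₁ v → Lat r v) → (∀ v → M₂ v → Lat r v) →
    (∀ v w → M₁ v → M₂ w → v ·ᴿ w ≈ᴿ 0#) → Splits M₁ M₂ → ∀ i₀ → Contains M₁ ([ + 3 ] i₀) →
    ∀ w → M₂ w → w ≋ᴿ 0ᴿ
  one-sided {M₁} {M₂} M₁⊆ M₂⊆ ortho split i₀ start w w∈ i =
    ≈-trans (w≋ i) (embed-zero {u} (λ j → ℤ.*-cancelˡ-≡ (+ 3) (u j) 0ℤ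
      (trans (sym ([]-∙ (+ 3) j u)) (contains-orthogonal ortho (all j) (w , w∈ , w≋)))) i)
    where
    u : Vector ℤ n
    u = proj₁ (M₂⊆ w w∈)
    w≋ : w ≋ᴿ embed r u
    w≋ = proj₂ (proj₂ (M₂⊆ w w∈))
    spread : ∀ {u v} → Short u → Short v → u ∙ v ≢ 0ℤ → Contains M₁ u → Contains M₁ v
    spread Su Sv u∙v≢0 u∈ = [ id , (λ v∈ → contradiction (contains-orthogonal ortho u∈ v∈) u∙v≢0) ]′
      (short-splits M₁⊆ M₂⊆ ortho split Sv)
    all : ∀ j → Contains M₁ ([ + 3 ] j)
    all j = connected spread i₀ j start

  -- The side that receives √3 times the basis vector at `i₀` forces the other one to be zero.
  indecomposable : Fin n → ∀ {M₁ M₂ : Vector Carrier n → Set} →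
    (∀ v → M₁ v → Lat r v) → (∀ v → M₂ v → Lat r v) →
    (∀ v w → M₁ v → M₂ w → v ·ᴿ w ≈ᴿ 0#) → Splits M₁ M₂ →
    ∃[ v ] (M₁ v × ¬ v ≋ᴿ 0ᴿ) → ∃[ w ] (M₂ w × ¬ w ≋ᴿ 0ᴿ) → ⊥
  indecomposable i₀ M₁⊆ M₂⊆ ortho split (v , v∈ , v≢0) (w , w∈ , w≢0) =
    [ (λ start → w≢0 (one-sided M₁⊆ M₂⊆ ortho split i₀ start w w∈))
    , (λ start → v≢0 (one-sided M₂⊆ M₁⊆
        (λ v w v∈ w∈ → ≈-trans (·-comm v w) (ortho w v w∈ v∈))
        (λ v v∈ → let v₁ , v₂ , v₁∈ , v₂∈ , eq = split v v∈
                  in v₂ , v₁ , v₂∈ , v₁∈ , λ i → ≈-trans (eq i) (+-comm′ (v₁ i) (v₂ i)))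
        i₀ start v v∈))
    ]′ (short-splits M₁⊆ M₂⊆ ortho split (3-unit i₀))
    where open CommutativeRing R using () renaming (+-comm to +-comm′)

  scaled⇒integral : ∀ v → ∃[ w ] (Lat r w × (∀ i → v i ≈ᴿ √3 *ᴿ w i)) → Lat 1# v
  scaled⇒integral v (w , (u , Au , w≋) , v≋) = u , Au , λ i →
    ≈-trans (v≋ i) (≈-trans (*-congˡ (w≋ i)) (≈-trans (√3*r* (ι (u i))) (≈-sym (*-identityˡ (ι (u i))))))

  integral⇒scaled : ∀ v → Lat 1# v → ∃[ w ] (Lat r w × (∀ i → v i ≈ᴿ √3 *ᴿ w i))
  integral⇒scaled v (u , Au , v≋) = embed r u , (u , Au , λ _ → ≈-refl) , λ i →
    ≈-trans (v≋ i) (≈-trans (*-identityˡ (ι (u i))) (≈-sym (√3*r* (ι (u i)))))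

  integral-coordinates : ∀ v → Lat 1# v → ∀ i → ∃[ z ] v i ≈ᴿ ι z
  integral-coordinates v (u , _ , v≋) i = u i , ≈-trans (v≋ i) (*-identityˡ (ι (u i)))

-- The lattice over the Cauchy reals

≤-fromℤ : ∀ x y a b → x ≈ fromℤ a → y ≈ fromℤ b → a ℤ.≤ b → x ≤ y
≤-fromℤ x y a b x≈ y≈ a≤b ε ε>0 =
  let M , p = x≈ (½ ℚ.* ε) (half>0 ε>0)
      N , q = y≈ (½ ℚ.* ε) (half>0 ε>0)
  in M ℕ.⊔ N , λ n ≤n → ordered n (p n (ℕ.≤-trans (ℕ.m≤m⊔n M N) ≤n)) (q n (ℕ.≤-trans (ℕ.m≤n⊔m M N) ≤n))
  where
  open ℚ.≤-Reasoning
  p≤∣p∣ : ∀ p → p ℚ.≤ ∣ p ∣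
  p≤∣p∣ p with ℚ.≤-total 0ℚ p
  ... | inj₁ 0≤p = ℚ.≤-reflexive (sym (ℚ.0≤p⇒∣p∣≡p 0≤p))
  ... | inj₂ p≤0 = ℚ.≤-trans p≤0 (ℚ.0≤∣p∣ p)
  upper : ∀ p q {δ} → ∣ p ℚ.- q ∣ ℚ.< δ → p ℚ.< q ℚ.+ δ
  upper p q {δ} close = begin-strict
    p                     ≡⟨ solve 2 (λ p q → p := q :+ (p :- q)) refl p q ⟩
    q ℚ.+ (p ℚ.- q)       ≤⟨ ℚ.+-monoʳ-≤ q (p≤∣p∣ (p ℚ.- q)) ⟩
    q ℚ.+ ∣ p ℚ.- q ∣     <⟨ ℚ.+-monoʳ-< q close ⟩
    q ℚ.+ δ ∎
    where open +-*-Solver using (solve; _:=_; _:+_; _:-_)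
  flip-∣-∣ : ∀ p q → ∣ p ℚ.- q ∣ ≡ ∣ q ℚ.- p ∣
  flip-∣-∣ p q = trans (sym (ℚ.∣-p∣≡∣p∣ (p ℚ.- q)))
    (cong ∣_∣ (solve 2 (λ p q → :- (p :- q) := q :- p) refl p q))
    where open +-*-Solver
  ordered : ∀ n → ∣ seq x n ℚ.- (a ℚ./ 1) ∣ ℚ.< ½ ℚ.* ε → ∣ seq y n ℚ.- (b ℚ./ 1) ∣ ℚ.< ½ ℚ.* ε →
            seq x n ℚ.< seq y n ℚ.+ ε
  ordered n p q = begin-strict
    seq x n
      <⟨ upper (seq x n) (a ℚ./ 1) p ⟩
    (a ℚ./ 1) ℚ.+ ½ ℚ.* ε
      ≤⟨ ℚ.+-monoˡ-≤ (½ ℚ.* ε) (subst₂ ℚ._≤_ (sym (/1 a)) (sym (/1 b)) (fromℤℚ-mono a≤b)) ⟩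
    (b ℚ./ 1) ℚ.+ ½ ℚ.* ε
      <⟨ ℚ.+-monoˡ-< (½ ℚ.* ε) (upper (b ℚ./ 1) (seq y n) (subst (ℚ._< ½ ℚ.* ε) (flip-∣-∣ (seq y n) (b ℚ./ 1)) q)) ⟩
    (seq y n ℚ.+ ½ ℚ.* ε) ℚ.+ ½ ℚ.* ε
      ≡⟨ trans (ℚ.+-assoc (seq y n) (½ ℚ.* ε) (½ ℚ.* ε)) (cong (seq y n ℚ.+_) (half+half ε)) ⟩
    seq y n ℚ.+ ε ∎

ℤ→ℝ : IntegerHomomorphism ℝ-commutativeRing
ℤ→ℝ = record
  { ι   = fromℤ
  ; ι-+ = fromℤ-+
  ; ι-* = fromℤ-*
  ; ι-0 = pointwise {fromℤ (+ 0)} {0ℝ} λ _ → refl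
  ; ι-1 = pointwise {fromℤ (+ 1)} {1ℝ} λ _ → refl }

module Σℝ = SemiringSum ℝᴿ.semiring

combinationᶻ-≈ : ∀ {k n} c (b : Vector (ℝ^ n) k) j →
  ℤ-combination c b j ≈ Σℝ.sum (λ i → IntegerHomomorphism.ι ℤ→ℝ (c i) ℝᴿ.* b i j)
combinationᶻ-≈ c b j = ℝᴿ.trans {ℤ-combination c b j} {Σℝ.sum f} {Σℝ.sum g} (ℝᴿ.refl {Σℝ.sum f})
  (Σℝ.sum-cong-≋ {x = f} {y = g} λ i → pointwise {f i} {g i} λ _ → refl)
  where
  f g : Vector ℝ _
  f i = Vector.map fromℤ c i ℝᴿ.* b i j
  g i = IntegerHomomorphism.ι ℤ→ℝ (c i) ℝᴿ.* b i j

vectorOperations : VectorOperations ℝ-commutativeRing ℤ→ℝ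
vectorOperations = record
  { _·ᴿ_           = _·_
  ; combinationᴿ   = combination
  ; combinationᶻ   = ℤ-combination
  ; ·-∑            = λ v w → ℝᴿ.refl {v · w}
  ; combinationᴿ-∑  = λ c b j → ℝᴿ.refl {combination c b j}
  ; combinationᶻ-∑ = combinationᶻ-≈ }

isInverseRootThree : IsInverseRootThree ℝ-commutativeRing ℤ→ℝ 1/√3
isInverseRootThree = record { r²*3≈1 = 1/√3-squared ; ι-injective = fromℤ-injective }

module _ {n : ℕ} (n≢0 : NonZero n) (i₀ : Fin n) (A : Vector ℤ n → Set) (ternary : MinimalTernary A) where

  open ScaledLattice ℝ-commutativeRing ℤ→ℝ vectorOperations 1/√3 isInverseRootThree A ternary
  open MinimalTernary ternary using (3-unit)
  open Embedding ℝ-commutativeRing ℤ→ℝ using (embed)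

  Lattice : Subset n
  Lattice = Lat 1/√3

  isLattice : ∀ s s′ → s′ ℝᴿ.* s ≈ 1ℝ → IsLattice n (Lat s)
  isLattice s s′ unit = scaledBasis s , basis-independent s s′ unit
                      , (λ {v} → lattice⇒span s v) , λ {v} → span⇒lattice s v

  embed-refl : ∀ (u : Vector ℤ n) → embed 1/√3 u ≋ embed 1/√3 u
  embed-refl u i = ℝᴿ.refl {embed 1/√3 u i}

  norm≈3 : ∀ u v → MinimalTernary.Short ternary u → v ≋ embed 1/√3 u → norm v ≈ fromℤ (+ 3)
  norm≈3 u v Su v≋ = short-norm {v} {u} Su v≋

  nonzero : ∀ u v → MinimalTernary.Short ternary u → v ≋ embed 1/√3 u → NonzeroVec v
  nonzero u v Su v≋ = norm≢0 {v} (+ 3) (norm≈3 u v Su v≋) λ ()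

  short∈ : ∀ u v → MinimalTernary.Short ternary u → v ≋ embed 1/√3 u →
           v ∈ Lattice × NonzeroVec v × norm v ≈ fromℤ (+ 3)
  short∈ u v Su v≋ = (u , proj₁ Su , v≋) , nonzero u v Su v≋ , norm≈3 u v Su v≋

  minimalVector : ∃[ v ] (v ∈ Lattice × NonzeroVec v × norm v ≈ fromℤ (+ 3))
  minimalVector = embed 1/√3 u , short∈ u (embed 1/√3 u) (3-unit i₀) (embed-refl u)
    where
    u : Vector ℤ n
    u = [ + 3 ] i₀

  isMinimumNorm : ∀ x → x ≈ fromℤ (+ 3) → IsMinimumNorm Lattice x
  isMinimumNorm x x≈3 = attained minimalVector
    , λ w w∈ w≢0 → let z , 3≤z , norm≈ = minimum w w∈ w≢0 in ≤-fromℤ x (norm w) (+ 3) z x≈3 norm≈ 3≤z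
    where
    attained : ∃[ v ] (v ∈ Lattice × NonzeroVec v × norm v ≈ fromℤ (+ 3)) →
               ∃[ v ] (v ∈ Lattice × NonzeroVec v × norm v ≈ x)
    attained (v , v∈ , v≢0 , norm≈) = v , v∈ , v≢0
      , ℝᴿ.trans {norm v} {fromℤ (+ 3)} {x} norm≈ (ℝᴿ.sym {x} {fromℤ (+ 3)} x≈3)

  irreducible : Irreducible Lattice
  irreducible D = indecomposable i₀ {M₁} {M₂}
    (λ v → proj₁ M₁-sub {v}) (λ v → proj₁ M₂-sub {v}) orthogonal decompose M₁-nonzero M₂-nonzero
    where open OrthogonalDecomposition D

  0≤√3 : 0ℝ ≤ √3
  0≤√3 ε ε>0 = 0 , λ i _ → subst (ℚ._< seq √3 i ℚ.+ ε) (ℚ.+-identityʳ 0ℚ)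
    (ℚ.+-mono-≤-< (*-nonNeg 0≤3 (ℚ.≤-trans 0≤½ (Newton.newton≥½ i))) ε>0)

  isometry : Isometry (Scaled √3 Lattice) (Lat 1ℝ)
  isometry = record
    { bijection = record
      { to = λ u → proj₁ u , scaled⇒integral (proj₁ u) (proj₂ u)
      ; cong = id
      ; bijective = id , λ v → (proj₁ v , integral⇒scaled (proj₁ v) (proj₂ v)) , id }
    ; additive  = λ u v w eq → eq
    ; isometric = λ u v → ℝᴿ.refl {proj₁ u · proj₁ v} }

  integrable : Integrable 3 Lattice
  integrable = √3 , (0≤√3 , √3*√3≈3) , n , n≢0 , Lat 1ℝ
    , ((λ {v} → integral-coordinates v) , n , isLattice 1ℝ 1ℝ (ℝᴿ.*-identityˡ 1ℝ))
    , isometry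

  short∈Min : ∀ u v → MinimalTernary.Short ternary u → v ≋ embed 1/√3 u → v ∈ Min Lattice
  short∈Min u v Su v≋ = let v∈ , v≢0 , norm≈ = short∈ u v Su v≋ in v∈ , v≢0 , isMinimumNorm (norm v) norm≈

  generatedByMinimalVectors : GeneratedByMinimalVectors Lattice
  generatedByMinimalVectors =
      (λ {v} → generatedBy-short (Min Lattice) short∈Min v)
    , λ { {v} (l , s , s∈ , c , v≋) → combination∈ {l} v c s (λ i → proj₁ (s∈ i)) v≋ }

  minimalTernaryLattice : Σ[ L ∈ Subset n ]
      ( IsLattice n L
      × Unimodular L
      × HasOddNormVector L
      × Irreducible L
      × IsMinimumNorm L (fromℤ (+ 3))
      × Integrable 3 L
      × GeneratedByMinimalVectors L )
  minimalTernaryLattice = Lattice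
    , isLattice 1/√3 √3 √3*r≈1
    , ((λ {v} → lattice⊆dual v) , λ {v} → dual⊆lattice v)
    , oddNormVector minimalVector
    , irreducible
    , isMinimumNorm (fromℤ (+ 3)) (ℝᴿ.refl {fromℤ (+ 3)})
    , integrable
    , generatedByMinimalVectors
    where
    oddNormVector : ∃[ v ] (v ∈ Lattice × NonzeroVec v × norm v ≈ fromℤ (+ 3)) → HasOddNormVector Lattice
    -- 3 = 1 + 2 · 1.
    oddNormVector (v , v∈ , _ , norm≈) = v , v∈ , + 1 , norm≈

theorem1p1 : (m : ℕ) .{{_ : NonZero m}} →
    Σ[ L ∈ Subset (24 * m) ]
    ( IsLattice (24 * m) L
    × Unimodular L
    × HasOddNormVector L
    × Irreducible L
    × IsMinimumNorm L (fromℤ (+ 3))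
    × Integrable 3 L
    × GeneratedByMinimalVectors L )
theorem1p1 (suc m) = minimalTernaryLattice _ zero (ChainCode (suc m)) (chainCode m)
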